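{- Let $m\geq 3$ be an integer. Let $C, D$ be sets of nonnegative integers such that $C\cup D=[0, m]$ (the set of all integers $i$ with $0\le i\le m$), $C\cap D=\{r_{1}, r_{2}\}$ with $r_{1}<r_{2}$, and $0\in C$. Suppose $r_{1}$ is even. Then $R_{C}(n)=R_{D}(n)$ for every nonnegative integer $n$ if and only if there exists a positive integer $l$ such that $r_{1}=2^{2l+1}-2$, $r_{2}=2^{2l+1}-1$, $m=2^{2l+2}-3$ and $$ C=A_{2l+1}\cup (2^{2l+1}-2+B_{2l+1}), \qquad D=B_{2l+1}\cup (2^{2l+1}-2+A_{2l+1}).$$
   Context: $\mathbb{N}$ denotes the set of all nonnegative integers. For $S\subseteq \mathbb{N}$ and $n\in\mathbb{N}$, the representation function $R_{S}(n)$ is the number of solutions of $n=s+s'$ with $s,s'\in S$ and $s<s'$. Let $A$ be the set of all nonnegative integers whose binary representation contains an even number of digits $1$ (the Thue–Morse set), and $B=\mathbb{N}\setminus A$. For a positive integer $l$, $A_{l}=A\cap[0,2^{l}-1]$ and $B_{l}=B\cap[0,2^{l}-1]$. For an integer $t$ and a set $X$, $t+X=\{t+x: x\in X\}$. -}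

module Defs where

open import Data.Nat using (ℕ; zero; suc; _+_; _*_; _∸_; _^_; _<ᵇ_; _≤ᵇ_; _≡ᵇ_)
open import Data.Nat.Base using (_/_)
open import Relation.Binary.PropositionalEquality using (_≡_)
open import Data.Bool using (Bool; true; false; not; _∧_; _∨_; if_then_else_)

NSet : Set
NSet = ℕ → Bool

-- parity of the number of 1 digits in the binary expansion of n
-- (fuel argument ≥ n guarantees termination; halving reaches 0 within n steps)
oddOnesAux : ℕ → ℕ → Bool
oddOnesAux zero    n = false
oddOnesAux (suc f) zero = false
oddOnesAux (suc f) (suc k) =
  let n = suc k in
  (if (n / 2) * 2 <ᵇ n then not (oddOnesAux f (n / 2)) else oddOnesAux f (n / 2))

oddOnes : ℕ → Bool
oddOnes n = oddOnesAux n n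

-- Thue–Morse set A: even number of binary 1s;  B = ℕ \ A
A : NSet
A n = not (oddOnes n)

B : NSet
B n = oddOnes n

trunc : ℕ → NSet → NSet
trunc l X n = X n ∧ (n <ᵇ 2 ^ l)

A_ : ℕ → NSet
A_ l = trunc l A

B_ : ℕ → NSet
B_ l = trunc l B

shift : ℕ → NSet → NSet
shift t X n = (t ≤ᵇ n) ∧ X (n ∸ t)

_∪ˢ_ : NSet → NSet → NSet
(X ∪ˢ Y) n = X n ∨ Y n

_∩ˢ_ : NSet → NSet → NSet
(X ∩ˢ Y) n = X n ∧ Y n

countBelow : (ℕ → Bool) → ℕ → ℕ
countBelow P zero = 0
countBelow P (suc k) = countBelow P k + (if P k then 1 else 0)

-- R_S(n) = #{(s, s') : s + s' = n, s, s' ∈ S, s < s'}  (s determines s' = n - s)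
R : NSet → ℕ → ℕ
R S n = countBelow (λ s → (s <ᵇ n ∸ s) ∧ S s ∧ S (n ∸ s)) (suc n)

_≐_ : NSet → NSet → Set
X ≐ Y = ∀ n → X n ≡ Y n

interval : ℕ → NSet
interval m n = n ≤ᵇ m

pair : ℕ → ℕ → NSet
pair a b n = (n ≡ᵇ a) ∨ (n ≡ᵇ b)

{-# OPTIONS --safe #-}
-- Let t and P be the difference and the sum of the generating polynomials of C and D.  Equality of the
-- representation functions says t(x) P(x) = t(x²), where P(x) = 1 + x + … + x^m + x^r₁ + x^r₂.
-- Write t = (1 − x)^k u with u(1) ≠ 0.  Then u(x) P(x) = (1 + x)^k u(x²), and x = 1 gives m + 3 = 2^k.
-- Now divide out 1 + x, 1 + x², 1 + x⁴, … in turn: each of these polynomials is prime in ℤ[x], so whatever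
-- part of the power of 1 + x^(2^j) does not divide P divides t, and is passed on as a power of 1 + x^(2^(j+1)).
-- For j ≥ k this must stop, hence the multiplicities of the factors 1 + x^(2^j), j < k, in P add up to k.
-- If 1 + x^(2^j) divides P then 2^(j+1) divides r₁ + 2 and r₂ + 1, so j = k − 1 is impossible and some factor
-- occurs twice.  A double factor occurs only for j = 1, and gives r₂ = r₁ + 1 and m = r₁ + r₂.  Finally
-- t(x) P(x) = t(x²) determines t from t(0) = 1, and the solution is
-- (1 − x^r₁) (1 − x) (1 − x²) … (1 − x^(2^(k−2))); its coefficient at r₁ vanishes only if k is even.
module Submission where

open import Defs

-- The equation t(x) P(x) = t(x²) comes from S(x)² = 2 ∑ R_S(n) xⁿ + S(x²): subtracting it for C and
-- D leaves a difference of squares on the left. Everything takes place in ℤ[x], without roots of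
-- unity and without unique factorisation. Polynomials are only cancelled when their constant term
-- is 1, where an induction on coefficients suffices. Primality of 1 + x^(2^j) rests on (1 -
-- x)^(2^j) ≡ 1 + x^(2^j) modulo 2, together with the value 2 at x = 1. Evaluation at a root ζ of 1
-- + x^N is replaced by a linear functional on coefficients whose weights satisfy w (N + n) = - w n.
-- The divisibilities arise because 2N divides m + 3: then ζ annihilates 1 + ... + x^(m+2), so ζ^r₁
-- + ζ^r₂ = ζ⁻¹ + ζ⁻², and the parity of r₁ decides which exponent matches which. A double root adds
-- a relation between derivatives, and that one involves the sizes of r₁, r₂ and m, not only their
-- residues.

module Theory where

  open import Algebra.Bundles using (CommutativeRing)
  import Algebra.Properties.CommutativeSemiring.Exp as CExp
  import Algebra.Properties.Semiring.Exp as Exp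
  import Algebra.Solver.Ring as RingSolver
  open import Algebra.Solver.Ring.AlmostCommutativeRing
    using (AlmostCommutativeRing; fromCommutativeRing; _-Raw-AlmostCommutative⟶_)
  open import Algebra.Structures using (IsCommutativeRing)
  open import Data.Bool.Base using (Bool; true; false; if_then_else_; _∧_; _∨_; not; T)
  import Data.Bool.Properties as 𝔹ₚ
  open import Data.Integer.Base as ℤ using (ℤ; +_; _+_; _*_; -_; 0ℤ; 1ℤ; -1ℤ)
  import Data.Integer.Divisibility.Signed as ℤ∣
  import Data.Integer.Properties as ℤₚ
  open import Data.Integer.Tactic.RingSolver using (solve-∀)
  open import Data.Maybe.Base using (Maybe; just; nothing)
  open import Data.Nat.Base as ℕ using (ℕ; zero; suc; _≤_; _<_; z≤n; s≤s; _^_; NonZero)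
  import Data.Nat.Divisibility as ℕ∣
  open import Data.Nat.DivMod
    using (_/_; _%_; [m+n]%n≡m%n; +-distrib-/-∣ˡ; +-distrib-/-∣ʳ; n/n≡1; m*n/n≡m; m/n<m; m≡m%n+[m/n]*n)
  open import Data.Nat.Induction using (<-rec)
  open import Data.Nat.Primality using (euclidsLemma; prime[2])
  import Data.Nat.Properties as ℕₚ
  open import Data.Nat.Tactic.RingSolver using () renaming (solve-∀ to ℕ-solve-∀)
  open import Data.Product using (Σ; _,_; ∃; ∃₂; proj₁; proj₂; _×_)
  open import Data.Sum using (_⊎_; inj₁; inj₂; map)
  open import Function.Base using (_∘_; case_of_)
  open import Relation.Binary.PropositionalEquality hiding ([_])
  import Relation.Binary.Reasoning.Setoid as SetoidReasoning
  open import Relation.Nullary using (¬_; yes; no; contradiction)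
  open import Algebra.Properties.AbelianGroup ℤₚ.+-0-abelianGroup using (∙-cancelˡ)

  -- Polynomials as finitely supported coefficient sequences

  Series : Set
  Series = ℕ → ℤ

  conv : Series → Series → Series
  conv f g zero    = f 0 * g 0
  conv f g (suc n) = f 0 * g (suc n) + conv (f ∘ suc) g n

  conv-cong : ∀ {f f′ g g′} → (∀ i → f i ≡ f′ i) → (∀ i → g i ≡ g′ i) → ∀ n → conv f g n ≡ conv f′ g′ n
  conv-cong p q zero    = cong₂ _*_ (p 0) (q 0)
  conv-cong p q (suc n) = cong₂ _+_ (cong₂ _*_ (p 0) (q (suc n))) (conv-cong (p ∘ suc) q n)

  -- The recursion of `conv` strips the left factor; this strips the right one. Commutativity is the
  -- agreement of the two.
  conv-sucʳ : ∀ f g n → conv f g (suc n) ≡ conv f (g ∘ suc) n + f (suc n) * g 0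
  conv-sucʳ f g zero    = refl
  conv-sucʳ f g (suc n) = trans (cong (_+_ (f 0 * g (suc (suc n)))) (conv-sucʳ (f ∘ suc) g n))
                                (sym (ℤₚ.+-assoc (f 0 * g (suc (suc n))) (conv (f ∘ suc) (g ∘ suc) n) _))

  conv-comm : ∀ f g n → conv f g n ≡ conv g f n
  conv-comm f g zero    = ℤₚ.*-comm (f 0) (g 0)
  conv-comm f g (suc n) = begin
    f 0 * g (suc n) + conv (f ∘ suc) g n  ≡⟨ cong₂ _+_ (ℤₚ.*-comm (f 0) (g (suc n))) (conv-comm (f ∘ suc) g n) ⟩
    g (suc n) * f 0 + conv g (f ∘ suc) n  ≡⟨ ℤₚ.+-comm (g (suc n) * f 0) _ ⟩
    conv g (f ∘ suc) n + g (suc n) * f 0  ≡⟨ conv-sucʳ g f n ⟨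
    conv g f (suc n)                      ∎
    where open ≡-Reasoning

  conv-distribʳ : ∀ f g h n → conv (λ i → f i + g i) h n ≡ conv f h n + conv g h n
  conv-distribʳ f g h zero    = ℤₚ.*-distribʳ-+ (h 0) (f 0) (g 0)
  conv-distribʳ f g h (suc n) =
    trans (cong (_+_ ((f 0 + g 0) * h (suc n))) (conv-distribʳ (f ∘ suc) (g ∘ suc) h n))
          (rearrange (f 0) (g 0) (h (suc n)) (conv (f ∘ suc) h n) (conv (g ∘ suc) h n))
    where
    rearrange : ∀ a b c u v → (a + b) * c + (u + v) ≡ (a * c + u) + (b * c + v)
    rearrange = solve-∀

  conv-scaleˡ : ∀ c f g n → conv (λ i → c * f i) g n ≡ c * conv f g n
  conv-scaleˡ c f g zero    = ℤₚ.*-assoc c (f 0) (g 0)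
  conv-scaleˡ c f g (suc n) =
    trans (cong (_+_ (c * f 0 * g (suc n))) (conv-scaleˡ c (f ∘ suc) g n))
          (rearrange c (f 0) (g (suc n)) (conv (f ∘ suc) g n))
    where
    rearrange : ∀ a b c u → a * b * c + a * u ≡ a * (b * c + u)
    rearrange = solve-∀

  conv-zeroˡ : ∀ f g n → (∀ i → i ≤ n → f i ≡ 0ℤ) → conv f g n ≡ 0ℤ
  conv-zeroˡ f g zero    f≡0 = cong (_* g 0) (f≡0 0 z≤n)
  conv-zeroˡ f g (suc n) f≡0 = cong₂ _+_ (cong (_* g (suc n)) (f≡0 0 z≤n)) (conv-zeroˡ (f ∘ suc) g n (λ i i≤n → f≡0 (suc i) (s≤s i≤n)))

  conv-assoc : ∀ f g h n → conv (conv f g) h n ≡ conv f (conv g h) n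
  conv-assoc f g h zero    = ℤₚ.*-assoc (f 0) (g 0) (h 0)
  conv-assoc f g h (suc n) = begin
    f 0 * g 0 * h (suc n) + conv (λ i → f 0 * g (suc i) + conv (f ∘ suc) g i) h n
      ≡⟨ cong (_+_ (f 0 * g 0 * h (suc n))) (conv-distribʳ (λ i → f 0 * g (suc i)) (conv (f ∘ suc) g) h n) ⟩
    f 0 * g 0 * h (suc n) + (conv (λ i → f 0 * g (suc i)) h n + conv (conv (f ∘ suc) g) h n)
      ≡⟨ cong (_+_ (f 0 * g 0 * h (suc n))) (cong₂ _+_ (conv-scaleˡ (f 0) (g ∘ suc) h n) (conv-assoc (f ∘ suc) g h n)) ⟩
    f 0 * g 0 * h (suc n) + (f 0 * conv (g ∘ suc) h n + conv (f ∘ suc) (conv g h) n)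
      ≡⟨ rearrange (f 0) (g 0) (h (suc n)) _ _ ⟩
    f 0 * (g 0 * h (suc n) + conv (g ∘ suc) h n) + conv (f ∘ suc) (conv g h) n ∎
    where
    open ≡-Reasoning
    rearrange : ∀ a b c u v → a * b * c + (a * u + v) ≡ a * (b * c + u) + v
    rearrange = solve-∀

  -- The bound is any bound for the support, not the degree, so no operation has to detect a
  -- vanishing leading coefficient; `_≈_` ignores it.
  record Poly : Set where
    no-eta-equality
    constructor poly
    field
      coeff  : Series
      bound  : ℕ
      vanish : ∀ n → bound ≤ n → coeff n ≡ 0ℤ
  open Poly public

  infix 4 _≈_
  record _≈_ (p q : Poly) : Set where
    constructor coeffs
    field at : ∀ n → coeff p n ≡ coeff q n
  open _≈_ public

  ≈-refl : ∀ {p} → p ≈ p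
  ≈-refl = coeffs λ _ → refl

  infixl 6 _⊕_
  infixl 7 _⊛_
  infix  8 ⊝_
  infix  9 _[X²]

  constant : ℤ → Series
  constant c zero    = c
  constant c (suc _) = 0ℤ

  shiftUp : Series → Series
  shiftUp f zero    = 0ℤ
  shiftUp f (suc n) = f n

  conv-vanish : ∀ d e f g → (∀ n → d ≤ n → f n ≡ 0ℤ) → (∀ n → e ≤ n → g n ≡ 0ℤ) →
                ∀ n → d ℕ.+ e ≤ n → conv f g n ≡ 0ℤ
  conv-vanish zero    e f g f≡0 g≡0 n le = conv-zeroˡ f g n (λ i _ → f≡0 i z≤n)
  conv-vanish (suc d) e f g f≡0 g≡0 (suc n) (s≤s le) =
    cong₂ _+_ (trans (cong (f 0 *_) (g≡0 (suc n) (ℕₚ.≤-trans (ℕₚ.m≤n+m e d) (ℕₚ.m≤n⇒m≤1+n le)))) (ℤₚ.*-zeroʳ (f 0)))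
              (conv-vanish d e (f ∘ suc) g (λ i le′ → f≡0 (suc i) (s≤s le′)) g≡0 n le)

  conv-constantˡ : ∀ c f n → conv (constant c) f n ≡ c * f n
  conv-constantˡ c f zero    = refl
  conv-constantˡ c f (suc n) = trans (cong (_+_ (c * f (suc n))) (conv-zeroˡ (λ _ → 0ℤ) f n (λ _ _ → refl))) (ℤₚ.+-identityʳ _)

  -- The lowest-order term of a product. With `g 0` equal to 1 it drives both the cancellation law
  -- and the uniqueness of solutions of the functional equation.
  conv-lowest : ∀ f g n → (∀ i → i < n → f i ≡ 0ℤ) → conv f g n ≡ f n * g 0
  conv-lowest f g zero    _   = refl
  conv-lowest f g (suc n) f≡0 =
    trans (cong₂ _+_ (cong (_* g (suc n)) (f≡0 0 (s≤s z≤n))) (conv-lowest (f ∘ suc) g n λ i i<n → f≡0 (suc i) (s≤s i<n)))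
          (ℤₚ.+-identityˡ _)

  -- A weight `w` acts as a linear functional on polynomials: the constant weight 1 is evaluation at
  -- 1, and a weight n ↦ ζⁿ would be evaluation at ζ.
  pairs : ℕ → Series → Series → ℤ
  pairs zero    w f = 0ℤ
  pairs (suc d) w f = w 0 * f 0 + pairs d (w ∘ suc) (f ∘ suc)

  pairs-zero : ∀ d w f → (∀ n → w n * f n ≡ 0ℤ) → pairs d w f ≡ 0ℤ
  pairs-zero zero    w f _   = refl
  pairs-zero (suc d) w f w*f = cong₂ _+_ (w*f 0) (pairs-zero d (w ∘ suc) (f ∘ suc) (w*f ∘ suc))

  pairs-extend : ∀ {d e} w f → (∀ n → d ≤ n → f n ≡ 0ℤ) → d ≤ e → pairs d w f ≡ pairs e w f
  pairs-extend {e = e} w f f≡0 z≤n = sym (pairs-zero e w f λ n → trans (cong (w n *_) (f≡0 n z≤n)) (ℤₚ.*-zeroʳ (w n)))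
  pairs-extend w f f≡0 (s≤s le) = cong (_+_ (w 0 * f 0)) (pairs-extend (w ∘ suc) (f ∘ suc) (λ n le′ → f≡0 (suc n) (s≤s le′)) le)

  pairs-cong : ∀ d {w w′ f f′} → (∀ n → w n ≡ w′ n) → (∀ n → f n ≡ f′ n) → pairs d w f ≡ pairs d w′ f′
  pairs-cong zero    _ _ = refl
  pairs-cong (suc d) p q = cong₂ _+_ (cong₂ _*_ (p 0) (q 0)) (pairs-cong d (p ∘ suc) (q ∘ suc))

  pairs-+ʳ : ∀ d w f g → pairs d w (λ n → f n + g n) ≡ pairs d w f + pairs d w g
  pairs-+ʳ zero    w f g = refl
  pairs-+ʳ (suc d) w f g = trans (cong (_+_ (w 0 * (f 0 + g 0))) (pairs-+ʳ d (w ∘ suc) (f ∘ suc) (g ∘ suc)))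
                                 (rearrange (w 0) (f 0) (g 0) _ _)
    where
    rearrange : ∀ a b c u v → a * (b + c) + (u + v) ≡ (a * b + u) + (a * c + v)
    rearrange = solve-∀

  pairs-+ˡ : ∀ d v w f → pairs d (λ n → v n + w n) f ≡ pairs d v f + pairs d w f
  pairs-+ˡ zero    v w f = refl
  pairs-+ˡ (suc d) v w f = trans (cong (_+_ ((v 0 + w 0) * f 0)) (pairs-+ˡ d (v ∘ suc) (w ∘ suc) (f ∘ suc)))
                                 (rearrange (v 0) (w 0) (f 0) _ _)
    where
    rearrange : ∀ a b c u v → (a + b) * c + (u + v) ≡ (a * c + u) + (b * c + v)
    rearrange = solve-∀

  pairs-scale : ∀ d c w f → pairs d w (λ n → c * f n) ≡ c * pairs d w f
  pairs-scale zero    c w f = sym (ℤₚ.*-zeroʳ c)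
  pairs-scale (suc d) c w f = trans (cong (_+_ (w 0 * (c * f 0))) (pairs-scale d c (w ∘ suc) (f ∘ suc)))
                                 (rearrange c (w 0) (f 0) _)
    where
    rearrange : ∀ c a b u → a * (c * b) + c * u ≡ c * (a * b + u)
    rearrange = solve-∀

  -- The coefficients of f(x²).
  spread : Series → Series
  spread f zero          = f 0
  spread f (suc zero)    = 0ℤ
  spread f (suc (suc n)) = spread (f ∘ suc) n

  spread-cong : ∀ {f g} → (∀ n → f n ≡ g n) → ∀ n → spread f n ≡ spread g n
  spread-cong e zero          = e 0
  spread-cong e (suc zero)    = refl
  spread-cong e (suc (suc n)) = spread-cong (e ∘ suc) n

  spread-zero : ∀ f n → (∀ i → i ≤ n → f i ≡ 0ℤ) → spread f n ≡ 0ℤ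
  spread-zero f zero          f≡0 = f≡0 0 z≤n
  spread-zero f (suc zero)    f≡0 = refl
  spread-zero f (suc (suc n)) f≡0 = spread-zero (f ∘ suc) n λ i i≤n → f≡0 (suc i) (s≤s (ℕₚ.m≤n⇒m≤1+n i≤n))

  spread-vanish : ∀ d f → (∀ n → d ≤ n → f n ≡ 0ℤ) → ∀ n → d ℕ.+ d ≤ n → spread f n ≡ 0ℤ
  spread-vanish zero    f f≡0 n             _        = spread-zero f n λ i _ → f≡0 i z≤n
  spread-vanish (suc d) f f≡0 (suc zero)    _        = refl
  spread-vanish (suc d) f f≡0 (suc (suc n)) (s≤s le) =
    spread-vanish d (f ∘ suc) (λ i le′ → f≡0 (suc i) (s≤s le′)) n (ℕₚ.≤-pred (subst (_≤ suc n) (ℕₚ.+-suc d d) le))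

  spread-+ : ∀ f g n → spread (λ i → f i + g i) n ≡ spread f n + spread g n
  spread-+ f g zero          = refl
  spread-+ f g (suc zero)    = refl
  spread-+ f g (suc (suc n)) = spread-+ (f ∘ suc) (g ∘ suc) n

  spread-scale : ∀ c f n → spread (λ i → c * f i) n ≡ c * spread f n
  spread-scale c f zero          = refl
  spread-scale c f (suc zero)    = sym (ℤₚ.*-zeroʳ c)
  spread-scale c f (suc (suc n)) = spread-scale c (f ∘ suc) n

  spread-- : ∀ f n → spread (λ i → - f i) n ≡ - spread f n
  spread-- f zero          = refl
  spread-- f (suc zero)    = refl
  spread-- f (suc (suc n)) = spread-- (f ∘ suc) n

  spread-conv : ∀ f g n → spread (conv f g) n ≡ conv (spread f) (spread g) n
  spread-conv f g zero          = refl
  spread-conv f g (suc zero)    = sym (trans (ℤₚ.+-identityʳ _) (ℤₚ.*-zeroʳ (f 0)))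
  spread-conv f g (suc (suc n)) = begin
    spread (λ i → f 0 * g (suc i) + conv (f ∘ suc) g i) n
      ≡⟨ spread-+ (λ i → f 0 * g (suc i)) (conv (f ∘ suc) g) n ⟩
    spread (λ i → f 0 * g (suc i)) n + spread (conv (f ∘ suc) g) n
      ≡⟨ cong₂ _+_ (spread-scale (f 0) (g ∘ suc) n) (spread-conv (f ∘ suc) g n) ⟩
    f 0 * spread (g ∘ suc) n + conv (spread (f ∘ suc)) (spread g) n
      ≡⟨ cong (_+_ (f 0 * spread (g ∘ suc) n)) (ℤₚ.+-identityˡ _) ⟨
    f 0 * spread (g ∘ suc) n + (0ℤ + conv (spread (f ∘ suc)) (spread g) n) ∎
    where open ≡-Reasoning

  n≤1+pred[n] : ∀ n → n ≤ suc (ℕ.pred n)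
  n≤1+pred[n] zero    = z≤n
  n≤1+pred[n] (suc n) = ℕₚ.≤-refl

  tail : Poly → Poly
  tail p = poly (coeff p ∘ suc) (ℕ.pred (bound p)) λ n le → vanish p (suc n) (ℕₚ.≤-trans (n≤1+pred[n] (bound p)) (s≤s le))

  opaque
    C : ℤ → Poly
    C c = poly (constant c) 1 λ { (suc _) _ → refl }

    _⊕_ : Poly → Poly → Poly
    p ⊕ q = poly (λ n → coeff p n + coeff q n) (bound p ℕ.+ bound q) λ n le →
      cong₂ _+_ (vanish p n (ℕₚ.≤-trans (ℕₚ.m≤m+n (bound p) (bound q)) le))
                (vanish q n (ℕₚ.≤-trans (ℕₚ.m≤n+m (bound q) (bound p)) le))

    ⊝_ : Poly → Poly
    ⊝ p = poly (λ n → - coeff p n) (bound p) λ n le → cong -_ (vanish p n le)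

    _⊛_ : Poly → Poly → Poly
    p ⊛ q = poly (conv (coeff p) (coeff q)) (bound p ℕ.+ bound q)
      (conv-vanish (bound p) (bound q) (coeff p) (coeff q) (vanish p) (vanish q))

    X : Poly
    X = poly (shiftUp (constant 1ℤ)) 2 λ { (suc zero) (s≤s ()) ; (suc (suc _)) _ → refl }

    _[X²] : Poly → Poly
    _[X²] p = poly (spread (coeff p)) (bound p ℕ.+ bound p) (spread-vanish (bound p) (coeff p) (vanish p))

    coeff-⊕ : ∀ p q n → coeff (p ⊕ q) n ≡ coeff p n + coeff q n
    coeff-⊕ p q n = refl

    coeff-⊝ : ∀ p n → coeff (⊝ p) n ≡ - coeff p n
    coeff-⊝ p n = refl

    coeff-⊛ : ∀ p q n → coeff (p ⊛ q) n ≡ conv (coeff p) (coeff q) n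
    coeff-⊛ p q n = refl

    coeff-[X²] : ∀ p n → coeff (p [X²]) n ≡ spread (coeff p) n
    coeff-[X²] p n = refl

    coeff-C : ∀ c n → coeff (C c) n ≡ constant c n
    coeff-C c n = refl

    coeff-X⊛ : ∀ p n → coeff (X ⊛ p) n ≡ shiftUp (coeff p) n
    coeff-X⊛ p zero    = refl
    coeff-X⊛ p (suc n) = trans (ℤₚ.+-identityˡ _) (trans (conv-constantˡ 1ℤ (coeff p) n) (ℤₚ.*-identityˡ _))

    C-+ : ∀ a b → C (a + b) ≈ C a ⊕ C b
    C-+ a b = coeffs λ { zero → refl ; (suc _) → refl }

    C-* : ∀ a b → C (a * b) ≈ C a ⊛ C b
    C-* a b = coeffs λ { zero → refl ; (suc n) → sym (trans (conv-constantˡ a (constant b) (suc n)) (ℤₚ.*-zeroʳ a)) }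

    C-- : ∀ a → C (- a) ≈ ⊝ C a
    C-- a = coeffs λ { zero → refl ; (suc _) → refl }

    head-tail : ∀ p → p ≈ C (coeff p 0) ⊕ X ⊛ tail p
    head-tail p = coeffs λ
      { zero    → sym (ℤₚ.+-identityʳ _)
      ; (suc n) → sym (trans (ℤₚ.+-identityˡ _) (coeff-X⊛ (tail p) (suc n))) }

    poly-isCommutativeRing : IsCommutativeRing _≈_ _⊕_ _⊛_ ⊝_ (C 0ℤ) (C 1ℤ)
    poly-isCommutativeRing = record
        { isRing = record
          { +-isAbelianGroup = record
            { isGroup = record
              { isMonoid = record
                { isSemigroup = record
                  { isMagma = record
                    { isEquivalence = record
                      { refl = ≈-refl
                      ; sym = λ e → coeffs λ n → sym (at e n)
                      ; trans = λ e e′ → coeffs λ n → trans (at e n) (at e′ n) }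
                    ; ∙-cong = λ e e′ → coeffs λ n → cong₂ _+_ (at e n) (at e′ n) }
                  ; assoc = λ p q r → coeffs λ n → ℤₚ.+-assoc (coeff p n) _ _ }
                ; identity = (λ p → coeffs λ { zero → ℤₚ.+-identityˡ _ ; (suc n) → ℤₚ.+-identityˡ _ })
                           , (λ p → coeffs λ { zero → ℤₚ.+-identityʳ _ ; (suc n) → ℤₚ.+-identityʳ _ }) }
              ; inverse = (λ p → coeffs λ { zero → ℤₚ.+-inverseˡ (coeff p 0) ; (suc n) → ℤₚ.+-inverseˡ (coeff p (suc n)) })
                        , (λ p → coeffs λ { zero → ℤₚ.+-inverseʳ (coeff p 0) ; (suc n) → ℤₚ.+-inverseʳ (coeff p (suc n)) })
              ; ⁻¹-cong = λ e → coeffs λ n → cong -_ (at e n) }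
            ; comm = λ p q → coeffs λ n → ℤₚ.+-comm (coeff p n) (coeff q n) }
          ; *-cong = λ e e′ → coeffs (conv-cong (at e) (at e′))
          ; *-assoc = λ p q r → coeffs (conv-assoc (coeff p) (coeff q) (coeff r))
          ; *-identity = identityˡ , (λ p → coeffs λ n → trans (conv-comm (coeff p) (constant 1ℤ) n) (at (identityˡ p) n))
          ; distrib = (λ p q r → coeffs λ n → trans (conv-comm (coeff p) _ n)
                        (trans (conv-distribʳ (coeff q) (coeff r) (coeff p) n)
                               (cong₂ _+_ (conv-comm (coeff q) _ n) (conv-comm (coeff r) _ n))))
                    , (λ p q r → coeffs (conv-distribʳ (coeff q) (coeff r) (coeff p))) }
        ; *-comm = λ p q → coeffs (conv-comm (coeff p) (coeff q)) }
      where
      identityˡ : ∀ p → C 1ℤ ⊛ p ≈ p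
      identityˡ p = coeffs λ n → trans (conv-constantˡ 1ℤ (coeff p) n) (ℤₚ.*-identityˡ _)

    [X²]-cong : ∀ {p q} → p ≈ q → p [X²] ≈ q [X²]
    [X²]-cong e = coeffs (spread-cong (at e))

    [X²]-⊕ : ∀ p q → (p ⊕ q) [X²] ≈ p [X²] ⊕ q [X²]
    [X²]-⊕ p q = coeffs (spread-+ (coeff p) (coeff q))

    [X²]-⊝ : ∀ p → (⊝ p) [X²] ≈ ⊝ p [X²]
    [X²]-⊝ p = coeffs (spread-- (coeff p))

    [X²]-⊛ : ∀ p q → (p ⊛ q) [X²] ≈ p [X²] ⊛ q [X²]
    [X²]-⊛ p q = coeffs (spread-conv (coeff p) (coeff q))

    [X²]-C : ∀ c → C c [X²] ≈ C c
    [X²]-C c = coeffs λ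
      { zero          → refl
      ; (suc zero)    → refl
      ; (suc (suc n)) → spread-zero (λ _ → 0ℤ) n λ _ _ → refl }

    [X²]-X : X [X²] ≈ X ⊛ X
    [X²]-X = coeffs λ
      { zero                → refl
      ; (suc zero)          → refl
      ; (suc (suc zero))    → refl
      ; (suc (suc (suc n))) → trans (at ([X²]-C 1ℤ) (suc n)) (sym (coeff-X⊛ X (suc (suc (suc n))))) }

    ⟪_,_⟫ : Series → Poly → ℤ
    ⟪ w , p ⟫ = pairs (bound p) w (coeff p)

    pair-bound : ∀ w p {d} → bound p ≤ d → ⟪ w , p ⟫ ≡ pairs d w (coeff p)
    pair-bound w p = pairs-extend w (coeff p) (vanish p)

    pair-cong : ∀ {w w′ p q} → (∀ n → w n ≡ w′ n) → p ≈ q → ⟪ w , p ⟫ ≡ ⟪ w′ , q ⟫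
    pair-cong {w} {w′} {p} {q} w≗w′ p≈q = begin
      ⟪ w , p ⟫                               ≡⟨ pair-bound w p (ℕₚ.m≤m+n (bound p) (bound q)) ⟩
      pairs (bound p ℕ.+ bound q) w (coeff p)   ≡⟨ pairs-cong (bound p ℕ.+ bound q) w≗w′ (at p≈q) ⟩
      pairs (bound p ℕ.+ bound q) w′ (coeff q)  ≡⟨ pair-bound w′ q (ℕₚ.m≤n+m (bound q) (bound p)) ⟨
      ⟪ w′ , q ⟫                              ∎
      where open ≡-Reasoning

    pair-congʳ : ∀ w {p q} → p ≈ q → ⟪ w , p ⟫ ≡ ⟪ w , q ⟫
    pair-congʳ w = pair-cong {w} (λ _ → refl)

    pair-⊕ : ∀ w p q → ⟪ w , p ⊕ q ⟫ ≡ ⟪ w , p ⟫ + ⟪ w , q ⟫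
    pair-⊕ w p q = trans (pairs-+ʳ (bound p ℕ.+ bound q) w (coeff p) (coeff q))
      (cong₂ _+_ (sym (pair-bound w p (ℕₚ.m≤m+n (bound p) (bound q)))) (sym (pair-bound w q (ℕₚ.m≤n+m (bound q) (bound p)))))

    pair-scale : ∀ w c p → ⟪ w , C c ⊛ p ⟫ ≡ c * ⟪ w , p ⟫
    pair-scale w c p = begin
      ⟪ w , C c ⊛ p ⟫                                    ≡⟨⟩
      pairs (suc (bound p)) w (conv (constant c) (coeff p))  ≡⟨ pairs-cong (suc (bound p)) {w = w} (λ _ → refl) (conv-constantˡ c (coeff p)) ⟩
      pairs (suc (bound p)) w (λ n → c * coeff p n)          ≡⟨ pairs-scale (suc (bound p)) c w (coeff p) ⟩
      c * pairs (suc (bound p)) w (coeff p)                  ≡⟨ cong (c *_) (pair-bound w p (ℕₚ.n≤1+n _)) ⟨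
      c * ⟪ w , p ⟫                                      ∎
      where open ≡-Reasoning

    pair-⊝ : ∀ w p → ⟪ w , ⊝ p ⟫ ≡ - ⟪ w , p ⟫
    pair-⊝ w p = begin
      ⟪ w , ⊝ p ⟫        ≡⟨ pair-congʳ w ⊝p≈-1p ⟩
      ⟪ w , C -1ℤ ⊛ p ⟫  ≡⟨ pair-scale w -1ℤ p ⟩
      -1ℤ * ⟪ w , p ⟫    ≡⟨ ℤₚ.-1*i≡-i _ ⟩
      - ⟪ w , p ⟫        ∎
      where
      open ≡-Reasoning
      ⊝p≈-1p : ⊝ p ≈ C -1ℤ ⊛ p
      ⊝p≈-1p = coeffs λ n → sym (trans (conv-constantˡ -1ℤ (coeff p) n) (ℤₚ.-1*i≡-i (coeff p n)))

    -- Multiplication by x is adjoint to the shift of weights. This turns divisibility by 1 + x^N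
    -- into a recurrence on weights.
    pair-X⊛ : ∀ w p → ⟪ w , X ⊛ p ⟫ ≡ ⟪ w ∘ suc , p ⟫
    pair-X⊛ w p = begin
      ⟪ w , X ⊛ p ⟫               ≡⟨ pair-congʳ w X⊛p≈shifted ⟩
      ⟪ w , shifted ⟫             ≡⟨⟩
      w 0 * 0ℤ + ⟪ w ∘ suc , p ⟫  ≡⟨ cong (_+ ⟪ w ∘ suc , p ⟫) (ℤₚ.*-zeroʳ (w 0)) ⟩
      0ℤ + ⟪ w ∘ suc , p ⟫        ≡⟨ ℤₚ.+-identityˡ _ ⟩
      ⟪ w ∘ suc , p ⟫             ∎
      where
      open ≡-Reasoning
      -- The same polynomial with the bound `suc (bound p)`, so that the pairing unfolds to one zero
      -- term and the pairing with `p`.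
      shifted : Poly
      shifted = poly (shiftUp (coeff p)) (suc (bound p)) λ { (suc n) (s≤s le) → vanish p n le }
      X⊛p≈shifted : X ⊛ p ≈ shifted
      X⊛p≈shifted = coeffs (coeff-X⊛ p)

    pair-C : ∀ w c → ⟪ w , C c ⟫ ≡ w 0 * c
    pair-C w c = ℤₚ.+-identityʳ _

    pair-+ : ∀ v w p → ⟪ (λ n → v n + w n) , p ⟫ ≡ ⟪ v , p ⟫ + ⟪ w , p ⟫
    pair-+ v w p = pairs-+ˡ (bound p) v w (coeff p)

    pair-zero : ∀ w p → (∀ n → w n ≡ 0ℤ) → ⟪ w , p ⟫ ≡ 0ℤ
    pair-zero w p w≡0 = pairs-zero (bound p) w (coeff p) λ n → cong (_* coeff p n) (w≡0 n)

  polyRing : CommutativeRing _ _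
  polyRing = record { isCommutativeRing = poly-isCommutativeRing }

  almostRing : AlmostCommutativeRing _ _
  almostRing = fromCommutativeRing polyRing

  C-morphism : CommutativeRing.rawRing ℤₚ.+-*-commutativeRing -Raw-AlmostCommutative⟶ almostRing
  C-morphism = record
    { ⟦_⟧    = C
    ; +-homo = C-+
    ; *-homo = C-*
    ; -‿homo = C--
    ; 0-homo = ≈-refl
    ; 1-homo = ≈-refl
    }

  C-≟ : ∀ a b → Maybe (C a ≈ C b)
  C-≟ a b with a ℤₚ.≟ b
  ... | yes refl = just ≈-refl
  ... | no  _    = nothing

  module PolySolver = RingSolver (CommutativeRing.rawRing ℤₚ.+-*-commutativeRing) almostRing C-morphism C-≟
  open PolySolver using (solve; _:=_; _:+_; _:*_; _:-_; :-_; con)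

  -- Evaluation at 1, division by 1 − x, and the substitution x ↦ x²

  module Ring = CommutativeRing polyRing
  module ≈-Reasoning = SetoidReasoning Ring.setoid
  open Exp Ring.semiring using () renaming (_^_ to _↑_)

  infix 8 X^_

  X^_ : ℕ → Poly
  X^ n = X ↑ n

  X^-coeff : ∀ r p n → coeff (X^ r ⊛ p) (r ℕ.+ n) ≡ coeff p n
  X^-coeff zero    p n = at (Ring.*-identityˡ p) n
  X^-coeff (suc r) p n = trans (at (Ring.*-assoc X (X^ r) p) (suc r ℕ.+ n)) (trans (coeff-X⊛ (X^ r ⊛ p) (suc r ℕ.+ n)) (X^-coeff r p n))

  X^-+ : ∀ m n → X^ (m ℕ.+ n) ≈ X^ m ⊛ X^ n
  X^-+ = Exp.^-homo-* Ring.semiring X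

  pair-X^⊛ : ∀ N w p → ⟪ w , X^ N ⊛ p ⟫ ≡ ⟪ w ∘ (N ℕ.+_) , p ⟫
  pair-X^⊛ zero    w p = pair-congʳ w (Ring.*-identityˡ p)
  pair-X^⊛ (suc N) w p = trans (pair-congʳ w (Ring.*-assoc X (X^ N) p)) (trans (pair-X⊛ w (X^ N ⊛ p)) (pair-X^⊛ N (w ∘ suc) p))

  pair-X^ : ∀ w N → ⟪ w , X^ N ⟫ ≡ w N
  pair-X^ w N = begin
    ⟪ w , X^ N ⟫              ≡⟨ pair-congʳ w (Ring.*-identityʳ (X^ N)) ⟨
    ⟪ w , X^ N ⊛ C 1ℤ ⟫       ≡⟨ pair-X^⊛ N w (C 1ℤ) ⟩
    ⟪ w ∘ (N ℕ.+_) , C 1ℤ ⟫   ≡⟨ trans (pair-C _ 1ℤ) (ℤₚ.*-identityʳ _) ⟩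
    w (N ℕ.+ 0)               ≡⟨ cong w (ℕₚ.+-identityʳ N) ⟩
    w N                       ∎
    where open ≡-Reasoning

  eval₁ : Poly → ℤ
  eval₁ = ⟪ (λ _ → 1ℤ) ,_⟫

  eval₁-cong : ∀ {p q} → p ≈ q → eval₁ p ≡ eval₁ q
  eval₁-cong = pair-congʳ _

  eval₁-C : ∀ c → eval₁ (C c) ≡ c
  eval₁-C c = trans (pair-C _ c) (ℤₚ.*-identityˡ c)

  coeff-0 : ∀ n → coeff (C 0ℤ) n ≡ 0ℤ
  coeff-0 zero    = coeff-C 0ℤ 0
  coeff-0 (suc n) = coeff-C 0ℤ (suc n)

  opaque
    -- Horner's scheme as an induction principle, by recursion on the bound. Transport along `_≈_`
    -- is an extra premise because equality of polynomials is a setoid relation.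
    poly-induction : ∀ {ℓ} (P : Poly → Set ℓ) → (∀ {p q} → p ≈ q → P p → P q) → P (C 0ℤ) →
                     (∀ c p → P p → P (C c ⊕ X ⊛ p)) → ∀ p → P p
    poly-induction P transport P0 Pstep p = go (bound p) p (vanish p)
      where
      go : ∀ d q → (∀ n → d ≤ n → coeff q n ≡ 0ℤ) → P q
      go zero    q q≡0 = transport (coeffs λ n → trans (coeff-0 n) (sym (q≡0 n z≤n))) P0
      go (suc d) q q≡0 = transport (Ring.sym (head-tail q)) (Pstep (coeff q 0) (tail q) (go d (tail q) λ n le → q≡0 (suc n) (s≤s le)))

  eval₁-⊕ : ∀ p q → eval₁ (p ⊕ q) ≡ eval₁ p + eval₁ q
  eval₁-⊕ = pair-⊕ _

  eval₁-⊛ : ∀ p q → eval₁ (p ⊛ q) ≡ eval₁ p * eval₁ q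
  eval₁-⊛ p q = poly-induction (λ p → eval₁ (p ⊛ q) ≡ eval₁ p * eval₁ q)
    (λ {p} {p′} e h → trans (eval₁-cong (Ring.*-congʳ (Ring.sym e))) (trans h (cong (_* eval₁ q) (eval₁-cong e))))
    (trans (eval₁-cong (Ring.zeroˡ q)) (trans (eval₁-C 0ℤ) (cong (_* eval₁ q) (sym (eval₁-C 0ℤ)))))
    step p
    where
    open ≡-Reasoning
    step : ∀ c p → eval₁ (p ⊛ q) ≡ eval₁ p * eval₁ q → eval₁ ((C c ⊕ X ⊛ p) ⊛ q) ≡ eval₁ (C c ⊕ X ⊛ p) * eval₁ q
    step c p IH = begin
      eval₁ ((C c ⊕ X ⊛ p) ⊛ q)
        ≡⟨ eval₁-cong (solve 4 (λ c x p q → (c :+ x :* p) :* q := c :* q :+ x :* (p :* q)) ≈-refl (C c) X p q) ⟩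
      eval₁ (C c ⊛ q ⊕ X ⊛ (p ⊛ q))
        ≡⟨ eval₁-⊕ (C c ⊛ q) (X ⊛ (p ⊛ q)) ⟩
      eval₁ (C c ⊛ q) + eval₁ (X ⊛ (p ⊛ q))
        ≡⟨ cong₂ _+_ (pair-scale _ c q) (trans (pair-X⊛ _ (p ⊛ q)) IH) ⟩
      c * eval₁ q + eval₁ p * eval₁ q
        ≡⟨ ℤₚ.*-distribʳ-+ (eval₁ q) c (eval₁ p) ⟨
      (c + eval₁ p) * eval₁ q
        ≡⟨ cong (_* eval₁ q) (cong₂ _+_ (eval₁-C c) (pair-X⊛ _ p)) ⟨
      (eval₁ (C c) + eval₁ (X ⊛ p)) * eval₁ q
        ≡⟨ cong (_* eval₁ q) (eval₁-⊕ (C c) (X ⊛ p)) ⟨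
      eval₁ (C c ⊕ X ⊛ p) * eval₁ q ∎

  eval₁-X^ : ∀ n → eval₁ (X^ n) ≡ 1ℤ
  eval₁-X^ = pair-X^ _

  π : Poly
  π = C 1ℤ ⊕ ⊝ X

  eval₁-X : eval₁ X ≡ 1ℤ
  eval₁-X = trans (eval₁-cong (Ring.sym (Ring.*-identityʳ X))) (eval₁-X^ 1)

  eval₁-π : eval₁ π ≡ 0ℤ
  eval₁-π = trans (eval₁-⊕ (C 1ℤ) (⊝ X)) (cong₂ _+_ (eval₁-C 1ℤ) (trans (pair-⊝ _ X) (cong -_ eval₁-X)))

  eval₁-π⊛ : ∀ p → eval₁ (π ⊛ p) ≡ 0ℤ
  eval₁-π⊛ p = trans (eval₁-⊛ π p) (cong (_* eval₁ p) eval₁-π)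

  opaque
    -- Synthetic division: the remainder modulo 1 - x is a constant, and evaluating at 1 identifies
    -- it.
    divide-π : ∀ p → ∃ λ g → p ≈ π ⊛ g ⊕ C (eval₁ p)
    divide-π p with poly-induction (λ p → ∃₂ λ g e → p ≈ π ⊛ g ⊕ C e) transport base step p
      where
      transport : ∀ {p q} → p ≈ q → (∃₂ λ g e → p ≈ π ⊛ g ⊕ C e) → ∃₂ λ g e → q ≈ π ⊛ g ⊕ C e
      transport p≈q (g , e , eq) = g , e , Ring.trans (Ring.sym p≈q) eq
      base : ∃₂ λ g e → C 0ℤ ≈ π ⊛ g ⊕ C e
      base = C 0ℤ , 0ℤ , solve 1 (λ x → con 0ℤ := (con 1ℤ :- x) :* con 0ℤ :+ con 0ℤ) ≈-refl X
      step : ∀ c p → (∃₂ λ g e → p ≈ π ⊛ g ⊕ C e) → ∃₂ λ g e → C c ⊕ X ⊛ p ≈ π ⊛ g ⊕ C e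
      -- x e = e - (1 - x) e, so the old remainder moves into the quotient with a minus sign and is
      -- added to `c`.
      step c p (g , e , eq) = X ⊛ g ⊕ ⊝ C e , c + e , Ring.trans (Ring.+-congˡ (Ring.*-congˡ eq))
        (Ring.trans
          (solve 4 (λ x g c e → c :+ x :* ((con 1ℤ :- x) :* g :+ e) := (con 1ℤ :- x) :* (x :* g :- e) :+ (c :+ e))
                 ≈-refl X g (C c) (C e))
          (Ring.+-congˡ (Ring.sym (C-+ c e))))
    ... | g , e , eq = g , subst (λ e → p ≈ π ⊛ g ⊕ C e) (sym eval≡e) eq
      where
      open ≡-Reasoning
      eval≡e : eval₁ p ≡ e
      eval≡e = begin
        eval₁ p                          ≡⟨ eval₁-cong eq ⟩
        eval₁ (π ⊛ g ⊕ C e)              ≡⟨ eval₁-⊕ (π ⊛ g) (C e) ⟩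
        eval₁ (π ⊛ g) + eval₁ (C e)      ≡⟨ cong₂ _+_ (eval₁-π⊛ g) (eval₁-C e) ⟩
        0ℤ + e                           ≡⟨ ℤₚ.+-identityˡ e ⟩
        e                                ∎

  -- A polynomial with constant term 1 is invertible as a power series: the lowest nonzero
  -- coefficient of `p` would survive in the product.
  ⊛-monic-zero : ∀ f p → coeff f 0 ≡ 1ℤ → p ⊛ f ≈ C 0ℤ → p ≈ C 0ℤ
  ⊛-monic-zero f p f0≡1 pf≈0 = coeffs λ n → trans (<-rec (λ n → coeff p n ≡ 0ℤ) step n) (sym (coeff-0 n))
    where
    open ≡-Reasoning
    step : ∀ n → (∀ {i} → i < n → coeff p i ≡ 0ℤ) → coeff p n ≡ 0ℤ
    step n below = begin
      coeff p n               ≡⟨ ℤₚ.*-identityʳ _ ⟨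
      coeff p n * 1ℤ          ≡⟨ cong (coeff p n *_) f0≡1 ⟨
      coeff p n * coeff f 0   ≡⟨ trans (coeff-⊛ p f n) (conv-lowest (coeff p) (coeff f) n (λ i i<n → below i<n)) ⟨
      coeff (p ⊛ f) n         ≡⟨ at pf≈0 n ⟩
      coeff (C 0ℤ) n          ≡⟨ coeff-0 n ⟩
      0ℤ                      ∎

  ⊛-cancelˡ : ∀ f {p q} → coeff f 0 ≡ 1ℤ → f ⊛ p ≈ f ⊛ q → p ≈ q
  ⊛-cancelˡ f {p} {q} f0≡1 e = begin
    p                  ≈⟨ solve 2 (λ p q → p := (p :- q) :+ q) ≈-refl p q ⟩
    (p ⊕ ⊝ q) ⊕ q      ≈⟨ Ring.+-congʳ (⊛-monic-zero f (p ⊕ ⊝ q) f0≡1 difference) ⟩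
    C 0ℤ ⊕ q           ≈⟨ Ring.+-identityˡ q ⟩
    q                  ∎
    where
    open ≈-Reasoning
    difference : (p ⊕ ⊝ q) ⊛ f ≈ C 0ℤ
    difference = begin
      (p ⊕ ⊝ q) ⊛ f         ≈⟨ solve 3 (λ f p q → (p :- q) :* f := f :* p :- f :* q) ≈-refl f p q ⟩
      f ⊛ p ⊕ ⊝ (f ⊛ q)     ≈⟨ Ring.+-congʳ e ⟩
      f ⊛ q ⊕ ⊝ (f ⊛ q)     ≈⟨ Ring.-‿inverseʳ (f ⊛ q) ⟩
      C 0ℤ                  ∎

  [X²]-↑ : ∀ p n → (p ↑ n) [X²] ≈ p [X²] ↑ n
  [X²]-↑ p zero    = [X²]-C 1ℤ
  [X²]-↑ p (suc n) = Ring.trans ([X²]-⊛ p (p ↑ n)) (Ring.*-congˡ ([X²]-↑ p n))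

  [X²]-X^ : ∀ n → (X^ n) [X²] ≈ X^ (n ℕ.+ n)
  [X²]-X^ n = Ring.trans ([X²]-↑ X n) (Ring.trans (Exp.^-congˡ Ring.semiring n [X²]-X)
    (Ring.trans (CExp.^-distrib-* Ring.commutativeSemiring X X n) (Ring.sym (X^-+ n n))))

  eval₁-[X²] : ∀ p → eval₁ (p [X²]) ≡ eval₁ p
  eval₁-[X²] = poly-induction (λ p → eval₁ (p [X²]) ≡ eval₁ p)
    (λ e h → trans (eval₁-cong ([X²]-cong (Ring.sym e))) (trans h (eval₁-cong e)))
    (eval₁-cong ([X²]-C 0ℤ))
    (λ c p IH → begin
      eval₁ ((C c ⊕ X ⊛ p) [X²])                    ≡⟨ eval₁-cong ([X²]-⊕ (C c) (X ⊛ p)) ⟩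
      eval₁ (C c [X²] ⊕ (X ⊛ p) [X²])               ≡⟨ eval₁-⊕ (C c [X²]) ((X ⊛ p) [X²]) ⟩
      eval₁ (C c [X²]) + eval₁ ((X ⊛ p) [X²])       ≡⟨ cong₂ _+_ (eval₁-cong ([X²]-C c))
          (eval₁-cong (Ring.trans ([X²]-⊛ X p) (Ring.trans (Ring.*-congʳ [X²]-X) (Ring.*-assoc X X (p [X²]))))) ⟩
      eval₁ (C c) + eval₁ (X ⊛ (X ⊛ p [X²]))        ≡⟨ cong (_+_ (eval₁ (C c))) (trans (pair-X⊛ _ (X ⊛ p [X²])) (pair-X⊛ _ (p [X²]))) ⟩
      eval₁ (C c) + eval₁ (p [X²])                  ≡⟨ cong (_+_ (eval₁ (C c))) (trans IH (sym (pair-X⊛ _ p))) ⟩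
      eval₁ (C c) + eval₁ (X ⊛ p)                   ≡⟨ eval₁-⊕ (C c) (X ⊛ p) ⟨
      eval₁ (C c ⊕ X ⊛ p)                           ∎)
    where open ≡-Reasoning

  -- Primality of 1 + x^(2^j)

  open import Algebra.Definitions.RawMagma Ring.*-rawMagma using (_,_) renaming (_∣ˡ_ to _∣_)

  ∣-respʳ : ∀ {f p q} → p ≈ q → f ∣ p → f ∣ q
  ∣-respʳ p≈q (h , e) = h , Ring.trans e p≈q

  ∣-⊕ : ∀ {f p q} → f ∣ p → f ∣ q → f ∣ p ⊕ q
  ∣-⊕ {f} (h , e) (k , e′) = h ⊕ k , Ring.trans (Ring.distribˡ f h k) (Ring.+-cong e e′)

  ∣-⊝ : ∀ {f p} → f ∣ p → f ∣ ⊝ p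
  ∣-⊝ {f} (h , e) = ⊝ h , Ring.trans (solve 2 (λ f h → f :* :- h := :- (f :* h)) ≈-refl f h) (Ring.-‿cong e)

  ∣-⊛ˡ : ∀ {f p} q → f ∣ p → f ∣ q ⊛ p
  ∣-⊛ˡ {f} q (h , e) = q ⊛ h , Ring.trans (solve 3 (λ f h q → f :* (q :* h) := q :* (f :* h)) ≈-refl f h q) (Ring.*-congˡ e)

  f∣f⊛p : ∀ f p → f ∣ f ⊛ p
  f∣f⊛p f p = p , Ring.refl

  ∣-trans : ∀ {f g p} → f ∣ g → g ∣ p → f ∣ p
  ∣-trans {f} (h , e) (k , e′) = h ⊛ k , Ring.trans (Ring.sym (Ring.*-assoc f h k)) (Ring.trans (Ring.*-congʳ e) e′)

  ∣-remainders : ∀ {f p g q r q′ r′ t} → p ≈ f ⊛ q ⊕ r → g ≈ f ⊛ q′ ⊕ r′ → f ∣ p ⊕ ⊝ (t ⊛ g) → f ∣ r ⊕ ⊝ (t ⊛ r′)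
  ∣-remainders {f} {p} {g} {q} {r} {q′} {r′} {t} p≈ g≈ d = ∣-respʳ
    (Ring.trans (Ring.+-congʳ (Ring.+-cong p≈ (Ring.-‿cong (Ring.*-congˡ g≈))))
      (solve 6 (λ f q r q′ r′ t → ((f :* q :+ r) :- t :* (f :* q′ :+ r′)) :+ f :* (t :* q′ :- q) := r :- t :* r′)
             ≈-refl f q r q′ r′ t))
    (∣-⊕ d (f∣f⊛p f (t ⊛ q′ ⊕ ⊝ q)))

  -- For N = 2^j this is the cyclotomic polynomial of order 2^(j+1).
  Ψ : ℕ → Poly
  Ψ N = C 1ℤ ⊕ X^ N

  eval₁-Ψ : ∀ N → eval₁ (Ψ N) ≡ + 2
  eval₁-Ψ N = trans (eval₁-⊕ (C 1ℤ) (X^ N)) (cong₂ _+_ (eval₁-C 1ℤ) (eval₁-X^ N))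

  coeff-π-0 : coeff π 0 ≡ 1ℤ
  coeff-π-0 = trans (coeff-⊕ (C 1ℤ) (⊝ X) 0) (cong₂ _+_ (coeff-C 1ℤ 0)
    (trans (coeff-⊝ X 0) (cong -_ (trans (at (Ring.sym (Ring.*-identityʳ X)) 0) (coeff-X⊛ (C 1ℤ) 0)))))

  -- If `Ψ N ⊛ h` equals `π ⊛ p`, then evaluating at 1 gives 2 h(1) = 0. Hence `h` is itself a
  -- multiple of `π`, and `π` cancels.
  Ψ∣π⊛⇒Ψ∣ : ∀ N p → Ψ N ∣ π ⊛ p → Ψ N ∣ p
  Ψ∣π⊛⇒Ψ∣ N p (h , e) with divide-π h
  ... | g , h≈ = g , Ring.sym (⊛-cancelˡ π coeff-π-0 (Ring.trans (Ring.sym e) (Ring.trans (Ring.*-congˡ h≈πg)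
                       (solve 3 (λ f π g → f :* (π :* g) := π :* (f :* g)) ≈-refl (Ψ N) π g))))
    where
    2*eval≡0 : + 2 * eval₁ h ≡ 0ℤ
    2*eval≡0 = begin
      + 2 * eval₁ h               ≡⟨ cong (_* eval₁ h) (eval₁-Ψ N) ⟨
      eval₁ (Ψ N) * eval₁ h       ≡⟨ eval₁-⊛ (Ψ N) h ⟨
      eval₁ (Ψ N ⊛ h)             ≡⟨ eval₁-cong e ⟩
      eval₁ (π ⊛ p)               ≡⟨ eval₁-π⊛ p ⟩
      0ℤ                          ∎
      where open ≡-Reasoning
    eval≡0 : eval₁ h ≡ 0ℤ
    eval≡0 = ℤₚ.*-cancelˡ-≡ (+ 2) (eval₁ h) 0ℤ 2*eval≡0
    h≈πg : h ≈ π ⊛ g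
    h≈πg = Ring.trans h≈ (Ring.trans (Ring.+-congˡ (Ring.reflexive (cong C eval≡0))) (Ring.+-identityʳ (π ⊛ g)))

  opaque
    -- Modulo `Ψ N` the number 2 is a multiple of 1 - x: from Ψ = (1 - x) u + 2 follows 2 c ≡ - (1 -
    -- x) u c. So p = (1 - x) g + 2 c is congruent to (1 - x)(g - u c).
    even⇒≡π⊛ : ∀ N p → + 2 ℤ∣.∣ eval₁ p → ∃ λ p′ → Ψ N ∣ p ⊕ ⊝ (π ⊛ p′)
    even⇒≡π⊛ N p (ℤ∣.divides c eval≡) with divide-π p | divide-π (Ψ N)
    ... | g , p≈ | u , Ψ≈ = g ⊕ ⊝ (u ⊛ C c) , C c , Ring.sym (begin
      p ⊕ ⊝ (π ⊛ (g ⊕ ⊝ (u ⊛ C c)))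
        ≈⟨ Ring.+-congʳ p≈ ⟩
      π ⊛ g ⊕ C (eval₁ p) ⊕ ⊝ (π ⊛ (g ⊕ ⊝ (u ⊛ C c)))
        ≈⟨ Ring.+-congʳ (Ring.+-congˡ (Ring.trans (Ring.reflexive (cong C eval≡)) (C-* c (+ 2)))) ⟩
      π ⊛ g ⊕ C c ⊛ C (+ 2) ⊕ ⊝ (π ⊛ (g ⊕ ⊝ (u ⊛ C c)))
        ≈⟨ solve 4 (λ π g u c → π :* g :+ c :* con (+ 2) :- π :* (g :- u :* c) := (π :* u :+ con (+ 2)) :* c) ≈-refl π g u (C c) ⟩
      (π ⊛ u ⊕ C (+ 2)) ⊛ C c
        ≈⟨ Ring.*-congʳ (Ring.trans Ψ≈ (Ring.+-congˡ (Ring.reflexive (cong C (eval₁-Ψ N))))) ⟨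
      Ψ N ⊛ C c ∎)
      where open ≈-Reasoning

  2∣*⇒2∣⊎2∣ : ∀ a b → + 2 ℤ∣.∣ a * b → + 2 ℤ∣.∣ a ⊎ + 2 ℤ∣.∣ b
  2∣*⇒2∣⊎2∣ a b 2∣ab = map ℤ∣.∣ᵤ⇒∣ ℤ∣.∣ᵤ⇒∣
    (euclidsLemma ℤ.∣ a ∣ ℤ.∣ b ∣ prime[2] (subst (2 ℕ∣.∣_) (ℤₚ.abs-* a b) (ℤ∣.∣⇒∣ᵤ 2∣ab)))

  opaque
    -- At 1, Ψ N takes the value 2, so a product divisible by Ψ N has a factor with even value at 1;
    -- modulo Ψ N such a factor is a multiple of π.
    π-descent : ∀ N n f g → Ψ N ∣ f ⊛ g →
                ∃₂ λ a b → a ℕ.+ b ≡ n × (∃ λ f′ → Ψ N ∣ f ⊕ ⊝ (π ↑ a ⊛ f′)) × (∃ λ g′ → Ψ N ∣ g ⊕ ⊝ (π ↑ b ⊛ g′))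
    π-descent N zero    f g Ψ∣fg = 0 , 0 , refl , (f , self f) , (g , self g)
      where
      self : ∀ h → Ψ N ∣ h ⊕ ⊝ (C 1ℤ ⊛ h)
      self h = C 0ℤ , solve 2 (λ f h → f :* con 0ℤ := h :- con 1ℤ :* h) ≈-refl (Ψ N) h
    π-descent N (suc n) f g Ψ∣fg@(q , e) = case 2∣*⇒2∣⊎2∣ (eval₁ f) (eval₁ g) 2∣eval of λ
      { (inj₁ 2∣f) → let (f₁ , Ψ∣) = even⇒≡π⊛ N f 2∣f
                         (a , b , eq , (f′ , Ψ∣′) , divg) = π-descent N n f₁ g (peel f g f₁ Ψ∣ Ψ∣fg)
                     in suc a , b , cong suc eq , (f′ , lift f f₁ a f′ Ψ∣ Ψ∣′) , divg
      ; (inj₂ 2∣g) → let (g₁ , Ψ∣) = even⇒≡π⊛ N g 2∣g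
                         Ψ∣fg₁ = ∣-respʳ (Ring.*-comm g₁ f) (peel g f g₁ Ψ∣ (∣-respʳ (Ring.*-comm f g) Ψ∣fg))
                         (a , b , eq , divf , (g′ , Ψ∣′)) = π-descent N n f g₁ Ψ∣fg₁
                     in a , suc b , trans (ℕₚ.+-suc a b) (cong suc eq) , divf , (g′ , lift g g₁ b g′ Ψ∣ Ψ∣′)
      }
      where
      2∣eval : + 2 ℤ∣.∣ eval₁ f * eval₁ g
      2∣eval = ℤ∣.divides (eval₁ q) (begin
        eval₁ f * eval₁ g          ≡⟨ eval₁-⊛ f g ⟨
        eval₁ (f ⊛ g)              ≡⟨ eval₁-cong e ⟨
        eval₁ (Ψ N ⊛ q)            ≡⟨ eval₁-⊛ (Ψ N) q ⟩
        eval₁ (Ψ N) * eval₁ q      ≡⟨ cong (_* eval₁ q) (eval₁-Ψ N) ⟩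
        + 2 * eval₁ q              ≡⟨ ℤₚ.*-comm (+ 2) (eval₁ q) ⟩
        eval₁ q * + 2              ∎)
        where open ≡-Reasoning
      peel : ∀ f g f₁ → Ψ N ∣ f ⊕ ⊝ (π ⊛ f₁) → Ψ N ∣ f ⊛ g → Ψ N ∣ f₁ ⊛ g
      peel f g f₁ d d′ = Ψ∣π⊛⇒Ψ∣ N (f₁ ⊛ g) (∣-respʳ
        (solve 4 (λ f g f₁ π → f :* g :- g :* (f :- π :* f₁) := π :* (f₁ :* g)) ≈-refl f g f₁ π)
        (∣-⊕ d′ (∣-⊝ (∣-⊛ˡ g d))))
      lift : ∀ f f₁ a f′ → Ψ N ∣ f ⊕ ⊝ (π ⊛ f₁) → Ψ N ∣ f₁ ⊕ ⊝ (π ↑ a ⊛ f′) → Ψ N ∣ f ⊕ ⊝ (π ↑ suc a ⊛ f′)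
      lift f f₁ a f′ d d′ = ∣-respʳ
        (solve 5 (λ f f₁ p f′ π → (f :- π :* f₁) :+ π :* (f₁ :- p :* f′) := f :- π :* p :* f′) ≈-refl f f₁ (π ↑ a) f′ π)
        (∣-⊕ d (∣-⊛ˡ π d′))

  -- Squaring (1 + x^N) + 2 w gives 1 + x^(2N) up to even terms, among them the cross term 2 x^N.
  Frobenius-double : ∀ N w → π ↑ N ≈ Ψ N ⊕ C (+ 2) ⊛ w → ∃ λ w′ → π ↑ (2 ℕ.* N) ≈ Ψ (2 ℕ.* N) ⊕ C (+ 2) ⊛ w′
  Frobenius-double N w e = next (X^ N) , (begin
    π ↑ (2 ℕ.* N)                       ≡⟨ cong (π ↑_) 2N≡N+N ⟩
    π ↑ (N ℕ.+ N)                       ≈⟨ Exp.^-homo-* Ring.semiring π N N ⟩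
    π ↑ N ⊛ π ↑ N                       ≈⟨ Ring.*-cong e e ⟩
    (Ψ N ⊕ C (+ 2) ⊛ w) ⊛ (Ψ N ⊕ C (+ 2) ⊛ w)
      ≈⟨ square (X^ N) w ⟩
    C 1ℤ ⊕ X^ N ⊛ X^ N ⊕ C (+ 2) ⊛ next (X^ N)  ≈⟨ Ring.+-congʳ (Ring.+-congˡ (X^-+ N N)) ⟨
    Ψ (N ℕ.+ N) ⊕ C (+ 2) ⊛ next (X^ N)         ≡⟨ cong (λ M → Ψ M ⊕ C (+ 2) ⊛ next (X^ N)) 2N≡N+N ⟨
    Ψ (2 ℕ.* N) ⊕ C (+ 2) ⊛ next (X^ N)         ∎)
    where
    open ≈-Reasoning
    next : Poly → Poly
    next x = x ⊕ C (+ 2) ⊛ w ⊛ (C 1ℤ ⊕ x) ⊕ C (+ 2) ⊛ w ⊛ w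
    2N≡N+N : 2 ℕ.* N ≡ N ℕ.+ N
    2N≡N+N = cong (N ℕ.+_) (ℕₚ.+-identityʳ N)
    square : ∀ x w → (C 1ℤ ⊕ x ⊕ C (+ 2) ⊛ w) ⊛ (C 1ℤ ⊕ x ⊕ C (+ 2) ⊛ w)
                     ≈ C 1ℤ ⊕ x ⊛ x ⊕ C (+ 2) ⊛ (x ⊕ C (+ 2) ⊛ w ⊛ (C 1ℤ ⊕ x) ⊕ C (+ 2) ⊛ w ⊛ w)
    square = solve 2 (λ x w → (con 1ℤ :+ x :+ con (+ 2) :* w) :* (con 1ℤ :+ x :+ con (+ 2) :* w)
      := con 1ℤ :+ x :* x :+ con (+ 2) :* (x :+ con (+ 2) :* w :* (con 1ℤ :+ x) :+ con (+ 2) :* w :* w)) ≈-refl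

  π^2^j≈Ψ+2w : ∀ j → ∃ λ w → π ↑ (2 ^ j) ≈ Ψ (2 ^ j) ⊕ C (+ 2) ⊛ w
  π^2^j≈Ψ+2w zero    = ⊝ X , solve 1 (λ x → (con 1ℤ :- x) :* con 1ℤ := con 1ℤ :+ x :* con 1ℤ :+ con (+ 2) :* :- x) ≈-refl X
  π^2^j≈Ψ+2w (suc j) = let (w , e) = π^2^j≈Ψ+2w j in Frobenius-double (2 ^ j) w e

  ∣-difference-trans : ∀ {f p q r} → f ∣ p ⊕ ⊝ q → f ∣ q ⊕ ⊝ r → f ∣ p ⊕ ⊝ r
  ∣-difference-trans {f} {p} {q} {r} d d′ = ∣-respʳ (solve 3 (λ p q r → (p :- q) :+ (q :- r) := p :- r) ≈-refl p q r) (∣-⊕ d d′)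

  ∣-difference-refl : ∀ {f p q} → p ≈ q → f ∣ p ⊕ ⊝ q
  ∣-difference-refl {f} {p} {q} e = C 0ℤ , Ring.trans (Ring.zeroʳ f) (Ring.sym (Ring.trans (Ring.+-congʳ e) (Ring.-‿inverseʳ q)))

  ∣-difference-⊛ : ∀ {f p q} r → f ∣ p ⊕ ⊝ q → f ∣ r ⊛ p ⊕ ⊝ (r ⊛ q)
  ∣-difference-⊛ {f} {p} {q} r d = ∣-respʳ (solve 3 (λ p q r → r :* (p :- q) := r :* p :- r :* q) ≈-refl p q r) (∣-⊛ˡ r d)

  C-2^suc : ∀ e → C (+ (2 ^ suc e)) ≈ C (+ 2) ⊛ C (+ (2 ^ e))
  C-2^suc e = Ring.trans (Ring.reflexive (cong C (ℤₚ.pos-* 2 (2 ^ e)))) (C-* (+ 2) (+ (2 ^ e)))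

  -- Modulo `Ψ N` the hypothesis says π^N ≡ 2 w, so every block of N factors `π` can be exchanged
  -- for a factor 2.
  π^Ne≡2^e : ∀ N w → π ↑ N ≈ Ψ N ⊕ C (+ 2) ⊛ w →
             ∀ e f → ∃ λ g → Ψ N ∣ π ↑ (N ℕ.* e) ⊛ f ⊕ ⊝ (C (+ (2 ^ e)) ⊛ g)
  π^Ne≡2^e N w πN≈ zero    f = f , ∣-difference-refl (Ring.reflexive (cong (λ m → π ↑ m ⊛ f) (ℕₚ.*-zeroʳ N)))
  π^Ne≡2^e N w πN≈ (suc e) f =
    let (g , d) = π^Ne≡2^e N w πN≈ e f
        p = π ↑ (N ℕ.* e) ⊛ f
    in w ⊛ g , ∣-difference-trans (∣-difference-refl (regroup p Ring.refl))
               (∣-difference-trans (πN≡2w p)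
               (∣-difference-trans (∣-difference-⊛ (C (+ 2) ⊛ w) d)
                                   (∣-difference-refl (collect (C (+ 2)) w (C (+ (2 ^ e))) g (C-2^suc e)))))
    where
    regroup : ∀ p → π ↑ (N ℕ.* e) ⊛ f ≈ p → π ↑ (N ℕ.* suc e) ⊛ f ≈ π ↑ N ⊛ p
    regroup p eq = begin
      π ↑ (N ℕ.* suc e) ⊛ f           ≡⟨ cong (λ m → π ↑ m ⊛ f) (ℕₚ.*-suc N e) ⟩
      π ↑ (N ℕ.+ N ℕ.* e) ⊛ f         ≈⟨ Ring.*-congʳ (Exp.^-homo-* Ring.semiring π N (N ℕ.* e)) ⟩
      π ↑ N ⊛ π ↑ (N ℕ.* e) ⊛ f       ≈⟨ Ring.*-assoc (π ↑ N) (π ↑ (N ℕ.* e)) f ⟩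
      π ↑ N ⊛ (π ↑ (N ℕ.* e) ⊛ f)     ≈⟨ Ring.*-congˡ eq ⟩
      π ↑ N ⊛ p                       ∎
      where open ≈-Reasoning
    πN≡2w : ∀ p → Ψ N ∣ π ↑ N ⊛ p ⊕ ⊝ (C (+ 2) ⊛ w ⊛ p)
    πN≡2w p = ∣-respʳ (Ring.trans
      (solve 3 (λ f v p → f :* p := (f :+ v) :* p :- v :* p) ≈-refl (Ψ N) (C (+ 2) ⊛ w) p)
      (Ring.+-congʳ (Ring.*-congʳ (Ring.sym πN≈)))) (f∣f⊛p (Ψ N) p)
    collect : ∀ s w t g {u} → u ≈ s ⊛ t → s ⊛ w ⊛ (t ⊛ g) ≈ u ⊛ (w ⊛ g)
    collect s w t g u≈ = Ring.trans (solve 4 (λ s w t g → s :* w :* (t :* g) := s :* t :* (w :* g)) ≈-refl s w t g)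
                                    (Ring.*-congʳ (Ring.sym u≈))

  -- Division with remainder by 1 + x^N

  coeff-X^ : ∀ N n → coeff (X^ N) (N ℕ.+ n) ≡ coeff (C 1ℤ) n
  coeff-X^ N n = trans (at (Ring.sym (Ring.*-identityʳ (X^ N))) (N ℕ.+ n)) (X^-coeff N (C 1ℤ) n)

  coeff-C⊛ : ∀ c p n → coeff (C c ⊛ p) n ≡ c * coeff p n
  coeff-C⊛ c p n = trans (coeff-⊛ (C c) p n) (trans (conv-cong (coeff-C c) (λ _ → refl) n) (conv-constantˡ c (coeff p) n))

  divide-step : ∀ c t x xN q r → c ⊕ x ⊛ ((C 1ℤ ⊕ xN) ⊛ q ⊕ r) ≈ (C 1ℤ ⊕ xN) ⊛ (x ⊛ q ⊕ t) ⊕ (x ⊛ r ⊕ ⊝ (t ⊛ xN) ⊕ (c ⊕ ⊝ t))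
  divide-step = solve 6 (λ c t x xN q r → c :+ x :* ((con 1ℤ :+ xN) :* q :+ r)
    := (con 1ℤ :+ xN) :* (x :* q :+ t) :+ (x :* r :- t :* xN :+ (c :- t))) ≈-refl

  -- One Horner step for remainders modulo 1 + x^N. The intended `t` is the coefficient of x^N in x
  -- r, and subtracting t (1 + x^N) from c + x r removes it.
  reduce : ℕ → ℤ → ℤ → Poly → Poly
  reduce N c t r = X ⊛ r ⊕ ⊝ (C t ⊛ X^ N) ⊕ (C c ⊕ ⊝ C t)

  coeff-reduce : ∀ N c t r n →
    coeff (reduce N c t r) n ≡ shiftUp (coeff r) n + - (t * coeff (X^ N) n) + (coeff (C c) n + - coeff (C t) n)
  coeff-reduce N c t r n = trans (coeff-⊕ _ _ n) (cong₂ _+_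
    (trans (coeff-⊕ _ _ n) (cong₂ _+_ (coeff-X⊛ r n) (trans (coeff-⊝ _ n) (cong -_ (coeff-C⊛ t (X^ N) n)))))
    (trans (coeff-⊕ _ _ n) (cong (_+_ (coeff (C c) n)) (coeff-⊝ (C t) n))))

  reduce-small : ∀ M c r → (∀ n → M < n → coeff r n ≡ 0ℤ) → ∀ n → M < n → coeff (reduce (suc M) c (coeff r M) r) n ≡ 0ℤ
  reduce-small M c r small (suc n) (s≤s M≤n) =
    subst (λ n → coeff (reduce (suc M) c (coeff r M) r) (suc n) ≡ 0ℤ) (ℕₚ.m+[n∸m]≡n M≤n) (above (n ℕ.∸ M))
    where
    high : ∀ i → coeff r (M ℕ.+ i) + - (coeff r M * coeff (X^ (suc M)) (suc M ℕ.+ i)) ≡ 0ℤ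
    high zero = begin
      coeff r (M ℕ.+ 0) + - (coeff r M * coeff (X^ (suc M)) (suc M ℕ.+ 0))
        ≡⟨ cong₂ (λ a b → coeff r a + - (coeff r M * b)) (ℕₚ.+-identityʳ M) (trans (coeff-X^ (suc M) 0) (coeff-C 1ℤ 0)) ⟩
      coeff r M + - (coeff r M * 1ℤ)  ≡⟨ cong (λ z → coeff r M + - z) (ℤₚ.*-identityʳ (coeff r M)) ⟩
      coeff r M + - coeff r M         ≡⟨ ℤₚ.+-inverseʳ (coeff r M) ⟩
      0ℤ                              ∎
      where open ≡-Reasoning
    high (suc i) = cong₂ (λ a b → a + - b)
      (small (M ℕ.+ suc i) (ℕₚ.m<m+n M (s≤s z≤n)))
      (trans (cong (coeff r M *_) (trans (coeff-X^ (suc M) (suc i)) (coeff-C 1ℤ (suc i)))) (ℤₚ.*-zeroʳ (coeff r M)))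
    above : ∀ i → coeff (reduce (suc M) c (coeff r M) r) (suc (M ℕ.+ i)) ≡ 0ℤ
    above i = trans (coeff-reduce (suc M) c (coeff r M) r (suc (M ℕ.+ i))) (cong₂ _+_ (high i)
      (cong₂ (λ a b → a + - b) (coeff-C c (suc (M ℕ.+ i))) (coeff-C (coeff r M) (suc (M ℕ.+ i)))))

  opaque
    divide-Ψ : ∀ M p → ∃₂ λ q r → p ≈ Ψ (suc M) ⊛ q ⊕ r × (∀ n → M < n → coeff r n ≡ 0ℤ)
    divide-Ψ M = poly-induction (λ p → ∃₂ λ q r → p ≈ Ψ (suc M) ⊛ q ⊕ r × (∀ n → M < n → coeff r n ≡ 0ℤ))
      (λ p≈p′ (q , r , e , small) → q , r , Ring.trans (Ring.sym p≈p′) e , small)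
      (C 0ℤ , C 0ℤ , Ring.sym (Ring.trans (Ring.+-identityʳ _) (Ring.zeroʳ (Ψ (suc M)))) , λ n _ → coeff-0 n)
      (λ c p (q , r , e , small) → X ⊛ q ⊕ C (coeff r M) , reduce (suc M) c (coeff r M) r
        , Ring.trans (Ring.+-congˡ (Ring.*-congˡ e)) (divide-step (C c) (C (coeff r M)) X (X^ (suc M)) q r)
        , reduce-small M c r small)

  coeff-Ψ⊛ : ∀ N h n → coeff (Ψ N ⊛ h) (N ℕ.+ n) ≡ coeff h (N ℕ.+ n) + coeff h n
  coeff-Ψ⊛ N h n = trans (at (solve 2 (λ x h → (con 1ℤ :+ x) :* h := h :+ x :* h) ≈-refl (X^ N) h) (N ℕ.+ n))
    (trans (coeff-⊕ h (X^ N ⊛ h) (N ℕ.+ n)) (cong (_+_ (coeff h (N ℕ.+ n))) (X^-coeff N h n)))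

  -- With N = M + 1, a vanishing coefficient at N + n of the product means that h at n is minus h at
  -- N + n. Iterating pushes the index beyond the bound of `h`; `d` measures the distance still to
  -- go.
  Ψ⊛-small⇒0 : ∀ M h → (∀ n → M < n → coeff (Ψ (suc M) ⊛ h) n ≡ 0ℤ) → ∀ n → coeff h n ≡ 0ℤ
  Ψ⊛-small⇒0 M h small n = go (bound h) n (ℕₚ.m≤n+m (bound h) n)
    where
    open ≡-Reasoning
    go : ∀ d n → bound h ≤ n ℕ.+ d → coeff h n ≡ 0ℤ
    go zero    n le = vanish h n (subst (bound h ≤_) (ℕₚ.+-identityʳ n) le)
    go (suc d) n le = begin
      coeff h n                                ≡⟨ ℤₚ.+-identityˡ _ ⟨
      0ℤ + coeff h n                           ≡⟨ cong (_+ coeff h n) (go d (suc M ℕ.+ n) later) ⟨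
      coeff h (suc M ℕ.+ n) + coeff h n        ≡⟨ coeff-Ψ⊛ (suc M) h n ⟨
      coeff (Ψ (suc M) ⊛ h) (suc M ℕ.+ n)      ≡⟨ small (suc M ℕ.+ n) (s≤s (ℕₚ.m≤m+n M n)) ⟩
      0ℤ                                       ∎
      where
      later : bound h ≤ suc M ℕ.+ n ℕ.+ d
      later = ℕₚ.≤-trans le (subst (_≤ suc (M ℕ.+ n ℕ.+ d)) (sym (ℕₚ.+-suc n d)) (s≤s (ℕₚ.+-monoˡ-≤ d (ℕₚ.m≤n+m n M))))

  series-bounded : ∀ d (f : Series) → (∀ n → d ≤ n → f n ≡ 0ℤ) → ∃ λ b → ∀ n → ℤ.∣ f n ∣ ≤ b
  series-bounded zero    f f≡0 = 0 , λ n → ℕₚ.≤-reflexive (cong ℤ.∣_∣ (f≡0 n z≤n))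
  series-bounded (suc d) f f≡0 =
    let (b , bounded) = series-bounded d (f ∘ suc) (λ n le → f≡0 (suc n) (s≤s le))
    in ℤ.∣ f 0 ∣ ℕ.+ b , λ
      { zero    → ℕₚ.m≤m+n ℤ.∣ f 0 ∣ b
      ; (suc n) → ℕₚ.≤-trans (bounded n) (ℕₚ.m≤n+m b ℤ.∣ f 0 ∣) }

  n<2^n : ∀ n → n < 2 ^ n
  n<2^n zero    = s≤s z≤n
  n<2^n (suc n) = ℕₚ.+-mono-≤-< {1} (ℕₚ.m^n>0 2 n) (subst (n <_) (sym (ℕₚ.+-identityʳ (2 ^ n))) (n<2^n n))

  coeff-bounded : ∀ p → ∃ λ e → ∀ n → ℤ.∣ coeff p n ∣ < 2 ^ e
  coeff-bounded p =
    let (b , bounded) = series-bounded (bound p) (coeff p) (vanish p)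
    in b , λ n → ℕₚ.≤-<-trans (bounded n) (n<2^n b)

  Ψ∣small⇒≈0 : ∀ M p → Ψ (suc M) ∣ p → (∀ n → M < n → coeff p n ≡ 0ℤ) → p ≈ C 0ℤ
  Ψ∣small⇒≈0 M p (h , e) small = Ring.trans (Ring.sym e) (Ring.trans (Ring.*-congˡ h≈0) (Ring.zeroʳ (Ψ (suc M))))
    where
    h≈0 : h ≈ C 0ℤ
    h≈0 = coeffs λ n → trans (Ψ⊛-small⇒0 M h (λ i M<i → trans (at e i) (small i M<i)) n) (sym (coeff-0 n))

  bounded-multiple : ∀ c i j → i ≡ + c * j → ℤ.∣ i ∣ < c → i ≡ 0ℤ
  bounded-multiple c i j i≡cj i<c = trans i≡cj (trans (cong (+ c *_) (ℤₚ.∣i∣≡0⇒i≡0 (∣j∣≡0 ℤ.∣ j ∣ refl))) (ℤₚ.*-zeroʳ (+ c)))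
    where
    ∣j∣≡0 : ∀ a → ℤ.∣ j ∣ ≡ a → ℤ.∣ j ∣ ≡ 0
    ∣j∣≡0 zero    eq = eq
    ∣j∣≡0 (suc a) eq = contradiction i<c (ℕₚ.≤⇒≯ c≤∣i∣)
      where
      open ℕₚ.≤-Reasoning
      c≤∣i∣ : c ≤ ℤ.∣ i ∣
      c≤∣i∣ = begin
        c                 ≤⟨ ℕₚ.m≤m*n c (suc a) ⟩
        c ℕ.* suc a       ≡⟨ cong (c ℕ.*_) eq ⟨
        c ℕ.* ℤ.∣ j ∣     ≡⟨ ℤₚ.abs-* (+ c) j ⟨
        ℤ.∣ + c * j ∣     ≡⟨ cong ℤ.∣_∣ i≡cj ⟨
        ℤ.∣ i ∣           ∎

  small≡multiple⇒≈0 : ∀ M c r r′ → (∀ n → M < n → coeff r n ≡ 0ℤ) → (∀ n → M < n → coeff r′ n ≡ 0ℤ) →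
                      (∀ n → ℤ.∣ coeff r n ∣ < c) → Ψ (suc M) ∣ r ⊕ ⊝ (C (+ c) ⊛ r′) → r ≈ C 0ℤ
  small≡multiple⇒≈0 M c r r′ r-small r′-small r-bounded d =
    coeffs λ n → trans (bounded-multiple c (coeff r n) (coeff r′ n) (r≡cr′ n) (r-bounded n)) (sym (coeff-0 n))
    where
    coeff-diff : ∀ n → coeff (r ⊕ ⊝ (C (+ c) ⊛ r′)) n ≡ coeff r n + - (+ c * coeff r′ n)
    coeff-diff n = trans (coeff-⊕ r _ n) (cong (_+_ (coeff r n)) (trans (coeff-⊝ _ n) (cong -_ (coeff-C⊛ (+ c) r′ n))))
    diff-small : ∀ n → M < n → coeff (r ⊕ ⊝ (C (+ c) ⊛ r′)) n ≡ 0ℤ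
    diff-small n M<n = trans (coeff-diff n) (cong₂ (λ a b → a + - b) (r-small n M<n)
      (trans (cong (+ c *_) (r′-small n M<n)) (ℤₚ.*-zeroʳ (+ c))))
    r≡cr′ : ∀ n → coeff r n ≡ + c * coeff r′ n
    r≡cr′ n = ℤₚ.i-j≡0⇒i≡j (coeff r n) (+ c * coeff r′ n)
      (trans (sym (coeff-diff n)) (trans (at (Ψ∣small⇒≈0 M _ d diff-small) n) (coeff-0 n)))

  opaque
    -- Remainders modulo a monic polynomial are unique, so the remainder of `p` is 2^e times that of
    -- `g`. Since 2^e exceeds its coefficients in absolute value, it is zero. The exponent is fixed
    -- before `g` is known.
    ≡2^e⇒Ψ∣ : ∀ M p → ∃ λ e → ∀ g → Ψ (suc M) ∣ p ⊕ ⊝ (C (+ (2 ^ e)) ⊛ g) → Ψ (suc M) ∣ p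
    ≡2^e⇒Ψ∣ M p =
      let (q , r , p≈ , r-small) = divide-Ψ M p
          (e , r-bounded)        = coeff-bounded r
      in e , λ g d →
        let (q′ , r′ , g≈ , r′-small) = divide-Ψ M g
            r≈0 = small≡multiple⇒≈0 M (2 ^ e) r r′ r-small r′-small r-bounded
                    (∣-remainders {t = C (+ (2 ^ e))} p≈ g≈ d)
        in q , Ring.sym (Ring.trans p≈ (Ring.trans (Ring.+-congˡ r≈0) (Ring.+-identityʳ (Ψ (suc M) ⊛ q))))

  a+b≡c+d⇒c≤a⊎d≤b : ∀ {a b c d} → a ℕ.+ b ≡ c ℕ.+ d → c ≤ a ⊎ d ≤ b
  a+b≡c+d⇒c≤a⊎d≤b {a} {b} {c} {d} eq with c ℕₚ.≤? a
  ... | yes c≤a = inj₁ c≤a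
  ... | no  c≰a = inj₂ (ℕₚ.≮⇒≥ λ b<d → ℕₚ.<-irrefl eq (ℕₚ.+-mono-< (ℕₚ.≰⇒> c≰a) b<d))

  2^-Ψ∣-criterion : ∀ j p → ∃ λ e → ∀ g → Ψ (2 ^ j) ∣ p ⊕ ⊝ (C (+ (2 ^ e)) ⊛ g) → Ψ (2 ^ j) ∣ p
  2^-Ψ∣-criterion j p = positive (2 ^ j) (ℕₚ.m^n>0 2 j)
    where
    positive : ∀ N → 1 ≤ N → ∃ λ e → ∀ g → Ψ N ∣ p ⊕ ⊝ (C (+ (2 ^ e)) ⊛ g) → Ψ N ∣ p
    positive (suc M) _ = ≡2^e⇒Ψ∣ M p

  ↑-split : ∀ p {a b} q → a ≤ b → ∃ λ q′ → p ↑ b ⊛ q ≈ p ↑ a ⊛ q′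
  ↑-split p {a} {b} q a≤b = p ↑ (b ℕ.∸ a) ⊛ q , (begin
    p ↑ b ⊛ q                       ≡⟨ cong (λ c → p ↑ c ⊛ q) (ℕₚ.m+[n∸m]≡n a≤b) ⟨
    p ↑ (a ℕ.+ (b ℕ.∸ a)) ⊛ q       ≈⟨ Ring.*-congʳ (Exp.^-homo-* Ring.semiring p a (b ℕ.∸ a)) ⟩
    p ↑ a ⊛ p ↑ (b ℕ.∸ a) ⊛ q       ≈⟨ Ring.*-assoc (p ↑ a) (p ↑ (b ℕ.∸ a)) q ⟩
    p ↑ a ⊛ (p ↑ (b ℕ.∸ a) ⊛ q)     ∎)
    where open ≈-Reasoning

  -- From the threshold `2 ^ j * e` on, `π ↑ a` supplies the factor 2^e modulo `Ψ (2 ^ j)` that the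
  -- criterion asks for. The threshold depends on `p` alone, so the length of a descent can be fixed
  -- beforehand.
  ≡π^a⇒Ψ∣ : ∀ j p → ∃ λ n → ∀ a → n ≤ a → (∃ λ p′ → Ψ (2 ^ j) ∣ p ⊕ ⊝ (π ↑ a ⊛ p′)) → Ψ (2 ^ j) ∣ p
  ≡π^a⇒Ψ∣ j p =
    let (e , criterion) = 2^-Ψ∣-criterion j p
    in 2 ^ j ℕ.* e , λ a Ne≤a (p′ , d) →
      let (p″ , eq) = ↑-split π p′ Ne≤a
          (w , πN≈) = π^2^j≈Ψ+2w j
          (g , d′)  = π^Ne≡2^e (2 ^ j) w πN≈ e p″
      in criterion g (∣-difference-trans (∣-respʳ (Ring.+-congˡ (Ring.-‿cong eq)) d) d′)

  -- Modulo Ψ (2^j) the 2^j-th power of π is a multiple of 2, so a long enough descent makes one of the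
  -- factors congruent to a multiple of 2^e, where 2^e exceeds the coefficients of its remainder.
  Ψ-prime : ∀ j f g → Ψ (2 ^ j) ∣ f ⊛ g → Ψ (2 ^ j) ∣ f ⊎ Ψ (2 ^ j) ∣ g
  Ψ-prime j f g Ψ∣fg =
    let (m , f-good) = ≡π^a⇒Ψ∣ j f
        (n , g-good) = ≡π^a⇒Ψ∣ j g
        (a , b , eq , f≡ , g≡) = π-descent (2 ^ j) (m ℕ.+ n) f g Ψ∣fg
    in map (λ m≤a → f-good a m≤a f≡) (λ n≤b → g-good b n≤b g≡) (a+b≡c+d⇒c≤a⊎d≤b eq)

  -- Antiperiodic functionals

  I : ℕ → Poly
  I zero    = C 0ℤ
  I (suc n) = I n ⊕ X^ n

  π⊛I : ∀ n → π ⊛ I n ≈ C 1ℤ ⊕ ⊝ X^ n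
  π⊛I zero    = solve 1 (λ x → (con 1ℤ :- x) :* con 0ℤ := con 1ℤ :- con 1ℤ) ≈-refl X
  π⊛I (suc n) = begin
    π ⊛ (I n ⊕ X^ n)                        ≈⟨ Ring.distribˡ π (I n) (X^ n) ⟩
    π ⊛ I n ⊕ π ⊛ X^ n                      ≈⟨ Ring.+-congʳ (π⊛I n) ⟩
    C 1ℤ ⊕ ⊝ X^ n ⊕ π ⊛ X^ n                ≈⟨ telescope X (X^ n) ⟩
    C 1ℤ ⊕ ⊝ X^ (suc n)                     ∎
    where
    open ≈-Reasoning
    telescope : ∀ x y → C 1ℤ ⊕ ⊝ y ⊕ (C 1ℤ ⊕ ⊝ x) ⊛ y ≈ C 1ℤ ⊕ ⊝ (x ⊛ y)
    telescope = solve 2 (λ x y → con 1ℤ :- y :+ (con 1ℤ :- x) :* y := con 1ℤ :- x :* y) ≈-refl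

  Ψ∣1-X^ : ∀ N c → Ψ N ∣ C 1ℤ ⊕ ⊝ X^ (c ℕ.* (N ℕ.+ N))
  Ψ∣1-X^ N zero    = C 0ℤ , solve 1 (λ f → f :* con 0ℤ := con 1ℤ :- con 1ℤ) ≈-refl (Ψ N)
  Ψ∣1-X^ N (suc c) = ∣-respʳ
    (Ring.trans (step (X^ N) (X^ (c ℕ.* (N ℕ.+ N))))
      (Ring.+-congˡ (Ring.-‿cong (Ring.sym (Ring.trans (X^-+ (N ℕ.+ N) (c ℕ.* (N ℕ.+ N))) (Ring.*-congʳ (X^-+ N N)))))))
    (∣-⊕ (f∣f⊛p (Ψ N) (C 1ℤ ⊕ ⊝ X^ N)) (∣-⊛ˡ (X^ N ⊛ X^ N) (Ψ∣1-X^ N c)))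
    where
    step : ∀ x y → (C 1ℤ ⊕ x) ⊛ (C 1ℤ ⊕ ⊝ x) ⊕ x ⊛ x ⊛ (C 1ℤ ⊕ ⊝ y) ≈ C 1ℤ ⊕ ⊝ (x ⊛ x ⊛ y)
    step = solve 2 (λ x y → (con 1ℤ :+ x) :* (con 1ℤ :- x) :+ x :* x :* (con 1ℤ :- y) := con 1ℤ :- x :* x :* y) ≈-refl

  -- Multiplied by 1 - x the interval becomes 1 - x^(2Nc), which has the factor 1 - x^(2N) = (1 +
  -- x^N)(1 - x^N); then `π` is removed modulo `Ψ N`.
  Ψ∣I : ∀ N c → Ψ N ∣ I (c ℕ.* (N ℕ.+ N))
  Ψ∣I N c = Ψ∣π⊛⇒Ψ∣ N _ (∣-respʳ (Ring.sym (π⊛I (c ℕ.* (N ℕ.+ N)))) (Ψ∣1-X^ N c))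

  -- An N-antiperiodic weight stands in for evaluation at a primitive 2N-th root of unity.
  Antiperiodic : ℕ → Series → Set
  Antiperiodic N w = ∀ n → w (N ℕ.+ n) ≡ - w n

  pair-Ψ⊛ : ∀ N w p → ⟪ w , Ψ N ⊛ p ⟫ ≡ ⟪ (λ n → w n + w (N ℕ.+ n)) , p ⟫
  pair-Ψ⊛ N w p = begin
    ⟪ w , Ψ N ⊛ p ⟫                         ≡⟨ pair-congʳ w (solve 2 (λ x p → (con 1ℤ :+ x) :* p := p :+ x :* p) ≈-refl (X^ N) p) ⟩
    ⟪ w , p ⊕ X^ N ⊛ p ⟫                    ≡⟨ pair-⊕ w p (X^ N ⊛ p) ⟩
    ⟪ w , p ⟫ + ⟪ w , X^ N ⊛ p ⟫            ≡⟨ cong (_+_ ⟪ w , p ⟫) (pair-X^⊛ N w p) ⟩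
    ⟪ w , p ⟫ + ⟪ w ∘ (N ℕ.+_) , p ⟫        ≡⟨ pair-+ w (w ∘ (N ℕ.+_)) p ⟨
    ⟪ (λ n → w n + w (N ℕ.+ n)) , p ⟫       ∎
    where open ≡-Reasoning

  -- By adjunction a factor `Ψ N` replaces `w n` by `w n + w (N + n)`, which is zero.
  antiperiodic-kills : ∀ {N w p} → Antiperiodic N w → Ψ N ∣ p → ⟪ w , p ⟫ ≡ 0ℤ
  antiperiodic-kills {N} {w} {p} anti (h , e) = begin
    ⟪ w , p ⟫                           ≡⟨ pair-congʳ w e ⟨
    ⟪ w , Ψ N ⊛ h ⟫                     ≡⟨ pair-Ψ⊛ N w h ⟩
    ⟪ (λ n → w n + w (N ℕ.+ n)) , h ⟫   ≡⟨ pair-zero _ h (λ n → trans (cong (_+_ (w n)) (anti n)) (ℤₚ.+-inverseʳ (w n))) ⟩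
    0ℤ                                  ∎
    where open ≡-Reasoning

  -- The weight n · w n plays the role of the derivative at such a root.
  antiperiodic-moment-kills : ∀ {N w p} → Antiperiodic N w → Ψ N ⊛ Ψ N ∣ p → ⟪ (λ n → + n * w n) , p ⟫ ≡ 0ℤ
  antiperiodic-moment-kills {N} {w} {p} anti (h , e) = begin
    ⟪ moment , p ⟫                                ≡⟨ pair-congʳ moment e ⟨
    ⟪ moment , Ψ N ⊛ Ψ N ⊛ h ⟫                    ≡⟨ pair-congʳ moment (Ring.*-assoc (Ψ N) (Ψ N) h) ⟩
    ⟪ moment , Ψ N ⊛ (Ψ N ⊛ h) ⟫                  ≡⟨ pair-Ψ⊛ N moment (Ψ N ⊛ h) ⟩
    ⟪ (λ n → moment n + moment (N ℕ.+ n)) , Ψ N ⊛ h ⟫  ≡⟨ antiperiodic-kills {N} anti′ (f∣f⊛p (Ψ N) h) ⟩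
    0ℤ                                            ∎
    where
    open ≡-Reasoning
    moment : Series
    moment n = + n * w n
    -- The first factor `Ψ N` turns the moment weight into - N w, which is again antiperiodic and is
    -- killed by the second factor.
    collapse : ∀ n → moment n + moment (N ℕ.+ n) ≡ - (+ N * w n)
    collapse n = trans (cong (_+_ (+ n * w n)) (cong₂ _*_ (ℤₚ.pos-+ N n) (anti n))) (cancel (+ N) (+ n) (w n))
      where
      cancel : ∀ N n x → n * x + (N + n) * - x ≡ - (N * x)
      cancel = solve-∀
    anti′ : Antiperiodic N (λ n → moment n + moment (N ℕ.+ n))
    anti′ n = begin
      moment (N ℕ.+ n) + moment (N ℕ.+ (N ℕ.+ n))  ≡⟨ collapse (N ℕ.+ n) ⟩
      - (+ N * w (N ℕ.+ n))                        ≡⟨ cong (λ z → - (+ N * z)) (anti n) ⟩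
      - (+ N * - w n)                              ≡⟨ cong -_ (ℤₚ.neg-distribʳ-* (+ N) (w n)) ⟨
      - - (+ N * w n)                              ≡⟨ cong -_ (collapse n) ⟨
      - (moment n + moment (N ℕ.+ n))              ∎

  antiperiodic⇒periodic : ∀ {N w} → Antiperiodic N w → ∀ q n → w (q ℕ.* (N ℕ.+ N) ℕ.+ n) ≡ w n
  antiperiodic⇒periodic anti zero    n = refl
  antiperiodic⇒periodic {N} {w} anti (suc q) n = begin
    w (N ℕ.+ N ℕ.+ q ℕ.* (N ℕ.+ N) ℕ.+ n)       ≡⟨ cong w (trans (cong (ℕ._+ n) (ℕₚ.+-assoc N N _)) (trans (ℕₚ.+-assoc N _ n) (cong (N ℕ.+_) (ℕₚ.+-assoc N _ n)))) ⟩
    w (N ℕ.+ (N ℕ.+ (q ℕ.* (N ℕ.+ N) ℕ.+ n)))   ≡⟨ trans (anti _) (cong -_ (anti _)) ⟩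
    - - w (q ℕ.* (N ℕ.+ N) ℕ.+ n)               ≡⟨ ℤₚ.neg-involutive _ ⟩
    w (q ℕ.* (N ℕ.+ N) ℕ.+ n)                   ≡⟨ antiperiodic⇒periodic {N} {w} anti q n ⟩
    w n                                         ∎
    where open ≡-Reasoning

  antiperiodic-shift : ∀ {N w} c → Antiperiodic N w → Antiperiodic N (w ∘ (c ℕ.+_))
  antiperiodic-shift {N} {w} c anti n = trans (cong w (trans (sym (ℕₚ.+-assoc c N n)) (trans (cong (ℕ._+ n) (ℕₚ.+-comm c N)) (ℕₚ.+-assoc N c n)))) (anti (c ℕ.+ n))

  alternating : ℕ → ℤ
  alternating zero    = 1ℤ
  alternating (suc n) = - alternating n

  -- The basic antiperiodic weight: supported on the multiples of N with alternating signs. It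
  -- equals 1 exactly on the multiples of 2N, so it detects that residue class, and its shifts
  -- detect the others.
  comb : (N : ℕ) → .{{NonZero N}} → Series
  comb N n = if n % N ℕ.≡ᵇ 0 then alternating (n / N) else 0ℤ

  comb-antiperiodic : ∀ N .{{_ : NonZero N}} → Antiperiodic N (comb N)
  comb-antiperiodic N n = trans
    (cong₂ (λ r q → if r ℕ.≡ᵇ 0 then alternating q else 0ℤ) [N+n]%N≡n%N [N+n]/N≡1+n/N) (negate (n % N ℕ.≡ᵇ 0))
    where
    [N+n]%N≡n%N : (N ℕ.+ n) % N ≡ n % N
    [N+n]%N≡n%N = trans (cong (_% N) (ℕₚ.+-comm N n)) ([m+n]%n≡m%n n N)
    [N+n]/N≡1+n/N : (N ℕ.+ n) / N ≡ suc (n / N)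
    [N+n]/N≡1+n/N = trans (+-distrib-/-∣ˡ n ℕ∣.∣-refl) (cong (ℕ._+ n / N) (n/n≡1 N))
    negate : ∀ b → (if b then alternating (suc (n / N)) else 0ℤ) ≡ - (if b then alternating (n / N) else 0ℤ)
    negate true  = refl
    negate false = refl

  comb-∤ : ∀ N .{{_ : NonZero N}} n → ¬ N ℕ∣.∣ n → comb N n ≡ 0ℤ
  comb-∤ N n N∤n with n % N in eq
  ... | zero  = contradiction (ℕ∣.m%n≡0⇒n∣m n N eq) N∤n
  ... | suc _ = refl

  alternating≡1 : ∀ q → alternating q ≡ 1ℤ → ∃ λ h → q ≡ h ℕ.+ h
  alternating≡1 zero          _  = 0 , refl
  alternating≡1 (suc zero)    ()
  alternating≡1 (suc (suc q)) eq =
    let (h , q≡) = alternating≡1 q (trans (sym (ℤₚ.neg-involutive (alternating q))) eq)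
    in suc h , cong suc (trans (cong suc q≡) (sym (ℕₚ.+-suc h h)))

  comb≡1 : ∀ N .{{_ : NonZero N}} n → comb N n ≡ 1ℤ → ∃ λ q → n ≡ q ℕ.* (N ℕ.+ N)
  comb≡1 N n eq with n % N in n%N≡
  ... | suc _ = contradiction eq λ ()
  ... | zero  = let (h , n/N≡) = alternating≡1 (n / N) eq in h , (begin
    n                        ≡⟨ m≡m%n+[m/n]*n n N ⟩
    n % N ℕ.+ n / N ℕ.* N    ≡⟨ cong₂ (λ r q → r ℕ.+ q ℕ.* N) n%N≡ n/N≡ ⟩
    (h ℕ.+ h) ℕ.* N          ≡⟨ ℕₚ.*-distribʳ-+ N h h ⟩
    h ℕ.* N ℕ.+ h ℕ.* N      ≡⟨ ℕₚ.*-distribˡ-+ h N N ⟨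
    h ℕ.* (N ℕ.+ N)          ∎)
    where open ≡-Reasoning

  comb-period : ∀ N .{{_ : NonZero N}} q → comb N (q ℕ.* (N ℕ.+ N)) ≡ 1ℤ
  comb-period N q = begin
    comb N (q ℕ.* (N ℕ.+ N))          ≡⟨ cong (comb N) (ℕₚ.+-identityʳ _) ⟨
    comb N (q ℕ.* (N ℕ.+ N) ℕ.+ 0)    ≡⟨ antiperiodic⇒periodic {N} {comb N} (comb-antiperiodic N) q 0 ⟩
    comb N 0                          ≡⟨ comb-0 N ⟩
    1ℤ                                ∎
    where
    open ≡-Reasoning
    comb-0 : ∀ N .{{_ : NonZero N}} → comb N 0 ≡ 1ℤ
    comb-0 (suc M) = refl

  -- Cyclotomic factors of the sum polynomial

  intervalPlusTwo : ℕ → ℕ → ℕ → Poly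
  intervalPlusTwo m r₁ r₂ = I (suc m) ⊕ X^ r₁ ⊕ X^ r₂

  module _ (m r₁ r₂ : ℕ) where

    private
      P = intervalPlusTwo m r₁ r₂

    -- `Ψ N` also divides the full interval of length m + 3, as 2N divides m + 3. Subtracting that
    -- interval from `P` leaves x^r₁ + x^r₂ - x^(m+1) - x^(m+2).
    antiperiodic-balance : ∀ {N w} c → Antiperiodic N w → 3 ℕ.+ m ≡ c ℕ.* (N ℕ.+ N) → Ψ N ∣ P →
                           w r₁ + w r₂ ≡ w (1 ℕ.+ m) + w (2 ℕ.+ m)
    antiperiodic-balance {N} {w} c anti 3+m≡ Ψ∣P = ℤₚ.i-j≡0⇒i≡j _ _ (begin
      w r₁ + w r₂ + - (w (1 ℕ.+ m) + w (2 ℕ.+ m))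
        ≡⟨ cong₂ (λ a b → a + - b) (pair-X^+X^ r₁ r₂) (pair-X^+X^ (1 ℕ.+ m) (2 ℕ.+ m)) ⟨
      ⟪ w , X^ r₁ ⊕ X^ r₂ ⟫ + - ⟪ w , X^ (1 ℕ.+ m) ⊕ X^ (2 ℕ.+ m) ⟫
        ≡⟨ cong (_+_ ⟪ w , X^ r₁ ⊕ X^ r₂ ⟫) (pair-⊝ w _) ⟨
      ⟪ w , X^ r₁ ⊕ X^ r₂ ⟫ + ⟪ w , ⊝ (X^ (1 ℕ.+ m) ⊕ X^ (2 ℕ.+ m)) ⟫
        ≡⟨ pair-⊕ w _ _ ⟨
      ⟪ w , X^ r₁ ⊕ X^ r₂ ⊕ ⊝ (X^ (1 ℕ.+ m) ⊕ X^ (2 ℕ.+ m)) ⟫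
        ≡⟨ antiperiodic-kills {N} {w} anti (∣-respʳ (difference (I (suc m)) (X^ r₁) (X^ r₂) (X^ (1 ℕ.+ m)) (X^ (2 ℕ.+ m)))
             (∣-⊕ Ψ∣P (∣-⊝ (subst (λ n → Ψ N ∣ I n) (sym 3+m≡) (Ψ∣I N c))))) ⟩
      0ℤ ∎)
      where
      open ≡-Reasoning
      pair-X^+X^ : ∀ a b → ⟪ w , X^ a ⊕ X^ b ⟫ ≡ w a + w b
      pair-X^+X^ a b = trans (pair-⊕ w (X^ a) (X^ b)) (cong₂ _+_ (pair-X^ w a) (pair-X^ w b))
      difference : ∀ i a b c d → i ⊕ a ⊕ b ⊕ ⊝ (i ⊕ c ⊕ d) ≈ a ⊕ b ⊕ ⊝ (c ⊕ d)
      difference = solve 5 (λ i a b c d → i :+ a :+ b :- (i :+ c :+ d) := a :+ b :- (c :+ d)) ≈-refl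

    -- A full interval contains `Ψ N` only once and cannot be subtracted here. Multiplication by 1 -
    -- x serves instead: it reduces `P` to six monomials, of which the constant one has moment zero.
    antiperiodic-moment-balance : ∀ {N w} → Antiperiodic N w → Ψ N ⊛ Ψ N ∣ P →
      + r₁ * w r₁ + + r₂ * w r₂ ≡ + (1 ℕ.+ m) * w (1 ℕ.+ m) + + (1 ℕ.+ r₁) * w (1 ℕ.+ r₁) + + (1 ℕ.+ r₂) * w (1 ℕ.+ r₂)
    antiperiodic-moment-balance {N} {w} anti ΨΨ∣P = ℤₚ.i-j≡0⇒i≡j _ _ (begin
      v r₁ + v r₂ + - (v (1 ℕ.+ m) + v (1 ℕ.+ r₁) + v (1 ℕ.+ r₂))
        ≡⟨ cong (_+ - (v (1 ℕ.+ m) + v (1 ℕ.+ r₁) + v (1 ℕ.+ r₂))) (ℤₚ.+-identityˡ (v r₁ + v r₂)) ⟨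
      0ℤ + (v r₁ + v r₂) + - (v (1 ℕ.+ m) + v (1 ℕ.+ r₁) + v (1 ℕ.+ r₂))
        ≡⟨ cong₂ (λ a b → a + - b)
             (trans (pair-⊕ v (X^ 0) (X^ r₁ ⊕ X^ r₂)) (cong₂ _+_ (pair-X^ v 0) (trans (pair-⊕ v _ _) (cong₂ _+_ (pair-X^ v r₁) (pair-X^ v r₂)))))
             (trans (pair-⊕ v _ _) (cong₂ _+_ (trans (pair-⊕ v _ _) (cong₂ _+_ (pair-X^ v (1 ℕ.+ m)) (pair-X^ v (1 ℕ.+ r₁)))) (pair-X^ v (1 ℕ.+ r₂)))) ⟨
      ⟪ v , C 1ℤ ⊕ (X^ r₁ ⊕ X^ r₂) ⟫ + - ⟪ v , X^ (1 ℕ.+ m) ⊕ X^ (1 ℕ.+ r₁) ⊕ X^ (1 ℕ.+ r₂) ⟫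
        ≡⟨ trans (pair-⊕ v _ _) (cong (_+_ ⟪ v , C 1ℤ ⊕ (X^ r₁ ⊕ X^ r₂) ⟫) (pair-⊝ v _)) ⟨
      ⟪ v , C 1ℤ ⊕ (X^ r₁ ⊕ X^ r₂) ⊕ ⊝ (X^ (1 ℕ.+ m) ⊕ X^ (1 ℕ.+ r₁) ⊕ X^ (1 ℕ.+ r₂)) ⟫
        ≡⟨ pair-congʳ v πP≈ ⟨
      ⟪ v , π ⊛ P ⟫
        ≡⟨ antiperiodic-moment-kills {N} {w} anti (∣-⊛ˡ π ΨΨ∣P) ⟩
      0ℤ ∎)
      where
      open ≡-Reasoning
      v : Series
      v n = + n * w n
      expand : ∀ i a b y x → (C 1ℤ ⊕ ⊝ x) ⊛ i ≈ C 1ℤ ⊕ ⊝ y → (C 1ℤ ⊕ ⊝ x) ⊛ (i ⊕ a ⊕ b) ≈ C 1ℤ ⊕ (a ⊕ b) ⊕ ⊝ (y ⊕ x ⊛ a ⊕ x ⊛ b)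
      expand i a b y x e = Ring.trans
        (solve 4 (λ i a b x → (con 1ℤ :- x) :* (i :+ a :+ b) := (con 1ℤ :- x) :* i :+ (a :+ b) :- (x :* a :+ x :* b)) ≈-refl i a b x)
        (Ring.trans (Ring.+-congʳ (Ring.+-congʳ e))
          (solve 4 (λ y a b x → con 1ℤ :- y :+ (a :+ b) :- (x :* a :+ x :* b) := con 1ℤ :+ (a :+ b) :- (y :+ x :* a :+ x :* b)) ≈-refl y a b x))
      πP≈ : π ⊛ P ≈ C 1ℤ ⊕ (X^ r₁ ⊕ X^ r₂) ⊕ ⊝ (X^ (1 ℕ.+ m) ⊕ X^ (1 ℕ.+ r₁) ⊕ X^ (1 ℕ.+ r₂))
      πP≈ = expand (I (suc m)) (X^ r₁) (X^ r₂) (X^ (1 ℕ.+ m)) X (π⊛I (suc m))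

    -- For N ≥ 2 the comb shifted by 1 vanishes at r₁, because r₁ + 1 is odd, and at m + 1, because
    -- m + 2 precedes a multiple of N; this locates r₂. The comb shifted by 2 then vanishes at r₂
    -- and at m + 2, which locates r₁. For N = 1 the comb is (-1)ⁿ and has no zeros, so the parity
    -- of r₁ is used directly.
    Ψ∣P⇒congruences : ∀ j c → 3 ℕ.+ m ≡ c ℕ.* (2 ^ j ℕ.+ 2 ^ j) → 2 ℕ∣.∣ r₁ → Ψ (2 ^ j) ∣ P →
                      (∃ λ q → 2 ℕ.+ r₁ ≡ q ℕ.* (2 ^ j ℕ.+ 2 ^ j)) × (∃ λ q → 1 ℕ.+ r₂ ≡ q ℕ.* (2 ^ j ℕ.+ 2 ^ j))
    Ψ∣P⇒congruences zero c 3+m≡ (ℕ∣.divides h r₁≡) Ψ∣P =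
      (suc h , cong (2 ℕ.+_) r₁≡) , comb≡1 1 (1 ℕ.+ r₂) (begin
        comb 1 (1 ℕ.+ r₂)                             ≡⟨ comb-antiperiodic 1 r₂ ⟩
        - comb 1 r₂                                   ≡⟨ isolate 1ℤ (comb 1 r₂) (comb 1 (1 ℕ.+ m)) balance ⟩
        1ℤ                                            ∎)
      where
      open ≡-Reasoning
      balance : 1ℤ + comb 1 r₂ ≡ comb 1 (1 ℕ.+ m) + - comb 1 (1 ℕ.+ m)
      balance = begin
        1ℤ + comb 1 r₂                           ≡⟨ cong (_+ comb 1 r₂) (trans (cong (comb 1) r₁≡) (comb-period 1 h)) ⟨
        comb 1 r₁ + comb 1 r₂                    ≡⟨ antiperiodic-balance {1} {comb 1} c (comb-antiperiodic 1) 3+m≡ Ψ∣P ⟩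
        comb 1 (1 ℕ.+ m) + comb 1 (2 ℕ.+ m)      ≡⟨ cong (_+_ (comb 1 (1 ℕ.+ m))) (comb-antiperiodic 1 (1 ℕ.+ m)) ⟩
        comb 1 (1 ℕ.+ m) + - comb 1 (1 ℕ.+ m)    ∎
      isolate : ∀ a b x → a + b ≡ x + - x → - b ≡ a
      isolate a b x e = begin
        - b                 ≡⟨ ℤₚ.+-identityˡ (- b) ⟨
        0ℤ + - b            ≡⟨ cong (_+ - b) (trans e (ℤₚ.+-inverseʳ x)) ⟨
        a + b + - b         ≡⟨ ℤₚ.+-assoc a b (- b) ⟩
        a + (b + - b)       ≡⟨ cong (_+_ a) (ℤₚ.+-inverseʳ b) ⟩
        a + 0ℤ              ≡⟨ ℤₚ.+-identityʳ a ⟩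
        a                   ∎
    Ψ∣P⇒congruences (suc j) c 3+m≡ 2∣r₁ Ψ∣P = comb≡1 N (2 ℕ.+ r₁) at-2+r₁ , comb≡1 N (1 ℕ.+ r₂) at-1+r₂
      where
      open ≡-Reasoning
      N = 2 ^ suc j
      instance
        N≢0 : NonZero N
        N≢0 = ℕₚ.m^n≢0 2 (suc j)
      1<N : 1 < N
      1<N = ℕₚ.m≤m*n 2 (2 ^ j) {{ℕₚ.m^n≢0 2 j}}
      2∣N : 2 ℕ∣.∣ N
      2∣N = ℕ∣.m∣m*n (2 ^ j)
      consecutive : ∀ {d n} → 1 < d → d ℕ∣.∣ n → ¬ d ℕ∣.∣ 1 ℕ.+ n
      consecutive {d} {n} 1<d d∣n d∣1+n = ℕₚ.<⇒≢ 1<d (sym (ℕ∣.∣1⇒≡1 (ℕ∣.∣m+n∣m⇒∣n (subst (d ℕ∣.∣_) (ℕₚ.+-comm 1 n) d∣1+n) d∣n)))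
      N∣3+m : N ℕ∣.∣ 3 ℕ.+ m
      N∣3+m = ℕ∣.divides (c ℕ.+ c) (trans 3+m≡ (trans (ℕₚ.*-distribˡ-+ c N N) (sym (ℕₚ.*-distribʳ-+ N c c))))
      comb-3+m : comb N (3 ℕ.+ m) ≡ 1ℤ
      comb-3+m = trans (cong (comb N) 3+m≡) (comb-period N c)
      at-1+r₂ : comb N (1 ℕ.+ r₂) ≡ 1ℤ
      at-1+r₂ = begin
        comb N (1 ℕ.+ r₂)                         ≡⟨ ℤₚ.+-identityˡ _ ⟨
        0ℤ + comb N (1 ℕ.+ r₂)                    ≡⟨ cong (_+ comb N (1 ℕ.+ r₂)) (comb-∤ N (1 ℕ.+ r₁) λ N∣ → consecutive (s≤s (s≤s z≤n)) 2∣r₁ (ℕ∣.∣-trans 2∣N N∣)) ⟨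
        comb N (1 ℕ.+ r₁) + comb N (1 ℕ.+ r₂)     ≡⟨ antiperiodic-balance {N} c (antiperiodic-shift {N} {comb N} 1 (comb-antiperiodic N)) 3+m≡ Ψ∣P ⟩
        comb N (2 ℕ.+ m) + comb N (3 ℕ.+ m)       ≡⟨ cong₂ _+_ (comb-∤ N (2 ℕ.+ m) λ N∣ → consecutive 1<N N∣ N∣3+m) comb-3+m ⟩
        1ℤ                                        ∎
      N∣1+r₂ : N ℕ∣.∣ 1 ℕ.+ r₂
      N∣1+r₂ = let (q , eq) = comb≡1 N (1 ℕ.+ r₂) at-1+r₂
               in ℕ∣.divides (q ℕ.+ q) (trans eq (trans (ℕₚ.*-distribˡ-+ q N N) (sym (ℕₚ.*-distribʳ-+ N q q))))
      at-2+r₁ : comb N (2 ℕ.+ r₁) ≡ 1ℤ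
      at-2+r₁ = begin
        comb N (2 ℕ.+ r₁)                         ≡⟨ ℤₚ.+-identityʳ _ ⟨
        comb N (2 ℕ.+ r₁) + 0ℤ                    ≡⟨ cong (_+_ (comb N (2 ℕ.+ r₁))) (comb-∤ N (2 ℕ.+ r₂) (consecutive 1<N N∣1+r₂)) ⟨
        comb N (2 ℕ.+ r₁) + comb N (2 ℕ.+ r₂)     ≡⟨ antiperiodic-balance {N} c (antiperiodic-shift {N} {comb N} 2 (comb-antiperiodic N)) 3+m≡ Ψ∣P ⟩
        comb N (3 ℕ.+ m) + comb N (4 ℕ.+ m)       ≡⟨ cong₂ _+_ comb-3+m (comb-∤ N (4 ℕ.+ m) (consecutive 1<N N∣3+m)) ⟩
        1ℤ                                        ∎

    module _ (r₁<r₂ : r₁ < r₂) (r₂≤m : r₂ ≤ m) (2∣r₁ : 2 ℕ∣.∣ r₁) where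

      -- Here 2^(j+1) = m + 3, and 2 + r₁ is positive but smaller than m + 3, so it cannot be a
      -- multiple.
      top-Ψ∤P : ∀ j → 3 ℕ.+ m ≡ 2 ^ j ℕ.+ 2 ^ j → ¬ Ψ (2 ^ j) ∣ P
      top-Ψ∤P j 3+m≡ Ψ∣P with proj₁ (Ψ∣P⇒congruences j 1 (trans 3+m≡ (sym (ℕₚ.+-identityʳ _))) 2∣r₁ Ψ∣P)
      ... | suc q , eq = ℕₚ.<⇒≱ (ℕₚ.≤-<-trans (ℕₚ.+-monoʳ-≤ 2 (ℕₚ.<⇒≤ (ℕₚ.<-≤-trans r₁<r₂ r₂≤m))) (ℕₚ.n<1+n (2 ℕ.+ m)))
                           (subst (3 ℕ.+ m ≤_) (sym eq) (subst (_≤ suc q ℕ.* (2 ^ j ℕ.+ 2 ^ j)) (sym 3+m≡) (ℕₚ.m≤m+n _ _)))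

      -- Weights shifted by 2 see the exponents r₁, r₂, m + 1, r₁ + 1, r₂ + 1 as 0, 1, 0, 1, 2
      -- modulo 2N. Only three values of `w` remain, while the multipliers keep the true sizes.
      ΨΨ∣P⇒moments : ∀ j c → 3 ℕ.+ m ≡ c ℕ.* (2 ^ j ℕ.+ 2 ^ j) → Ψ (2 ^ j) ⊛ Ψ (2 ^ j) ∣ P →
                     ∀ {w} → Antiperiodic (2 ^ j) w →
                     + r₁ * w 0 + + r₂ * w 1 ≡ + (1 ℕ.+ m) * w 0 + + (1 ℕ.+ r₁) * w 1 + + (1 ℕ.+ r₂) * w 2
      ΨΨ∣P⇒moments j c 3+m≡ ΨΨ∣P {w} anti =
        let N = 2 ^ j
            ((q₁ , 2+r₁≡) , (q₂ , 1+r₂≡)) = Ψ∣P⇒congruences j c 3+m≡ 2∣r₁ (∣-trans (f∣f⊛p (Ψ N) (Ψ N)) ΨΨ∣P)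
            at : ∀ {a} q n → a ≡ q ℕ.* (N ℕ.+ N) → w (n ℕ.+ a) ≡ w n
            at q n a≡ = trans (cong w (trans (cong (n ℕ.+_) a≡) (ℕₚ.+-comm n _))) (antiperiodic⇒periodic {N} {w} anti q n)
            w-r₁   = at q₁ 0 2+r₁≡
            w-1+r₁ = at q₁ 1 2+r₁≡
            w-r₂   = at q₂ 1 1+r₂≡
            w-1+r₂ = at q₂ 2 1+r₂≡
            w-1+m  = at c 0 3+m≡
        in trans (sym (cong₂ (λ a b → + r₁ * a + + r₂ * b) w-r₁ w-r₂))
          (trans (antiperiodic-moment-balance {N} (antiperiodic-shift {N} {w} 2 anti) ΨΨ∣P)
            (cong₂ _+_ (cong₂ (λ a b → + (1 ℕ.+ m) * a + + (1 ℕ.+ r₁) * b) w-1+m w-1+r₁) (cong (+ (1 ℕ.+ r₂) *_) w-1+r₂)))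

      -- N = 2 is the only value of N = 2^j at which a double root can occur, and there it forces the claimed parameters.
      ΨΨ∣P⇒adjacent : ∀ j c → 3 ℕ.+ m ≡ c ℕ.* (2 ^ j ℕ.+ 2 ^ j) → Ψ (2 ^ j) ⊛ Ψ (2 ^ j) ∣ P →
                      r₂ ≡ 1 ℕ.+ r₁ × m ≡ r₁ ℕ.+ r₂
      -- With the signs (-1)ⁿ the relation reads r₁ + (r₁ + 1) = (m + 1) + (r₂ + 1) + r₂, where the
      -- right side is too large.
      ΨΨ∣P⇒adjacent zero c 3+m≡ ΨΨ∣P = contradiction (ℤₚ.+-injective equation) (ℕₚ.<⇒≢ too-big)
        where
        rearrange : ∀ x y u s t → x * 1ℤ + y * -1ℤ ≡ u * 1ℤ + s * -1ℤ + t * 1ℤ → x + s ≡ u + t + y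
        rearrange x y u s t e = trans (lhs x y s) (trans (cong (_+ (y + s)) e) (rhs y u s t))
          where
          lhs : ∀ x y s → x + s ≡ x * 1ℤ + y * -1ℤ + (y + s)
          lhs = solve-∀
          rhs : ∀ y u s t → u * 1ℤ + s * -1ℤ + t * 1ℤ + (y + s) ≡ u + t + y
          rhs = solve-∀
        equation : + (r₁ ℕ.+ (1 ℕ.+ r₁)) ≡ + (1 ℕ.+ m ℕ.+ (1 ℕ.+ r₂) ℕ.+ r₂)
        equation = rearrange (+ r₁) (+ r₂) (+ (1 ℕ.+ m)) (+ (1 ℕ.+ r₁)) (+ (1 ℕ.+ r₂))
                     (ΨΨ∣P⇒moments 0 c 3+m≡ ΨΨ∣P {comb 1} (comb-antiperiodic 1))
        too-big : r₁ ℕ.+ (1 ℕ.+ r₁) < 1 ℕ.+ m ℕ.+ (1 ℕ.+ r₂) ℕ.+ r₂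
        too-big = ℕₚ.+-mono-<-≤ (ℕₚ.<-≤-trans r₁<r₂ (ℕₚ.≤-trans (ℕₚ.n≤1+n r₂) (ℕₚ.m≤n+m (1 ℕ.+ r₂) (1 ℕ.+ m)))) r₁<r₂
      -- The comb of step 2 has values 1, 0, -1 at 0, 1, 2 and yields m = r₁ + r₂; its shift by one
      -- has values 0, -1, 0 and yields r₂ = r₁ + 1.
      ΨΨ∣P⇒adjacent (suc zero) c 3+m≡ ΨΨ∣P = r₂≡1+r₁ , ℕₚ.suc-injective (trans (sym (ℤₚ.+-injective second)) (ℕₚ.+-suc r₁ r₂))
        where
        rearrange₁ : ∀ x y u s t → x * 0ℤ + y * -1ℤ ≡ u * 0ℤ + s * -1ℤ + t * 0ℤ → y ≡ s
        rearrange₁ x y u s t e = trans (lhs x y) (trans (cong -_ e) (rhs u s t))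
          where
          lhs : ∀ x y → y ≡ - (x * 0ℤ + y * -1ℤ)
          lhs = solve-∀
          rhs : ∀ u s t → - (u * 0ℤ + s * -1ℤ + t * 0ℤ) ≡ s
          rhs = solve-∀
        rearrange₂ : ∀ x y u s t → x * 1ℤ + y * 0ℤ ≡ u * 1ℤ + s * 0ℤ + t * -1ℤ → x + t ≡ u
        rearrange₂ x y u s t e = trans (lhs x y t) (trans (cong (_+ t) e) (rhs u s t))
          where
          lhs : ∀ x y t → x + t ≡ x * 1ℤ + y * 0ℤ + t
          lhs = solve-∀
          rhs : ∀ u s t → u * 1ℤ + s * 0ℤ + t * -1ℤ + t ≡ u
          rhs = solve-∀
        r₂≡1+r₁ : r₂ ≡ 1 ℕ.+ r₁
        r₂≡1+r₁ = ℤₚ.+-injective (rearrange₁ (+ r₁) (+ r₂) (+ (1 ℕ.+ m)) (+ (1 ℕ.+ r₁)) (+ (1 ℕ.+ r₂))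
          (ΨΨ∣P⇒moments 1 c 3+m≡ ΨΨ∣P (antiperiodic-shift {2} {comb 2} 1 (comb-antiperiodic 2))))
        second : + (r₁ ℕ.+ (1 ℕ.+ r₂)) ≡ + (1 ℕ.+ m)
        second = rearrange₂ (+ r₁) (+ r₂) (+ (1 ℕ.+ m)) (+ (1 ℕ.+ r₁)) (+ (1 ℕ.+ r₂))
          (ΨΨ∣P⇒moments 1 c 3+m≡ ΨΨ∣P {comb 2} (comb-antiperiodic 2))
      ΨΨ∣P⇒adjacent (suc (suc j)) c 3+m≡ ΨΨ∣P = contradiction (ℤₚ.+-injective equation) λ ()
        where
        N = 2 ^ suc (suc j)
        -- For N ≥ 4 the comb shifted by N - 2 has values 0, 0, -1 at 0, 1, 2, so that only the term
        -- of r₂ + 1 survives, and it would have to be zero.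
        M = N ℕ.∸ 2
        instance
          N≢0 : NonZero N
          N≢0 = ℕₚ.m^n≢0 2 (suc (suc j))
        4≤N : 4 ≤ N
        4≤N = ℕₚ.^-monoʳ-≤ 2 {2} {suc (suc j)} (s≤s (s≤s z≤n))
        2+M≡N : 2 ℕ.+ M ≡ N
        2+M≡N = ℕₚ.m+[n∸m]≡n (ℕₚ.≤-trans (s≤s (s≤s z≤n)) 4≤N)
        small : ∀ n → 0 < n → n < N → comb N n ≡ 0ℤ
        small n 0<n n<N = comb-∤ N n (ℕ∣.>⇒∤ {{ℕ.>-nonZero 0<n}} n<N)
        0<M : 0 < M
        0<M = ℕₚ.≤-trans (s≤s z≤n) (ℕₚ.∸-monoˡ-≤ 2 4≤N)
        w : Series
        w = comb N ∘ (M ℕ.+_)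
        w0 : w 0 ≡ 0ℤ
        w0 = trans (cong (comb N) (ℕₚ.+-identityʳ M)) (small M 0<M (subst (M <_) 2+M≡N (ℕₚ.m≤n⇒m≤1+n ℕₚ.≤-refl)))
        w1 : w 1 ≡ 0ℤ
        w1 = trans (cong (comb N) (ℕₚ.+-comm M 1)) (small (1 ℕ.+ M) (s≤s z≤n) (subst (1 ℕ.+ M <_) 2+M≡N ℕₚ.≤-refl))
        w2 : w 2 ≡ -1ℤ
        w2 = begin
          comb N (M ℕ.+ 2)    ≡⟨ cong (comb N) (trans (ℕₚ.+-comm M 2) (trans 2+M≡N (sym (ℕₚ.+-identityʳ N)))) ⟩
          comb N (N ℕ.+ 0)    ≡⟨ comb-antiperiodic N 0 ⟩
          - comb N 0          ≡⟨ cong -_ (comb-period N 0) ⟩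
          -1ℤ                 ∎
          where open ≡-Reasoning
        rearrange : ∀ x y u s t → x * 0ℤ + y * 0ℤ ≡ u * 0ℤ + s * 0ℤ + t * -1ℤ → t ≡ 0ℤ
        rearrange x y u s t e = trans (lhs u s t) (trans (cong -_ (sym e)) (rhs x y))
          where
          lhs : ∀ u s t → t ≡ - (u * 0ℤ + s * 0ℤ + t * -1ℤ)
          lhs = solve-∀
          rhs : ∀ x y → - (x * 0ℤ + y * 0ℤ) ≡ 0ℤ
          rhs = solve-∀
        equation : + (1 ℕ.+ r₂) ≡ 0ℤ
        equation = rearrange (+ r₁) (+ r₂) (+ (1 ℕ.+ m)) (+ (1 ℕ.+ r₁)) (+ (1 ℕ.+ r₂)) (trans
          (sym (cong₂ (λ a b → + r₁ * a + + r₂ * b) w0 w1))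
          (trans (ΨΨ∣P⇒moments (suc (suc j)) c 3+m≡ ΨΨ∣P (antiperiodic-shift {N} {comb N} M (comb-antiperiodic N)))
            (cong₂ _+_ (cong₂ (λ a b → + (1 ℕ.+ m) * a + + (1 ℕ.+ r₁) * b) w0 w1) (cong (+ (1 ℕ.+ r₂) *_) w2))))

  -- Coefficients and values of the sum polynomial, and removal of powers of a factor

  ι : Bool → ℤ
  ι b = if b then 1ℤ else 0ℤ

  coeff-X^-ι : ∀ r n → coeff (X^ r) n ≡ ι (n ℕ.≡ᵇ r)
  coeff-X^-ι zero    zero    = coeff-C 1ℤ 0
  coeff-X^-ι zero    (suc n) = coeff-C 1ℤ (suc n)
  coeff-X^-ι (suc r) zero    = coeff-X⊛ (X^ r) 0
  coeff-X^-ι (suc r) (suc n) = trans (coeff-X⊛ (X^ r) (suc n)) (coeff-X^-ι r n)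

  coeff-I : ∀ n i → coeff (I n) i ≡ ι (i ℕ.<ᵇ n)
  coeff-I zero    i = coeff-0 i
  coeff-I (suc n) i = trans (coeff-⊕ (I n) (X^ n) i) (trans (cong₂ _+_ (coeff-I n i) (coeff-X^-ι n i)) (split i n))
    where
    split : ∀ i n → ι (i ℕ.<ᵇ n) + ι (i ℕ.≡ᵇ n) ≡ ι (i ℕ.<ᵇ suc n)
    split zero    zero    = refl
    split zero    (suc n) = refl
    split (suc i) zero    = refl
    split (suc i) (suc n) = split i n

  coeff-intervalPlusTwo : ∀ m r₁ r₂ i →
    coeff (intervalPlusTwo m r₁ r₂) i ≡ ι (i ℕ.<ᵇ suc m) + ι (i ℕ.≡ᵇ r₁) + ι (i ℕ.≡ᵇ r₂)
  coeff-intervalPlusTwo m r₁ r₂ i = trans (coeff-⊕ _ (X^ r₂) i) (cong₂ _+_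
    (trans (coeff-⊕ (I (suc m)) (X^ r₁) i) (cong₂ _+_ (coeff-I (suc m) i) (coeff-X^-ι r₁ i))) (coeff-X^-ι r₂ i))

  ≡ᵇ-false : ∀ {i j} → i ≢ j → (i ℕ.≡ᵇ j) ≡ false
  ≡ᵇ-false {zero}  {zero}  i≢j = contradiction refl i≢j
  ≡ᵇ-false {zero}  {suc j} i≢j = refl
  ≡ᵇ-false {suc i} {zero}  i≢j = refl
  ≡ᵇ-false {suc i} {suc j} i≢j = ≡ᵇ-false (i≢j ∘ cong suc)

  <ᵇ-false : ∀ {i j} → j ≤ i → (i ℕ.<ᵇ j) ≡ false
  <ᵇ-false {i}     z≤n       = refl
  <ᵇ-false {suc i} (s≤s j≤i) = <ᵇ-false j≤i

  intervalPlusTwo-vanish : ∀ {m r₁ r₂} → r₁ ≤ m → r₂ ≤ m → ∀ i → m < i → coeff (intervalPlusTwo m r₁ r₂) i ≡ 0ℤ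
  intervalPlusTwo-vanish {m} {r₁} {r₂} r₁≤m r₂≤m i m<i = trans (coeff-intervalPlusTwo m r₁ r₂ i)
    (cong₂ _+_ (cong₂ _+_ (cong ι (<ᵇ-false m<i)) (cong ι (≡ᵇ-false (ℕₚ.>⇒≢ (ℕₚ.≤-<-trans r₁≤m m<i)))))
               (cong ι (≡ᵇ-false (ℕₚ.>⇒≢ (ℕₚ.≤-<-trans r₂≤m m<i)))))

  intervalPlusTwo-0 : ∀ {m r₁ r₂} → 0 < r₁ → 0 < r₂ → coeff (intervalPlusTwo m r₁ r₂) 0 ≡ 1ℤ
  intervalPlusTwo-0 {m} {suc r₁} {suc r₂} _ _ = coeff-intervalPlusTwo m (suc r₁) (suc r₂) 0

  eval₁-I : ∀ n → eval₁ (I n) ≡ + n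
  eval₁-I zero    = eval₁-C 0ℤ
  eval₁-I (suc n) = trans (eval₁-⊕ (I n) (X^ n)) (trans (cong₂ _+_ (eval₁-I n) (eval₁-X^ n)) (cong +_ (ℕₚ.+-comm n 1)))

  eval₁-intervalPlusTwo : ∀ m r₁ r₂ → eval₁ (intervalPlusTwo m r₁ r₂) ≡ + (3 ℕ.+ m)
  eval₁-intervalPlusTwo m r₁ r₂ = trans (eval₁-⊕ _ (X^ r₂)) (trans (cong₂ _+_
    (trans (eval₁-⊕ (I (suc m)) (X^ r₁)) (cong₂ _+_ (eval₁-I (suc m)) (eval₁-X^ r₁))) (eval₁-X^ r₂))
    (cong +_ (trans (ℕₚ.+-comm _ 1) (cong suc (ℕₚ.+-comm _ 1)))))

  coeff₀-⊛ : ∀ p q → coeff (p ⊛ q) 0 ≡ coeff p 0 * coeff q 0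
  coeff₀-⊛ p q = coeff-⊛ p q 0

  coeff₀-↑ : ∀ {p} n → coeff p 0 ≡ 1ℤ → coeff (p ↑ n) 0 ≡ 1ℤ
  coeff₀-↑ zero    p₀≡1 = coeff-C 1ℤ 0
  coeff₀-↑ {p} (suc n) p₀≡1 = trans (coeff₀-⊛ p (p ↑ n)) (cong₂ _*_ p₀≡1 (coeff₀-↑ {p} n p₀≡1))

  coeff₀-Ψ : ∀ N → 1 ≤ N → coeff (Ψ N) 0 ≡ 1ℤ
  coeff₀-Ψ (suc M) _ = trans (coeff-⊕ (C 1ℤ) (X^ suc M) 0) (cong₂ _+_ (coeff-C 1ℤ 0) (coeff-X^-ι (suc M) 0))

  -- From index `d` on the coefficients of `g` are constant, since (1 - x) g has none later, and
  -- they are eventually zero. So division by 1 - x lowers the bound by one.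
  π⊛-vanish : ∀ d g → (∀ n → suc d ≤ n → coeff (π ⊛ g) n ≡ 0ℤ) → ∀ n → d ≤ n → coeff g n ≡ 0ℤ
  π⊛-vanish d g πg≡0 n d≤n = go (bound g) n d≤n (ℕₚ.m≤n+m (bound g) n)
    where
    coeff-π⊛ : ∀ n → coeff (π ⊛ g) (suc n) ≡ coeff g (suc n) + - coeff g n
    coeff-π⊛ n = trans (at (solve 2 (λ x g → (con 1ℤ :- x) :* g := g :- x :* g) ≈-refl X g) (suc n))
      (trans (coeff-⊕ g _ (suc n)) (cong (_+_ (coeff g (suc n))) (trans (coeff-⊝ (X ⊛ g) (suc n)) (cong -_ (coeff-X⊛ g (suc n))))))
    go : ∀ e n → d ≤ n → bound g ≤ n ℕ.+ e → coeff g n ≡ 0ℤ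
    go zero    n d≤n le = vanish g n (subst (bound g ≤_) (ℕₚ.+-identityʳ n) le)
    go (suc e) n d≤n le = trans
      (sym (ℤₚ.i-j≡0⇒i≡j (coeff g (suc n)) (coeff g n) (trans (sym (coeff-π⊛ n)) (πg≡0 (suc n) (s≤s d≤n)))))
      (go e (suc n) (ℕₚ.m≤n⇒m≤1+n d≤n) (subst (bound g ≤_) (ℕₚ.+-suc n e) le))

  -- Recursion on the bound, which drops with every division by 1 - x. Bound zero would contradict
  -- the constant term 1, which the division preserves.
  π-factor : ∀ d p → (∀ n → d ≤ n → coeff p n ≡ 0ℤ) → coeff p 0 ≡ 1ℤ → ∃₂ λ k u → p ≈ π ↑ k ⊛ u × eval₁ u ≢ 0ℤ
  π-factor zero    p p≡0 p₀≡1 = contradiction (trans (sym p₀≡1) (p≡0 0 z≤n)) λ ()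
  π-factor (suc d) p p≡0 p₀≡1 = case eval₁ p ℤₚ.≟ 0ℤ of λ
    { (no  eval≢0) → 0 , p , Ring.sym (Ring.*-identityˡ p) , eval≢0
    ; (yes eval≡0) →
        let (g , p≈) = divide-π p
            p≈πg     = Ring.trans p≈ (Ring.trans (Ring.+-congˡ (Ring.reflexive (cong C eval≡0))) (Ring.+-identityʳ (π ⊛ g)))
            g₀≡1     = trans (sym (ℤₚ.*-identityˡ (coeff g 0))) (trans (cong (_* coeff g 0) (sym coeff-π-0))
                         (trans (sym (coeff₀-⊛ π g)) (trans (sym (at p≈πg 0)) p₀≡1)))
            (k , u , g≈ , eval≢0) = π-factor d g (π⊛-vanish d g λ n le → trans (sym (at p≈πg n)) (p≡0 n le)) g₀≡1
        in suc k , u , Ring.trans p≈πg (Ring.trans (Ring.*-congˡ g≈) (Ring.sym (Ring.*-assoc π (π ↑ k) u))) , eval≢0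
    }

  power-[X²] : ∀ {f f′ p q} n → f [X²] ≈ f′ → p ≈ f ↑ n ⊛ q → p [X²] ≈ f′ ↑ n ⊛ q [X²]
  power-[X²] {f} {f′} {p} {q} n f[X²]≈ p≈ = begin
    p [X²]                      ≈⟨ [X²]-cong p≈ ⟩
    (f ↑ n ⊛ q) [X²]            ≈⟨ [X²]-⊛ (f ↑ n) q ⟩
    (f ↑ n) [X²] ⊛ q [X²]       ≈⟨ Ring.*-congʳ ([X²]-↑ f n) ⟩
    f [X²] ↑ n ⊛ q [X²]         ≈⟨ Ring.*-congʳ (Exp.^-congˡ Ring.semiring n f[X²]≈) ⟩
    f′ ↑ n ⊛ q [X²]             ∎
    where open ≈-Reasoning

  Ψ-[X²] : ∀ N → Ψ N [X²] ≈ Ψ (2 ℕ.* N)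
  Ψ-[X²] N = Ring.trans ([X²]-⊕ (C 1ℤ) (X^ N)) (Ring.+-cong ([X²]-C 1ℤ)
    (Ring.trans ([X²]-X^ N) (Ring.reflexive (cong (λ M → X^ (N ℕ.+ M)) (sym (ℕₚ.+-identityʳ N))))))

  π-[X²] : π [X²] ≈ π ⊛ Ψ 1
  π-[X²] = Ring.trans ([X²]-⊕ (C 1ℤ) (⊝ X)) (Ring.trans
    (Ring.+-cong ([X²]-C 1ℤ) (Ring.trans ([X²]-⊝ X) (Ring.-‿cong [X²]-X)))
    (solve 1 (λ x → con 1ℤ :- x :* x := (con 1ℤ :- x) :* (con 1ℤ :+ x :* con 1ℤ)) ≈-refl X))

  -- By primality each of the `a` factors can be taken out of `p` or of `q`: `c` of them come from
  -- `p` and `b` from `q`. Further factors may remain in `p′` and `q′`.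
  peel-powers : ∀ j a p q w → p ⊛ q ≈ Ψ (2 ^ j) ↑ a ⊛ w →
    ∃₂ λ b c → b ℕ.+ c ≡ a × ∃₂ λ p′ q′ → p ≈ Ψ (2 ^ j) ↑ c ⊛ p′ × q ≈ Ψ (2 ^ j) ↑ b ⊛ q′ × p′ ⊛ q′ ≈ w
  peel-powers j zero    p q w e = 0 , 0 , refl , p , q , Ring.sym (Ring.*-identityˡ p) , Ring.sym (Ring.*-identityˡ q)
                                , Ring.trans e (Ring.*-identityˡ w)
  peel-powers j (suc a) p q w e = case Ψ-prime j p q (Φ ↑ a ⊛ w , Ring.sym (Ring.trans e (Ring.*-assoc Φ (Φ ↑ a) w))) of λ
    { (inj₁ (p₁ , Φp₁≈p)) →
        let e₁ = ⊛-cancelˡ Φ Φ₀≡1 (Ring.trans (Ring.sym (Ring.*-assoc Φ p₁ q)) (Ring.trans (Ring.*-congʳ Φp₁≈p) (Ring.trans e (Ring.*-assoc Φ (Φ ↑ a) w))))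
            (b , c , b+c≡a , p′ , q′ , p₁≈ , q≈ , rest) = peel-powers j a p₁ q w e₁
        in b , suc c , trans (ℕₚ.+-suc b c) (cong suc b+c≡a) , p′ , q′ , extend c p₁≈ Φp₁≈p , q≈ , rest
    ; (inj₂ (q₁ , Φq₁≈q)) →
        let e₁ = ⊛-cancelˡ Φ Φ₀≡1 (Ring.trans (swap Φ p q₁) (Ring.trans (Ring.*-congˡ Φq₁≈q) (Ring.trans e (Ring.*-assoc Φ (Φ ↑ a) w))))
            (b , c , b+c≡a , p′ , q′ , p≈ , q₁≈ , rest) = peel-powers j a p q₁ w e₁
        in suc b , c , cong suc b+c≡a , p′ , q′ , p≈ , extend b q₁≈ Φq₁≈q , rest
    }
    where
    Φ = Ψ (2 ^ j)
    Φ₀≡1 : coeff Φ 0 ≡ 1ℤ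
    Φ₀≡1 = coeff₀-Ψ (2 ^ j) (ℕₚ.m^n>0 2 j)
    swap : ∀ f p q → f ⊛ (p ⊛ q) ≈ p ⊛ (f ⊛ q)
    swap = solve 3 (λ f p q → f :* (p :* q) := p :* (f :* q)) ≈-refl
    extend : ∀ {p₁ p′ p} c → p₁ ≈ Φ ↑ c ⊛ p′ → Φ ⊛ p₁ ≈ p → p ≈ Φ ↑ suc c ⊛ p′
    extend {p′ = p′} c e e′ = Ring.trans (Ring.sym e′) (Ring.trans (Ring.*-congˡ e) (Ring.sym (Ring.*-assoc Φ (Φ ↑ c) p′)))

  -- Descent along the tower 1 + x, 1 + x², 1 + x⁴, …

  module _ (m r₁ r₂ : ℕ) (r₁<r₂ : r₁ < r₂) (r₂≤m : r₂ ≤ m) (0<r₁ : 0 < r₁) (2∣r₁ : 2 ℕ∣.∣ r₁)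
           (t : Poly) (t₀≡1 : coeff t 0 ≡ 1ℤ) (t-vanish : ∀ n → m < n → coeff t n ≡ 0ℤ) where

    private
      P = intervalPlusTwo m r₁ r₂

      Adjacent : Set
      Adjacent = r₂ ≡ 1 ℕ.+ r₁ × m ≡ r₁ ℕ.+ r₂

    -- After j steps the factors 1 + x^(2^i) with i < j have been divided out of t and of P; each step lowers the
    -- exponent by the multiplicity of its factor in P.
    record Stage (k j : ℕ) : Set where
      constructor stage
      field
        exponent : ℕ
        p q      : Poly
        p∣t      : p ∣ t
        q∣P      : q ∣ P
        equation : p ⊛ q ≈ Ψ (2 ^ j) ↑ exponent ⊛ p [X²]
        enough   : k ≤ exponent ℕ.+ j

    π-free-part : t ⊛ P ≈ t [X²] → ∃ λ k → 3 ℕ.+ m ≡ 2 ^ k × Stage k 0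
    π-free-part tP≈ =
      let (k , u , t≈ , eval≢0) = π-factor (suc m) t t-vanish t₀≡1
          uP≈ = reduced k u t≈
      in k , size k u eval≢0 uP≈ , stage k u P (π ↑ k , Ring.trans (Ring.*-comm u (π ↑ k)) (Ring.sym t≈)) (C 1ℤ , Ring.*-identityʳ P)
                                     uP≈ (ℕₚ.≤-reflexive (sym (ℕₚ.+-identityʳ k)))
      where
      reduced : ∀ k u → t ≈ π ↑ k ⊛ u → u ⊛ P ≈ Ψ 1 ↑ k ⊛ u [X²]
      reduced k u t≈ = ⊛-cancelˡ (π ↑ k) (coeff₀-↑ {π} k coeff-π-0) (begin
        π ↑ k ⊛ (u ⊛ P)                   ≈⟨ Ring.*-assoc (π ↑ k) u P ⟨
        π ↑ k ⊛ u ⊛ P                     ≈⟨ Ring.*-congʳ t≈ ⟨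
        t ⊛ P                             ≈⟨ tP≈ ⟩
        t [X²]                            ≈⟨ power-[X²] {π} {π ⊛ Ψ 1} k π-[X²] t≈ ⟩
        (π ⊛ Ψ 1) ↑ k ⊛ u [X²]            ≈⟨ Ring.*-congʳ (CExp.^-distrib-* Ring.commutativeSemiring π (Ψ 1) k) ⟩
        π ↑ k ⊛ Ψ 1 ↑ k ⊛ u [X²]          ≈⟨ Ring.*-assoc (π ↑ k) (Ψ 1 ↑ k) (u [X²]) ⟩
        π ↑ k ⊛ (Ψ 1 ↑ k ⊛ u [X²])        ∎)
        where open ≈-Reasoning
      eval₁-Ψ1↑ : ∀ k → eval₁ (Ψ 1 ↑ k) ≡ + (2 ^ k)
      eval₁-Ψ1↑ zero    = eval₁-C 1ℤ
      eval₁-Ψ1↑ (suc k) = trans (eval₁-⊛ (Ψ 1) (Ψ 1 ↑ k)) (trans (cong₂ _*_ (eval₁-Ψ 1) (eval₁-Ψ1↑ k)) (sym (ℤₚ.pos-* 2 (2 ^ k))))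
      size : ∀ k u → eval₁ u ≢ 0ℤ → u ⊛ P ≈ Ψ 1 ↑ k ⊛ u [X²] → 3 ℕ.+ m ≡ 2 ^ k
      size k u eval≢0 e = ℤₚ.+-injective (ℤₚ.*-cancelˡ-≡ (eval₁ u) _ _ {{ℤ.≢-nonZero eval≢0}} (begin
        eval₁ u * + (3 ℕ.+ m)              ≡⟨ cong (eval₁ u *_) (eval₁-intervalPlusTwo m r₁ r₂) ⟨
        eval₁ u * eval₁ P                  ≡⟨ eval₁-⊛ u P ⟨
        eval₁ (u ⊛ P)                      ≡⟨ eval₁-cong e ⟩
        eval₁ (Ψ 1 ↑ k ⊛ u [X²])           ≡⟨ eval₁-⊛ (Ψ 1 ↑ k) (u [X²]) ⟩
        eval₁ (Ψ 1 ↑ k) * eval₁ (u [X²])   ≡⟨ cong₂ _*_ (eval₁-Ψ1↑ k) (eval₁-[X²] u) ⟩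
        + (2 ^ k) * eval₁ u                ≡⟨ ℤₚ.*-comm (+ (2 ^ k)) (eval₁ u) ⟩
        eval₁ u * + (2 ^ k)                ∎))
        where open ≡-Reasoning

    factor∣ : ∀ {f g p} → p ≈ f ⊛ g → g ∣ p
    factor∣ {f} {g} e = f , Ring.sym (Ring.trans e (Ring.*-comm f g))

    -- Substituting x² carries 1 + x^(2^j) to 1 + x^(2^(j+1)), so the power taken out of `p`
    -- reappears one level up, in front of p′(x²).
    next-stage : ∀ {k j} c {p p′ q q′} → p ∣ t → q ∣ P → p ≈ Ψ (2 ^ j) ↑ c ⊛ p′ → q′ ∣ q → p′ ⊛ q′ ≈ p [X²] →
                 k ≤ c ℕ.+ suc j → Stage k (suc j)
    next-stage {k} {j} c {p} {p′} {q} {q′} p∣t q∣P p≈ q′∣q e enough =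
      stage c p′ q′ (∣-trans (factor∣ p≈) p∣t) (∣-trans q′∣q q∣P)
        (Ring.trans e (power-[X²] {Ψ (2 ^ j)} c (Ψ-[X²] (2 ^ j)) p≈)) enough

    -- If `P` supplies at most one factor, the exponent falls by at most one while `j` grows by one,
    -- which keeps `enough`. Two factors from `P` are a double root.
    advance : ∀ {k j} c → 3 ℕ.+ m ≡ c ℕ.* (2 ^ j ℕ.+ 2 ^ j) → Stage k j → Adjacent ⊎ Stage k (suc j)
    advance {k} {j} d 3+m≡ (stage a p q p∣t q∣P e enough) = split (peel-powers j a p q (p [X²]) e)
      where
      Φ = Ψ (2 ^ j)
      split : (∃₂ λ b c → b ℕ.+ c ≡ a × ∃₂ λ p′ q′ → p ≈ Φ ↑ c ⊛ p′ × q ≈ Φ ↑ b ⊛ q′ × p′ ⊛ q′ ≈ p [X²]) → Adjacent ⊎ Stage k (suc j)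
      split (zero , c , refl , p′ , q′ , p≈ , q≈ , e′) = inj₂ (next-stage c p∣t q∣P p≈ (factor∣ q≈) e′
        (ℕₚ.≤-trans enough (ℕₚ.+-monoʳ-≤ c (ℕₚ.n≤1+n j))))
      split (suc zero , c , refl , p′ , q′ , p≈ , q≈ , e′) = inj₂ (next-stage c p∣t q∣P p≈ (factor∣ q≈) e′
        (subst (k ≤_) (sym (ℕₚ.+-suc c j)) enough))
      split (suc (suc b) , c , refl , p′ , q′ , p≈ , q≈ , e′) = inj₁ (ΨΨ∣P⇒adjacent m r₁ r₂ r₁<r₂ r₂≤m 2∣r₁ j d 3+m≡
        (∣-trans (Φ ↑ b ⊛ q′ , Ring.trans (regroup Φ (Φ ↑ b) q′) (Ring.sym q≈)) q∣P))
        where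
        regroup : ∀ f g h → f ⊛ f ⊛ (g ⊛ h) ≈ f ⊛ (f ⊛ g) ⊛ h
        regroup = solve 3 (λ f g h → f :* f :* (g :* h) := f :* (f :* g) :* h) ≈-refl

    Ψ-large∤ : ∀ p j → 3 ℕ.+ m ≡ 2 ^ j → (∀ n → m < n → coeff p n ≡ 0ℤ) → coeff p 0 ≡ 1ℤ → ¬ Ψ (2 ^ j) ∣ p
    Ψ-large∤ p j 3+m≡ p-vanish p₀≡1 Ψ∣p = contradiction (trans (sym p₀≡1) (trans (at p≈0 0) (coeff-0 0))) λ ()
      where
      p≈0 : p ≈ C 0ℤ
      p≈0 = Ψ∣small⇒≈0 (2 ℕ.+ m) p (subst (λ N → Ψ N ∣ p) (sym 3+m≡) Ψ∣p) (λ n 2+m<n → p-vanish n (ℕₚ.≤-trans (ℕₚ.m≤n+m (suc m) 2) 2+m<n))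

    -- At j = k - 1 the polynomial `P` supplies no factor, and `enough` leaves exponent at least 1.
    -- Hence 1 + x^(2^k) would divide `t` or `P`. Its degree m + 3 exceeds theirs, and both have
    -- constant term 1.
    no-last-stage : ∀ j → 3 ℕ.+ m ≡ 2 ^ suc j → ¬ Stage (suc j) j
    no-last-stage j 3+m≡ (stage a p q p∣t q∣P e enough) = split (peel-powers j a p q (p [X²]) e)
      where
      Φ = Ψ (2 ^ j)
      3+m≡N+N : 3 ℕ.+ m ≡ 2 ^ j ℕ.+ 2 ^ j
      3+m≡N+N = trans 3+m≡ (cong (2 ^ j ℕ.+_) (ℕₚ.+-identityʳ (2 ^ j)))
      r₁≤m = ℕₚ.≤-trans (ℕₚ.<⇒≤ r₁<r₂) r₂≤m
      split : ¬ ∃₂ λ b c → b ℕ.+ c ≡ a × ∃₂ λ p′ q′ → p ≈ Φ ↑ c ⊛ p′ × q ≈ Φ ↑ b ⊛ q′ × p′ ⊛ q′ ≈ p [X²]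
      split (suc b , c , refl , p′ , q′ , p≈ , q≈ , e′) = top-Ψ∤P m r₁ r₂ r₁<r₂ r₂≤m 2∣r₁ j 3+m≡N+N
        (∣-trans (Φ ↑ b ⊛ q′ , Ring.trans (Ring.sym (Ring.*-assoc Φ (Φ ↑ b) q′)) (Ring.sym q≈)) q∣P)
      split (zero , zero , refl , _) = ℕₚ.1+n≰n enough
      split (zero , suc c , refl , p′ , q′ , p≈ , q≈ , e′) = case Ψ-prime (suc j) p′ q′ Ψ∣p′q′ of λ
        { (inj₁ Ψ∣p′) → Ψ-large∤ t (suc j) 3+m≡ t-vanish t₀≡1 (∣-trans Ψ∣p′ (∣-trans (factor∣ p≈) p∣t))
        ; (inj₂ Ψ∣q′) → Ψ-large∤ P (suc j) 3+m≡ (intervalPlusTwo-vanish {m} {r₁} {r₂} r₁≤m r₂≤m)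
                          (intervalPlusTwo-0 {m} {r₁} {r₂} 0<r₁ (ℕₚ.<-trans 0<r₁ r₁<r₂)) (∣-trans Ψ∣q′ (∣-trans (factor∣ q≈) q∣P)) }
        where
        Ψ′ = Ψ (2 ^ suc j)
        Ψ∣p′q′ : Ψ′ ∣ p′ ⊛ q′
        Ψ∣p′q′ = Ψ′ ↑ c ⊛ p′ [X²] , Ring.trans (Ring.sym (Ring.*-assoc Ψ′ (Ψ′ ↑ c) (p′ [X²])))
                   (Ring.sym (Ring.trans e′ (power-[X²] {Φ} (suc c) (Ψ-[X²] (2 ^ j)) p≈)))

    -- `i` counts the levels still below k - 1. Stopping there keeps 2^(j+1) a divisor of m + 3 =
    -- 2^k at every step taken, as the analysis of double roots requires.
    reach : ∀ {k} j i → k ≡ suc (i ℕ.+ j) → 3 ℕ.+ m ≡ 2 ^ k → Stage k 0 → Adjacent ⊎ Stage k j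
    reach zero    i k≡ 3+m≡ s₀ = inj₂ s₀
    reach {k} (suc j) i k≡ 3+m≡ s₀ = case reach j (suc i) (trans k≡ (cong suc (ℕₚ.+-suc i j))) 3+m≡ s₀ of λ
      { (inj₁ adjacent) → inj₁ adjacent
      ; (inj₂ s)        → advance (2 ^ suc i) 3+m≡′ s }
      where
      open ≡-Reasoning
      3+m≡′ : 3 ℕ.+ m ≡ 2 ^ suc i ℕ.* (2 ^ j ℕ.+ 2 ^ j)
      3+m≡′ = begin
        3 ℕ.+ m                              ≡⟨ 3+m≡ ⟩
        2 ^ k                                ≡⟨ cong (2 ^_) k≡ ⟩
        2 ^ suc (i ℕ.+ suc j)                ≡⟨ ℕₚ.^-distribˡ-+-* 2 (suc i) (suc j) ⟩
        2 ^ suc i ℕ.* 2 ^ suc j              ≡⟨ cong (λ N → 2 ^ suc i ℕ.* (2 ^ j ℕ.+ N)) (ℕₚ.+-identityʳ (2 ^ j)) ⟩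
        2 ^ suc i ℕ.* (2 ^ j ℕ.+ 2 ^ j)      ∎

    functional-equation⇒parameters : t ⊛ P ≈ t [X²] → ∃ λ h → 3 ℕ.+ m ≡ 2 ^ suc h × r₂ ≡ 1 ℕ.+ r₁ × m ≡ r₁ ℕ.+ r₂
    functional-equation⇒parameters tP≈ = conclude (π-free-part tP≈)
      where
      conclude : (∃ λ k → 3 ℕ.+ m ≡ 2 ^ k × Stage k 0) → ∃ λ h → 3 ℕ.+ m ≡ 2 ^ suc h × Adjacent
      conclude (suc h , 3+m≡ , s₀) = case reach h 0 refl 3+m≡ s₀ of λ
        { (inj₁ adjacent) → h , 3+m≡ , adjacent
        ; (inj₂ s)        → contradiction s (no-last-stage h 3+m≡) }

  -- Representation functions and the Thue–Morse polynomial

  indicator : NSet → Series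
  indicator S n = ι (S n)

  countBelow-front : ∀ p k → countBelow p (suc k) ≡ (if p 0 then 1 else 0) ℕ.+ countBelow (p ∘ suc) k
  countBelow-front p zero    = sym (ℕₚ.+-identityʳ _)
  countBelow-front p (suc k) = trans (cong (ℕ._+ (if p (suc k) then 1 else 0)) (countBelow-front p k)) (ℕₚ.+-assoc (if p 0 then 1 else 0) _ _)

  countBelow-cong : ∀ {p q} k → (∀ s → s < k → p s ≡ q s) → countBelow p k ≡ countBelow q k
  countBelow-cong zero    p≡q = refl
  countBelow-cong (suc k) p≡q = cong₂ ℕ._+_ (countBelow-cong k λ s s<k → p≡q s (ℕₚ.m≤n⇒m≤1+n s<k)) (cong (if_then 1 else 0) (p≡q k (ℕₚ.n<1+n k)))

  -- Remove the outermost pair (0, n + 2); lowering both members of every other pair by one gives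
  -- pairs of sum n in the shifted set.
  R-step : ∀ S n → R S (2 ℕ.+ n) ≡ (if S 0 ∧ S (2 ℕ.+ n) then 1 else 0) ℕ.+ R (S ∘ suc) n
  R-step S n = begin
    -- The last candidate s = n + 2 leaves the complement 0, and s < 0 fails.
    countBelow p (2 ℕ.+ n) ℕ.+ (if p (2 ℕ.+ n) then 1 else 0)   ≡⟨ cong (λ k → countBelow p (2 ℕ.+ n) ℕ.+ (if (2 ℕ.+ n ℕ.<ᵇ k) ∧ S (2 ℕ.+ n) ∧ S k then 1 else 0)) (ℕₚ.n∸n≡0 n) ⟩
    countBelow p (2 ℕ.+ n) ℕ.+ 0                                ≡⟨ ℕₚ.+-identityʳ _ ⟩
    countBelow p (2 ℕ.+ n)                                      ≡⟨ countBelow-front p (suc n) ⟩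
    (if p 0 then 1 else 0) ℕ.+ countBelow (p ∘ suc) (suc n)      ≡⟨ cong ((if p 0 then 1 else 0) ℕ.+_) (countBelow-cong (suc n) inner) ⟩
    (if p 0 then 1 else 0) ℕ.+ R (S ∘ suc) n                    ∎
    where
    open ≡-Reasoning
    p : ℕ → Bool
    p s = (s ℕ.<ᵇ (2 ℕ.+ n) ℕ.∸ s) ∧ S s ∧ S ((2 ℕ.+ n) ℕ.∸ s)
    inner : ∀ s → s < suc n → p (suc s) ≡ (s ℕ.<ᵇ n ℕ.∸ s) ∧ S (suc s) ∧ S (suc (n ℕ.∸ s))
    inner s (s≤s s≤n) = cong (λ k → (suc s ℕ.<ᵇ k) ∧ S (suc s) ∧ S k) (ℕₚ.+-∸-assoc 1 s≤n)

  -- The square of a generating function counts ordered pairs: each pair s < s′ twice, and the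
  -- diagonal once, which gives S(x²). The induction strips the summands 0 and n together.
  conv-indicator : ∀ S n → conv (indicator S) (indicator S) n ≡ + 2 * + R S n + spread (indicator S) n
  conv-indicator S zero with S 0
  ... | true  = refl
  ... | false = refl
  conv-indicator S (suc zero) with S 0 | S 1
  ... | true  | true  = refl
  ... | true  | false = refl
  ... | false | true  = refl
  ... | false | false = refl
  conv-indicator S (suc (suc n)) = begin
    f 0 * f (2 ℕ.+ n) + conv (f ∘ suc) f (suc n)
      ≡⟨ cong (_+_ (f 0 * f (2 ℕ.+ n))) (conv-sucʳ (f ∘ suc) f n) ⟩
    f 0 * f (2 ℕ.+ n) + (conv (f ∘ suc) (f ∘ suc) n + f (2 ℕ.+ n) * f 0)
      ≡⟨ cong (λ z → f 0 * f (2 ℕ.+ n) + (z + f (2 ℕ.+ n) * f 0)) (conv-indicator (S ∘ suc) n) ⟩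
    f 0 * f (2 ℕ.+ n) + (+ 2 * + R (S ∘ suc) n + spread (f ∘ suc) n + f (2 ℕ.+ n) * f 0)
      ≡⟨ rearrange (f 0) (f (2 ℕ.+ n)) (+ R (S ∘ suc) n) (spread (f ∘ suc) n) ⟩
    + 2 * (f 0 * f (2 ℕ.+ n) + + R (S ∘ suc) n) + spread (f ∘ suc) n
      ≡⟨ cong (λ z → + 2 * z + spread (f ∘ suc) n) (trans (cong (_+ + R (S ∘ suc) n) (ι-∧ (S 0) (S (2 ℕ.+ n)))) (cong +_ (sym (R-step S n)))) ⟩
    + 2 * + R S (2 ℕ.+ n) + spread (f ∘ suc) n ∎
    where
    open ≡-Reasoning
    f = indicator S
    ι-∧ : ∀ a b → ι a * ι b ≡ + (if a ∧ b then 1 else 0)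
    ι-∧ true  true  = refl
    ι-∧ true  false = refl
    ι-∧ false true  = refl
    ι-∧ false false = refl
    rearrange : ∀ a b r s → a * b + (+ 2 * r + s + b * a) ≡ + 2 * (a * b + r) + s
    rearrange = solve-∀

  FunctionalEquation : Poly → Poly → Set
  FunctionalEquation t P = t ⊛ P ≈ t [X²]

  module _ (C₁ D₁ : NSet) (c d : Poly) (c-coeff : ∀ n → coeff c n ≡ ι (C₁ n)) (d-coeff : ∀ n → coeff d n ≡ ι (D₁ n)) where

    difference-of-squares : (c ⊕ ⊝ d) ⊛ (c ⊕ d) ≈ c ⊛ c ⊕ ⊝ (d ⊛ d)
    difference-of-squares = solve 2 (λ c d → (c :- d) :* (c :+ d) := c :* c :- d :* d) ≈-refl c d

    coeff-product : ∀ n → coeff ((c ⊕ ⊝ d) ⊛ (c ⊕ d)) n ≡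
      (+ 2 * + R C₁ n + spread (indicator C₁) n) + - (+ 2 * + R D₁ n + spread (indicator D₁) n)
    coeff-product n = trans (at difference-of-squares n) (trans (coeff-⊕ (c ⊛ c) _ n) (cong₂ _+_ (square c C₁ c-coeff n)
        (trans (coeff-⊝ (d ⊛ d) n) (cong -_ (square d D₁ d-coeff n)))))
      where
      square : ∀ p S → (∀ n → coeff p n ≡ ι (S n)) → ∀ n → coeff (p ⊛ p) n ≡ + 2 * + R S n + spread (indicator S) n
      square p S p≡ n = trans (coeff-⊛ p p n) (trans (conv-cong p≡ p≡ n) (conv-indicator S n))

    coeff-spread : ∀ n → coeff ((c ⊕ ⊝ d) [X²]) n ≡ spread (indicator C₁) n + - spread (indicator D₁) n
    coeff-spread n = trans (at ([X²]-⊕ c (⊝ d)) n) (trans (coeff-⊕ (c [X²]) _ n) (cong₂ _+_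
      (trans (coeff-[X²] c n) (spread-cong c-coeff n))
      (trans (at ([X²]-⊝ d) n) (trans (coeff-⊝ (d [X²]) n) (cong -_ (trans (coeff-[X²] d n) (spread-cong d-coeff n)))))))

    R≡⇒functional : (∀ n → R C₁ n ≡ R D₁ n) → FunctionalEquation (c ⊕ ⊝ d) (c ⊕ d)
    R≡⇒functional R≡ = coeffs λ n → trans (coeff-product n) (trans
      (cong (λ r → (+ 2 * + r + spread (indicator C₁) n) + - (+ 2 * + R D₁ n + spread (indicator D₁) n)) (R≡ n))
      (trans (cancel (+ 2 * + R D₁ n) (spread (indicator C₁) n) (spread (indicator D₁) n)) (sym (coeff-spread n))))
      where
      cancel : ∀ r x y → (r + x) + - (r + y) ≡ x + - y
      cancel = solve-∀

    functional⇒R≡ : FunctionalEquation (c ⊕ ⊝ d) (c ⊕ d) → ∀ n → R C₁ n ≡ R D₁ n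
    functional⇒R≡ e n = ℤₚ.+-injective (ℤₚ.*-cancelˡ-≡ (+ 2) _ _ (cancel (+ 2 * + R C₁ n) (+ 2 * + R D₁ n) (spread (indicator C₁) n) (spread (indicator D₁) n)
      (trans (sym (coeff-product n)) (trans (at e n) (coeff-spread n)))))
      where
      cancel : ∀ r s x y → (r + x) + - (s + y) ≡ x + - y → r ≡ s
      cancel r s x y e = trans (lhs r s x y) (trans (cong (_+ (s + y + - x)) e) (rhs s x y))
        where
        lhs : ∀ r s x y → r ≡ (r + x) + - (s + y) + (s + y + - x)
        lhs = solve-∀
        rhs : ∀ s x y → x + - y + (s + y + - x) ≡ s
        rhs = solve-∀

  -- The equation is linear, so the difference `u` solves it with u(0) = 0. At index n ≥ 1 the right
  -- side only involves u at n / 2, hence the lowest nonzero coefficient of `u` cannot exist.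
  functional-unique : ∀ {t t′ P} → coeff P 0 ≡ 1ℤ → coeff t 0 ≡ coeff t′ 0 →
                      FunctionalEquation t P → FunctionalEquation t′ P → t ≈ t′
  functional-unique {t} {t′} {P} P₀≡1 t₀≡ e e′ = coeffs λ n →
    ℤₚ.i-j≡0⇒i≡j (coeff t n) (coeff t′ n) (trans (sym (coeff-u n)) (<-rec (λ n → coeff u n ≡ 0ℤ) step n))
    where
    open ≡-Reasoning
    u : Poly
    u = t ⊕ ⊝ t′
    coeff-u : ∀ n → coeff u n ≡ coeff t n + - coeff t′ n
    coeff-u n = trans (coeff-⊕ t (⊝ t′) n) (cong (_+_ (coeff t n)) (coeff-⊝ t′ n))
    uP≈ : FunctionalEquation u P
    uP≈ = Ring.trans (solve 3 (λ t t′ P → (t :- t′) :* P := t :* P :- t′ :* P) ≈-refl t t′ P)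
      (Ring.trans (Ring.+-cong e (Ring.-‿cong e′)) (Ring.sym (Ring.trans ([X²]-⊕ t (⊝ t′)) (Ring.+-congˡ ([X²]-⊝ t′)))))
    spread-half : ∀ (f : Series) n → (∀ i → i < suc n → f i ≡ 0ℤ) → spread f (suc n) ≡ 0ℤ
    spread-half f zero    f≡0 = refl
    spread-half f (suc n) f≡0 = spread-zero (f ∘ suc) n λ i i≤n → f≡0 (suc i) (s≤s (s≤s i≤n))
    step : ∀ n → (∀ {i} → i < n → coeff u i ≡ 0ℤ) → coeff u n ≡ 0ℤ
    step zero    below = trans (coeff-u 0) (trans (cong (_+ - coeff t′ 0) t₀≡) (ℤₚ.+-inverseʳ (coeff t′ 0)))
    step (suc n) below = begin
      coeff u (suc n)                      ≡⟨ ℤₚ.*-identityʳ _ ⟨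
      coeff u (suc n) * 1ℤ                 ≡⟨ cong (coeff u (suc n) *_) P₀≡1 ⟨
      coeff u (suc n) * coeff P 0          ≡⟨ conv-lowest (coeff u) (coeff P) (suc n) (λ i i<n → below i<n) ⟨
      conv (coeff u) (coeff P) (suc n)     ≡⟨ coeff-⊛ u P (suc n) ⟨
      coeff (u ⊛ P) (suc n)                ≡⟨ at uP≈ (suc n) ⟩
      coeff (u [X²]) (suc n)               ≡⟨ coeff-[X²] u (suc n) ⟩
      spread (coeff u) (suc n)             ≡⟨ spread-half (coeff u) n (λ i i<n → below i<n) ⟩
      0ℤ                                   ∎

  -- Binary digit parity and its generating polynomial

  oddOnesAux-fuel : ∀ f g n → n ≤ f → n ≤ g → oddOnesAux f n ≡ oddOnesAux g n
  oddOnesAux-fuel zero    zero    zero    _  _  = refl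
  oddOnesAux-fuel zero    (suc g) zero    _  _  = refl
  oddOnesAux-fuel (suc f) zero    zero    _  _  = refl
  oddOnesAux-fuel (suc f) (suc g) zero    _  _  = refl
  oddOnesAux-fuel (suc f) (suc g) (suc k) (s≤s k≤f) (s≤s k≤g) =
    cong (λ b → if (suc k / 2) ℕ.* 2 ℕ.<ᵇ suc k then not b else b)
      (oddOnesAux-fuel f g (suc k / 2) (ℕₚ.≤-trans half≤k k≤f) (ℕₚ.≤-trans half≤k k≤g))
    where
    half≤k : suc k / 2 ≤ k
    half≤k = ℕₚ.≤-pred (m/n<m (suc k) 2 (s≤s (s≤s z≤n)))

  -- After one halving the fuel left is `n`, whereas `oddOnes q` starts with fuel `q`; independence
  -- of the fuel reconciles them.
  oddOnes-half : ∀ n q → suc n / 2 ≡ q → oddOnes (suc n) ≡ (if q ℕ.* 2 ℕ.<ᵇ suc n then not (oddOnes q) else oddOnes q)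
  oddOnes-half n q refl = cong (λ b → if (suc n / 2) ℕ.* 2 ℕ.<ᵇ suc n then not b else b)
    (oddOnesAux-fuel n (suc n / 2) (suc n / 2) (ℕₚ.≤-pred (m/n<m (suc n) 2 (s≤s (s≤s z≤n)))) ℕₚ.≤-refl)

  oddOnes-even : ∀ q → oddOnes (q ℕ.* 2) ≡ oddOnes q
  oddOnes-even zero    = refl
  oddOnes-even (suc q) = trans (oddOnes-half (suc (q ℕ.* 2)) (suc q) (m*n/n≡m (suc q) 2))
    (cong (λ b → if b then not (oddOnes (suc q)) else oddOnes (suc q)) (<ᵇ-false {suc q ℕ.* 2} ℕₚ.≤-refl))

  oddOnes-odd : ∀ q → oddOnes (suc (q ℕ.* 2)) ≡ not (oddOnes q)
  oddOnes-odd q = trans (oddOnes-half (q ℕ.* 2) q (trans (+-distrib-/-∣ʳ 1 {d = 2} (ℕ∣.n∣m*n q)) (m*n/n≡m q 2)))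
    (cong (λ b → if b then not (oddOnes q) else oddOnes q) (n<ᵇ1+n (q ℕ.* 2)))
    where
    n<ᵇ1+n : ∀ n → (n ℕ.<ᵇ suc n) ≡ true
    n<ᵇ1+n zero    = refl
    n<ᵇ1+n (suc n) = n<ᵇ1+n n

  even-<ᵇ : ∀ q N → (q ℕ.* 2 ℕ.<ᵇ N ℕ.* 2) ≡ (q ℕ.<ᵇ N)
  even-<ᵇ zero    zero    = refl
  even-<ᵇ zero    (suc N) = refl
  even-<ᵇ (suc q) zero    = refl
  even-<ᵇ (suc q) (suc N) = even-<ᵇ q N

  odd-<ᵇ : ∀ q N → (suc (q ℕ.* 2) ℕ.<ᵇ N ℕ.* 2) ≡ (q ℕ.<ᵇ N)
  odd-<ᵇ zero    zero    = refl
  odd-<ᵇ zero    (suc N) = refl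
  odd-<ᵇ (suc q) zero    = refl
  odd-<ᵇ (suc q) (suc N) = odd-<ᵇ q N

  parity : ∀ n → ∃ λ q → n ≡ q ℕ.* 2 ⊎ n ≡ suc (q ℕ.* 2)
  parity zero    = 0 , inj₁ refl
  parity (suc n) = case parity n of λ
    { (q , inj₁ n≡) → q , inj₂ (cong suc n≡)
    ; (q , inj₂ n≡) → suc q , inj₁ (cong suc n≡) }

  -- The product of 1 - x^(2^i) over i < h. Built with x ↦ x² it mirrors appending a lowest binary
  -- digit.
  τ : ℕ → Poly
  τ zero    = C 1ℤ
  τ (suc h) = π ⊛ τ h [X²]

  spread-even : ∀ f q → spread f (q ℕ.* 2) ≡ f q
  spread-even f zero    = refl
  spread-even f (suc q) = spread-even (f ∘ suc) q

  spread-odd : ∀ f q → spread f (suc (q ℕ.* 2)) ≡ 0ℤ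
  spread-odd f zero    = refl
  spread-odd f (suc q) = spread-odd (f ∘ suc) q

  coeff-π⊛ : ∀ p n → coeff (π ⊛ p) n ≡ coeff p n + - shiftUp (coeff p) n
  coeff-π⊛ p n = trans (at (solve 2 (λ x p → (con 1ℤ :- x) :* p := p :- x :* p) ≈-refl X p) n)
    (trans (coeff-⊕ p _ n) (cong (_+_ (coeff p n)) (trans (coeff-⊝ (X ⊛ p) n) (cong -_ (coeff-X⊛ p n)))))

  coeff-π⊛[X²]-even : ∀ p q → coeff (π ⊛ p [X²]) (q ℕ.* 2) ≡ coeff p q
  coeff-π⊛[X²]-even p q = trans (coeff-π⊛ (p [X²]) (q ℕ.* 2)) (trans
    (cong₂ (λ a b → a + - b) (trans (coeff-[X²] p (q ℕ.* 2)) (spread-even (coeff p) q)) (previous q)) (ℤₚ.+-identityʳ (coeff p q)))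
    where
    previous : ∀ q → shiftUp (coeff (p [X²])) (q ℕ.* 2) ≡ 0ℤ
    previous zero    = refl
    previous (suc q) = trans (coeff-[X²] p (suc (q ℕ.* 2))) (spread-odd (coeff p) q)

  coeff-π⊛[X²]-odd : ∀ p q → coeff (π ⊛ p [X²]) (suc (q ℕ.* 2)) ≡ - coeff p q
  coeff-π⊛[X²]-odd p q = trans (coeff-π⊛ (p [X²]) (suc (q ℕ.* 2))) (trans
    (cong₂ (λ a b → a + - b) (trans (coeff-[X²] p (suc (q ℕ.* 2))) (spread-odd (coeff p) q))
                             (trans (coeff-[X²] p (q ℕ.* 2)) (spread-even (coeff p) q)))
    (ℤₚ.+-identityˡ _))

  -- The value (−1)^b when c holds and 0 otherwise, split as in ι (A_ h n) − ι (B_ h n).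
  signed : Bool → Bool → ℤ
  signed b c = ι (not b ∧ c) + - ι (b ∧ c)

  -- In (1 - x) p(x²) index 2q carries the coefficient of `p` at q and index 2q + 1 its negative:
  -- the digit 0 keeps the parity of ones and the digit 1 flips it.
  coeff-τ : ∀ h n → coeff (τ h) n ≡ ι (A_ h n) + - ι (B_ h n)
  coeff-τ zero    zero    = coeff-C 1ℤ 0
  coeff-τ zero    (suc n) = trans (coeff-C 1ℤ (suc n)) (sym (cong₂ (λ a b → ι a + - ι b) (𝔹ₚ.∧-zeroʳ (not (oddOnes (suc n)))) (𝔹ₚ.∧-zeroʳ (oddOnes (suc n)))))
  coeff-τ (suc h) n       = case parity n of λ
    { (q , inj₁ refl) → trans (coeff-π⊛[X²]-even (τ h) q) (trans (coeff-τ h q)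
        (cong₂ signed (sym (oddOnes-even q)) (sym (trans (cong (q ℕ.* 2 ℕ.<ᵇ_) (ℕₚ.*-comm 2 (2 ^ h))) (even-<ᵇ q (2 ^ h))))))
    ; (q , inj₂ refl) → trans (coeff-π⊛[X²]-odd (τ h) q) (trans (cong -_ (coeff-τ h q)) (trans (flip (oddOnes q) (q ℕ.<ᵇ 2 ^ h))
        (cong₂ signed (sym (oddOnes-odd q)) (sym (trans (cong (suc (q ℕ.* 2) ℕ.<ᵇ_) (ℕₚ.*-comm 2 (2 ^ h))) (odd-<ᵇ q (2 ^ h)))))))
    }
    where
    flip : ∀ b c → - signed b c ≡ signed (not b) c
    flip true  true  = refl
    flip true  false = refl
    flip false true  = refl
    flip false false = refl

  -- Splits off the highest factor, where the definition splits off the lowest. Comparing the two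
  -- expresses (1 - x) τ(x²) through τ.
  τ-suc : ∀ h → τ (suc h) ≈ τ h ⊛ (C 1ℤ ⊕ ⊝ X^ (2 ^ h))
  τ-suc zero    = Ring.trans (Ring.*-congˡ ([X²]-C 1ℤ))
    (solve 1 (λ x → (con 1ℤ :- x) :* con 1ℤ := con 1ℤ :* (con 1ℤ :- x :* con 1ℤ)) ≈-refl X)
  τ-suc (suc h) = begin
    π ⊛ τ (suc h) [X²]                                   ≈⟨ Ring.*-congˡ ([X²]-cong (τ-suc h)) ⟩
    π ⊛ (τ h ⊛ (C 1ℤ ⊕ ⊝ X^ (2 ^ h))) [X²]               ≈⟨ Ring.*-congˡ ([X²]-⊛ (τ h) _) ⟩
    π ⊛ (τ h [X²] ⊛ (C 1ℤ ⊕ ⊝ X^ (2 ^ h)) [X²])          ≈⟨ Ring.*-assoc π (τ h [X²]) _ ⟨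
    τ (suc h) ⊛ (C 1ℤ ⊕ ⊝ X^ (2 ^ h)) [X²]               ≈⟨ Ring.*-congˡ (1-X^-[X²] (2 ^ h)) ⟩
    τ (suc h) ⊛ (C 1ℤ ⊕ ⊝ X^ (2 ^ h ℕ.+ 2 ^ h))          ≡⟨ cong (λ N → τ (suc h) ⊛ (C 1ℤ ⊕ ⊝ X^ (2 ^ h ℕ.+ N))) (ℕₚ.+-identityʳ (2 ^ h)) ⟨
    τ (suc h) ⊛ (C 1ℤ ⊕ ⊝ X^ (2 ^ suc h))                ∎
    where
    open ≈-Reasoning
    1-X^-[X²] : ∀ N → (C 1ℤ ⊕ ⊝ X^ N) [X²] ≈ C 1ℤ ⊕ ⊝ X^ (N ℕ.+ N)
    1-X^-[X²] N = Ring.trans ([X²]-⊕ (C 1ℤ) _) (Ring.+-cong ([X²]-C 1ℤ) (Ring.trans ([X²]-⊝ (X^ N)) (Ring.-‿cong ([X²]-X^ N))))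

  -- The explicit solution of the functional equation

  solution : ℕ → ℕ → Poly
  solution h s = (C 1ℤ ⊕ ⊝ X^ s) ⊛ τ h

  -- For m = 2s + 1 and exponents s, s + 1 the product is 1 + x^s - x^(s+2) - x^(2s+2), which
  -- factors.
  π⊛intervalPlusTwo : ∀ s → π ⊛ intervalPlusTwo (s ℕ.+ (1 ℕ.+ s)) s (1 ℕ.+ s) ≈ Ψ s ⊛ (C 1ℤ ⊕ ⊝ X^ (2 ℕ.+ s))
  π⊛intervalPlusTwo s = begin
    π ⊛ (I (suc m) ⊕ X^ s ⊕ X^ (1 ℕ.+ s))                     ≈⟨ distribute π (I (suc m)) (X^ s) (X^ (1 ℕ.+ s)) ⟩
    π ⊛ I (suc m) ⊕ π ⊛ (X^ s ⊕ X^ (1 ℕ.+ s))                 ≈⟨ Ring.+-congʳ (π⊛I (suc m)) ⟩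
    C 1ℤ ⊕ ⊝ X^ (suc m) ⊕ π ⊛ (X^ s ⊕ X^ (1 ℕ.+ s))           ≈⟨ Ring.+-congʳ (Ring.+-congˡ (Ring.-‿cong split)) ⟩
    C 1ℤ ⊕ ⊝ (X^ s ⊛ X^ (2 ℕ.+ s)) ⊕ π ⊛ (X^ s ⊕ X^ (1 ℕ.+ s)) ≈⟨ factorise X (X^ s) ⟩
    Ψ s ⊛ (C 1ℤ ⊕ ⊝ X^ (2 ℕ.+ s))                             ∎
    where
    open ≈-Reasoning
    m : ℕ
    m = s ℕ.+ (1 ℕ.+ s)
    split : X^ (suc m) ≈ X^ s ⊛ X^ (2 ℕ.+ s)
    split = Ring.trans (Ring.reflexive (cong X^_ (sym (ℕₚ.+-suc s (1 ℕ.+ s))))) (X^-+ s (2 ℕ.+ s))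
    distribute : ∀ p i y z → p ⊛ (i ⊕ y ⊕ z) ≈ p ⊛ i ⊕ p ⊛ (y ⊕ z)
    distribute = solve 4 (λ p i y z → p :* (i :+ y :+ z) := p :* i :+ p :* (y :+ z)) ≈-refl
    factorise : ∀ x y → C 1ℤ ⊕ ⊝ (y ⊛ (x ⊛ (x ⊛ y))) ⊕ (C 1ℤ ⊕ ⊝ x) ⊛ (y ⊕ x ⊛ y) ≈ (C 1ℤ ⊕ y) ⊛ (C 1ℤ ⊕ ⊝ (x ⊛ (x ⊛ y)))
    factorise = solve 2 (λ x y → con 1ℤ :- y :* (x :* (x :* y)) :+ (con 1ℤ :- x) :* (y :+ x :* y) := (con 1ℤ :+ y) :* (con 1ℤ :- x :* (x :* y))) ≈-refl

  -- The equation asks for t(x²) / t(x) = (1 + x^s)(1 - x^(2^h)) / (1 - x). The factor 1 - x^s of t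
  -- accounts for 1 + x^s, and `τ h` accounts for the rest.
  solution-functional : ∀ h s → 2 ^ h ≡ 2 ℕ.+ s → FunctionalEquation (solution h s) (intervalPlusTwo (s ℕ.+ (1 ℕ.+ s)) s (1 ℕ.+ s))
  solution-functional h s 2^h≡ = ⊛-cancelˡ π coeff-π-0 (begin
    π ⊛ (solution h s ⊛ P)
      ≈⟨ commute π (solution h s) P ⟩
    solution h s ⊛ (π ⊛ P)
      ≈⟨ Ring.*-congˡ (π⊛intervalPlusTwo s) ⟩
    (C 1ℤ ⊕ ⊝ X^ s) ⊛ τ h ⊛ (Ψ s ⊛ (C 1ℤ ⊕ ⊝ X^ (2 ℕ.+ s)))
      ≡⟨ cong (λ N → (C 1ℤ ⊕ ⊝ X^ s) ⊛ τ h ⊛ (Ψ s ⊛ (C 1ℤ ⊕ ⊝ X^ N))) 2^h≡ ⟨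
    (C 1ℤ ⊕ ⊝ X^ s) ⊛ τ h ⊛ (Ψ s ⊛ (C 1ℤ ⊕ ⊝ X^ (2 ^ h)))
      ≈⟨ regroup (X^ s) (τ h) (C 1ℤ ⊕ ⊝ X^ (2 ^ h)) ⟩
    (C 1ℤ ⊕ ⊝ (X^ s ⊛ X^ s)) ⊛ (τ h ⊛ (C 1ℤ ⊕ ⊝ X^ (2 ^ h)))
      ≈⟨ Ring.*-congˡ (τ-suc h) ⟨
    (C 1ℤ ⊕ ⊝ (X^ s ⊛ X^ s)) ⊛ (π ⊛ τ h [X²])
      ≈⟨ Ring.*-congʳ (Ring.trans ([X²]-⊕ (C 1ℤ) _) (Ring.+-cong ([X²]-C 1ℤ) (Ring.trans ([X²]-⊝ (X^ s)) (Ring.-‿cong (Ring.trans ([X²]-X^ s) (X^-+ s s)))))) ⟨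
    (C 1ℤ ⊕ ⊝ X^ s) [X²] ⊛ (π ⊛ τ h [X²])
      ≈⟨ commute ((C 1ℤ ⊕ ⊝ X^ s) [X²]) π (τ h [X²]) ⟩
    π ⊛ ((C 1ℤ ⊕ ⊝ X^ s) [X²] ⊛ τ h [X²])
      ≈⟨ Ring.*-congˡ ([X²]-⊛ (C 1ℤ ⊕ ⊝ X^ s) (τ h)) ⟨
    π ⊛ solution h s [X²] ∎)
    where
    open ≈-Reasoning
    P : Poly
    P = intervalPlusTwo (s ℕ.+ (1 ℕ.+ s)) s (1 ℕ.+ s)
    commute : ∀ p q r → p ⊛ (q ⊛ r) ≈ q ⊛ (p ⊛ r)
    commute = solve 3 (λ p q r → p :* (q :* r) := q :* (p :* r)) ≈-refl
    regroup : ∀ y t z → (C 1ℤ ⊕ ⊝ y) ⊛ t ⊛ ((C 1ℤ ⊕ y) ⊛ z) ≈ (C 1ℤ ⊕ ⊝ (y ⊛ y)) ⊛ (t ⊛ z)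
    regroup = solve 3 (λ y t z → (con 1ℤ :- y) :* t :* ((con 1ℤ :+ y) :* z) := (con 1ℤ :- y :* y) :* (t :* z)) ≈-refl

  -- 2^h - 1, written as h binary digits 1.
  ones : ℕ → ℕ
  ones zero    = 0
  ones (suc h) = suc (ones h ℕ.* 2)

  2^h≡1+ones : ∀ h → 2 ^ h ≡ suc (ones h)
  2^h≡1+ones zero    = refl
  2^h≡1+ones (suc h) = trans (cong (2 ℕ.*_) (2^h≡1+ones h)) (ℕₚ.*-comm 2 (suc (ones h)))

  isOdd : ℕ → Bool
  isOdd zero    = false
  isOdd (suc n) = not (isOdd n)

  oddOnes-ones : ∀ h → oddOnes (ones h) ≡ isOdd h
  oddOnes-ones zero    = refl
  oddOnes-ones (suc h) = trans (oddOnes-odd (ones h)) (cong not (oddOnes-ones h))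

  isOdd-double : ∀ l → isOdd (2 ℕ.* l) ≡ false
  isOdd-double l = subst (λ n → isOdd (l ℕ.+ n) ≡ false) (sym (ℕₚ.+-identityʳ l)) (double l)
    where
    double : ∀ l → isOdd (l ℕ.+ l) ≡ false
    double zero    = refl
    double (suc l) = trans (cong (not ∘ isOdd) (ℕₚ.+-suc l l)) (trans (𝔹ₚ.not-involutive (isOdd (l ℕ.+ l))) (double l))

  isOdd-false : ∀ n → isOdd n ≡ false → ∃ λ l → n ≡ 2 ℕ.* l
  isOdd-false n even = case parity n of λ
    { (q , inj₁ n≡) → q , trans n≡ (ℕₚ.*-comm q 2)
    ; (q , inj₂ n≡) → contradiction (trans (sym even) (trans (cong isOdd n≡) (cong not (trans (cong isOdd (ℕₚ.*-comm q 2)) (isOdd-double q))))) λ () }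

  -- In binary 2^(g+1) - 2 is g ones followed by a zero, and its successor is g + 1 ones.
  oddOnes-2^-2 : ∀ g s → 2 ^ suc g ≡ 2 ℕ.+ s → oddOnes s ≡ isOdd g × oddOnes (1 ℕ.+ s) ≡ not (isOdd g)
  oddOnes-2^-2 g s 2^h≡ = trans (cong oddOnes s≡) (trans (oddOnes-even (ones g)) (oddOnes-ones g))
                        , trans (cong (oddOnes ∘ suc) s≡) (oddOnes-ones (suc g))
    where
    s≡ : s ≡ ones g ℕ.* 2
    s≡ = ℕₚ.suc-injective (ℕₚ.suc-injective (trans (sym 2^h≡) (2^h≡1+ones (suc g))))

  coeff₀-τ : ∀ h → coeff (τ h) 0 ≡ 1ℤ
  coeff₀-τ zero    = coeff-C 1ℤ 0
  coeff₀-τ (suc h) = trans (coeff-π⊛[X²]-even (τ h) 0) (coeff₀-τ h)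

  coeff-solution : ∀ h s n → coeff (solution h s) n ≡ coeff (τ h) n + - coeff (X^ s ⊛ τ h) n
  coeff-solution h s n = trans (at (solve 2 (λ y t → (con 1ℤ :- y) :* t := t :- y :* t) ≈-refl (X^ s) (τ h)) n)
    (trans (coeff-⊕ (τ h) _ n) (cong (_+_ (coeff (τ h) n)) (coeff-⊝ (X^ s ⊛ τ h) n)))

  <ᵇ-true : ∀ {i j} → i < j → (i ℕ.<ᵇ j) ≡ true
  <ᵇ-true {zero}  (s≤s _)   = refl
  <ᵇ-true {suc i} (s≤s i<j) = <ᵇ-true i<j

  -- At index s the solution has coefficient τ_s - τ_0 = ±1 - 1, which vanishes only for the plus
  -- sign.
  solution-zero⇒oddOnes : ∀ h s → s < 2 ^ h → coeff (solution h s) s ≡ 0ℤ → oddOnes s ≡ false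
  solution-zero⇒oddOnes h s s<2^h eq = decide (oddOnes s) (ℤₚ.i-j≡0⇒i≡j (signed (oddOnes s) true) 1ℤ (trans (sym expand) eq))
    where
    expand : coeff (solution h s) s ≡ signed (oddOnes s) true + - 1ℤ
    expand = trans (coeff-solution h s s) (cong₂ (λ a b → a + - b)
      (trans (coeff-τ h s) (cong (signed (oddOnes s)) (<ᵇ-true s<2^h)))
      (trans (cong (coeff (X^ s ⊛ τ h)) (sym (ℕₚ.+-identityʳ s))) (trans (X^-coeff s (τ h) 0) (coeff₀-τ h))))
    decide : ∀ b → signed b true ≡ 1ℤ → b ≡ false
    decide false _ = refl

  -- The two sets

  fromSet : (S : NSet) (d : ℕ) → (∀ n → d ≤ n → S n ≡ false) → Poly
  fromSet S d S-bounded = poly (indicator S) d λ n d≤n → cong ι (S-bounded n d≤n)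

  trunc-bounded : ∀ h X n → 2 ^ h ≤ n → trunc h X n ≡ false
  trunc-bounded h X n le = trans (cong (X n ∧_) (<ᵇ-false le)) (𝔹ₚ.∧-zeroʳ (X n))

  ι-∨ : ∀ a b → ι (a ∨ b) + ι (a ∧ b) ≡ ι a + ι b
  ι-∨ true  true  = refl
  ι-∨ true  false = refl
  ι-∨ false true  = refl
  ι-∨ false false = refl

  ι-∨-disjoint : ∀ a b → a ∧ b ≡ false → ι (a ∨ b) ≡ ι a + ι b
  ι-∨-disjoint a b disjoint = trans (sym (ℤₚ.+-identityʳ _)) (trans (cong (_+_ (ι (a ∨ b))) (cong ι (sym disjoint))) (ι-∨ a b))

  ι-injective : ∀ {a b} → ι a ≡ ι b → a ≡ b
  ι-injective {true}  {true}  _ = refl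
  ι-injective {false} {false} _ = refl

  coeff-X^⊛-shift : ∀ s Y p → (∀ n → coeff p n ≡ ι (Y n)) → ∀ n → coeff (X^ s ⊛ p) n ≡ ι (shift s Y n)
  coeff-X^⊛-shift zero    Y p p≡ n       = trans (at (Ring.*-identityˡ p) n) (p≡ n)
  coeff-X^⊛-shift (suc s) Y p p≡ zero    = trans (at (Ring.*-assoc X (X^ s) p) 0) (coeff-X⊛ (X^ s ⊛ p) 0)
  coeff-X^⊛-shift (suc s) Y p p≡ (suc n) = trans (at (Ring.*-assoc X (X^ s) p) (suc n)) (trans (coeff-X⊛ (X^ s ⊛ p) (suc n))
    (trans (coeff-X^⊛-shift s Y p p≡ n) (cong (λ b → ι (b ∧ Y (n ℕ.∸ s))) (≤ᵇ-suc s n))))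
    where
    ≤ᵇ-suc : ∀ s n → (s ℕ.≤ᵇ n) ≡ (suc s ℕ.≤ᵇ suc n)
    ≤ᵇ-suc zero    n = refl
    ≤ᵇ-suc (suc s) n = refl

  -- As 2^h = s + 2, the ranges [0, s + 1] and s + [0, s + 1] overlap in s and s + 1 only, so two
  -- checks suffice.
  trunc-shift-disjoint : ∀ h s → 2 ^ h ≡ 2 ℕ.+ s → ∀ X Y → X s ∧ Y 0 ≡ false → X (1 ℕ.+ s) ∧ Y 1 ≡ false →
                         ∀ n → trunc h X n ∧ shift s (trunc h Y) n ≡ false
  trunc-shift-disjoint h s 2^h≡ X Y at₀ at₁ n = position (ℕₚ.<-≤-connex n s)
    where
    absorb : ∀ x p y q r → x ∧ y ≡ false → (x ∧ p) ∧ (r ∧ (y ∧ q)) ≡ false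
    absorb true  p false q r _ = trans (cong (p ∧_) (𝔹ₚ.∧-zeroʳ r)) (𝔹ₚ.∧-zeroʳ p)
    absorb false p y     q r _ = refl
    offset : ∀ i → trunc h X (i ℕ.+ s) ∧ shift s (trunc h Y) (i ℕ.+ s) ≡ false
    offset i = trans (cong (λ j → trunc h X (i ℕ.+ s) ∧ ((s ℕ.≤ᵇ i ℕ.+ s) ∧ trunc h Y j)) (ℕₚ.m+n∸n≡m i s)) (collide i)
      where
      collide : ∀ i → trunc h X (i ℕ.+ s) ∧ ((s ℕ.≤ᵇ i ℕ.+ s) ∧ trunc h Y i) ≡ false
      collide zero          = absorb (X s) (s ℕ.<ᵇ 2 ^ h) (Y 0) (0 ℕ.<ᵇ 2 ^ h) (s ℕ.≤ᵇ s) at₀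
      collide (suc zero)    = absorb (X (1 ℕ.+ s)) (suc s ℕ.<ᵇ 2 ^ h) (Y 1) (1 ℕ.<ᵇ 2 ^ h) (s ℕ.≤ᵇ suc s) at₁
      collide (suc (suc i)) = cong (_∧ ((s ℕ.≤ᵇ 2 ℕ.+ i ℕ.+ s) ∧ trunc h Y (2 ℕ.+ i))) (trunc-bounded h X (2 ℕ.+ i ℕ.+ s)
        (subst (_≤ 2 ℕ.+ i ℕ.+ s) (sym 2^h≡) (s≤s (s≤s (ℕₚ.m≤n+m s i)))))
    position : n < s ⊎ s ≤ n → trunc h X n ∧ shift s (trunc h Y) n ≡ false
    position (inj₁ n<s) = trans (cong (λ b → trunc h X n ∧ (b ∧ trunc h Y (n ℕ.∸ s))) (≤ᵇ-false n<s)) (𝔹ₚ.∧-zeroʳ (trunc h X n))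
      where
      ≤ᵇ-false : ∀ {s n} → n < s → (s ℕ.≤ᵇ n) ≡ false
      ≤ᵇ-false {suc s} (s≤s n≤s) = <ᵇ-false n≤s
    position (inj₂ s≤n) = subst (λ n → trunc h X n ∧ shift s (trunc h Y) n ≡ false) (ℕₚ.m∸n+n≡m s≤n) (offset (n ℕ.∸ s))

  module Candidate (h s : ℕ) (2^h≡ : 2 ^ h ≡ 2 ℕ.+ s) (even-s : oddOnes s ≡ false) (odd-1+s : oddOnes (1 ℕ.+ s) ≡ true) where

    C₀ D₀ : NSet
    C₀ = A_ h ∪ˢ shift s (B_ h)
    D₀ = B_ h ∪ˢ shift s (A_ h)

    private
      a b : Poly
      a = fromSet (A_ h) (2 ^ h) (trunc-bounded h A)
      b = fromSet (B_ h) (2 ^ h) (trunc-bounded h B)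

      a-b≈τ : a ⊕ ⊝ b ≈ τ h
      a-b≈τ = coeffs λ n → trans (coeff-⊕ a (⊝ b) n) (trans (cong (_+_ (ι (A_ h n))) (coeff-⊝ b n)) (sym (coeff-τ h n)))

      a+b≈I : a ⊕ b ≈ I (2 ^ h)
      a+b≈I = coeffs λ n → trans (coeff-⊕ a b n) (trans (partition (oddOnes n) (n ℕ.<ᵇ 2 ^ h)) (sym (coeff-I (2 ^ h) n)))
        where
        partition : ∀ x c → ι (not x ∧ c) + ι (x ∧ c) ≡ ι c
        partition true  c = ℤₚ.+-identityˡ (ι c)
        partition false c = ℤₚ.+-identityʳ (ι c)

      c₀ d₀ : Poly
      c₀ = a ⊕ X^ s ⊛ b
      d₀ = b ⊕ X^ s ⊛ a

      union-coeff : ∀ X Y (p q : Poly) → (∀ n → coeff p n ≡ ι (trunc h X n)) → (∀ n → coeff q n ≡ ι (trunc h Y n)) →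
                    X s ∧ Y 0 ≡ false → X (1 ℕ.+ s) ∧ Y 1 ≡ false →
                    ∀ n → coeff (p ⊕ X^ s ⊛ q) n ≡ ι ((trunc h X ∪ˢ shift s (trunc h Y)) n)
      union-coeff X Y p q p≡ q≡ at₀ at₁ n = trans (coeff-⊕ p _ n) (trans
        (cong₂ _+_ (p≡ n) (coeff-X^⊛-shift s (trunc h Y) q q≡ n))
        (sym (ι-∨-disjoint (trunc h X n) (shift s (trunc h Y) n) (trunc-shift-disjoint h s 2^h≡ X Y at₀ at₁ n))))

      c₀-coeff : ∀ n → coeff c₀ n ≡ ι (C₀ n)
      -- No collision at s because 0 is not in `B`, and none at s + 1 because s + 1 is not in `A`.
      c₀-coeff = union-coeff A B a b (λ _ → refl) (λ _ → refl) (𝔹ₚ.∧-zeroʳ (not (oddOnes s))) (cong (λ x → not x ∧ oddOnes 1) odd-1+s)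

      d₀-coeff : ∀ n → coeff d₀ n ≡ ι (D₀ n)
      d₀-coeff = union-coeff B A b a (λ _ → refl) (λ _ → refl) (cong (_∧ true) even-s) (𝔹ₚ.∧-zeroʳ (oddOnes (1 ℕ.+ s)))

    module _ (c d : Poly) (c-coeff : ∀ n → coeff c n ≡ ι (C₀ n)) (d-coeff : ∀ n → coeff d n ≡ ι (D₀ n)) where
      private
        c≈ : c ≈ c₀
        c≈ = coeffs λ n → trans (c-coeff n) (sym (c₀-coeff n))
        d≈ : d ≈ d₀
        d≈ = coeffs λ n → trans (d-coeff n) (sym (d₀-coeff n))

      candidate-difference : c ⊕ ⊝ d ≈ solution h s
      candidate-difference = begin
        c ⊕ ⊝ d                             ≈⟨ Ring.+-cong c≈ (Ring.-‿cong d≈) ⟩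
        c₀ ⊕ ⊝ d₀                           ≈⟨ collect a b (X^ s) ⟩
        (C 1ℤ ⊕ ⊝ X^ s) ⊛ (a ⊕ ⊝ b)         ≈⟨ Ring.*-congˡ a-b≈τ ⟩
        solution h s                        ∎
        where
        open ≈-Reasoning
        collect : ∀ a b y → a ⊕ y ⊛ b ⊕ ⊝ (b ⊕ y ⊛ a) ≈ (C 1ℤ ⊕ ⊝ y) ⊛ (a ⊕ ⊝ b)
        collect = solve 3 (λ a b y → a :+ y :* b :- (b :+ y :* a) := (con 1ℤ :- y) :* (a :- b)) ≈-refl

      -- The truncations of `A` and `B` partition an interval of length 2^h, so the sum is (1 + x^s)
      -- times that interval; after multiplication by 1 - x the two sides have the same
      -- factorisation.
      candidate-sum : c ⊕ d ≈ intervalPlusTwo (s ℕ.+ (1 ℕ.+ s)) s (1 ℕ.+ s)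
      candidate-sum = ⊛-cancelˡ π coeff-π-0 (begin
        π ⊛ (c ⊕ d)                         ≈⟨ Ring.*-congˡ (Ring.+-cong c≈ d≈) ⟩
        π ⊛ (c₀ ⊕ d₀)                       ≈⟨ collect π a b (X^ s) ⟩
        Ψ s ⊛ (π ⊛ (a ⊕ b))                 ≈⟨ Ring.*-congˡ (Ring.*-congˡ a+b≈I) ⟩
        Ψ s ⊛ (π ⊛ I (2 ^ h))               ≈⟨ Ring.*-congˡ (π⊛I (2 ^ h)) ⟩
        Ψ s ⊛ (C 1ℤ ⊕ ⊝ X^ (2 ^ h))         ≡⟨ cong (λ N → Ψ s ⊛ (C 1ℤ ⊕ ⊝ X^ N)) 2^h≡ ⟩
        Ψ s ⊛ (C 1ℤ ⊕ ⊝ X^ (2 ℕ.+ s))       ≈⟨ π⊛intervalPlusTwo s ⟨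
        π ⊛ intervalPlusTwo (s ℕ.+ (1 ℕ.+ s)) s (1 ℕ.+ s) ∎)
        where
        open ≈-Reasoning
        collect : ∀ p a b y → p ⊛ (a ⊕ y ⊛ b ⊕ (b ⊕ y ⊛ a)) ≈ (C 1ℤ ⊕ y) ⊛ (p ⊛ (a ⊕ b))
        collect = solve 4 (λ p a b y → p :* (a :+ y :* b :+ (b :+ y :* a)) := (con 1ℤ :+ y) :* (p :* (a :+ b))) ≈-refl

      candidate-functional : FunctionalEquation (c ⊕ ⊝ d) (c ⊕ d)
      candidate-functional = Ring.trans (Ring.*-cong candidate-difference candidate-sum)
        (Ring.trans (solution-functional h s 2^h≡) ([X²]-cong (Ring.sym candidate-difference)))

    -- Sum and difference determine both indicator polynomials, since 2 cancels in ℤ.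
    candidate-unique : ∀ {C₁ D₁} c d → (∀ n → coeff c n ≡ ι (C₁ n)) → (∀ n → coeff d n ≡ ι (D₁ n)) →
      c ⊕ ⊝ d ≈ solution h s → c ⊕ d ≈ intervalPlusTwo (s ℕ.+ (1 ℕ.+ s)) s (1 ℕ.+ s) → C₁ ≐ C₀ × D₁ ≐ D₀
    candidate-unique {C₁} {D₁} c d c-coeff d-coeff c-d≈ c+d≈ =
        (λ n → ι-injective (trans (sym (c-coeff n)) (trans (left n) (c₀-coeff n))))
      , (λ n → ι-injective (trans (sym (d-coeff n)) (trans (right n) (d₀-coeff n))))
      where
      halve : ∀ x x′ y y′ → x + y ≡ x′ + y′ → x + - y ≡ x′ + - y′ → x ≡ x′
      halve x x′ y y′ e e′ = ℤₚ.*-cancelˡ-≡ (+ 2) x x′ (trans (double x y) (trans (cong₂ _+_ e e′) (sym (double x′ y′))))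
        where
        double : ∀ x y → + 2 * x ≡ x + y + (x + - y)
        double = solve-∀
      sum : ∀ n → coeff c n + coeff d n ≡ coeff c₀ n + coeff d₀ n
      sum n = trans (sym (coeff-⊕ c d n)) (trans (at (Ring.trans c+d≈ (Ring.sym (candidate-sum c₀ d₀ c₀-coeff d₀-coeff))) n) (coeff-⊕ c₀ d₀ n))
      coeff-⊖ : ∀ p q n → coeff (p ⊕ ⊝ q) n ≡ coeff p n + - coeff q n
      coeff-⊖ p q n = trans (coeff-⊕ p _ n) (cong (_+_ (coeff p n)) (coeff-⊝ q n))
      difference : ∀ n → coeff c n + - coeff d n ≡ coeff c₀ n + - coeff d₀ n
      difference n = trans (sym (coeff-⊖ c d n)) (trans (at (Ring.trans c-d≈ (Ring.sym (candidate-difference c₀ d₀ c₀-coeff d₀-coeff))) n) (coeff-⊖ c₀ d₀ n))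
      left : ∀ n → coeff c n ≡ coeff c₀ n
      left n = halve _ _ (coeff d n) (coeff d₀ n) (sum n) (difference n)
      right : ∀ n → coeff d n ≡ coeff d₀ n
      right n = ∙-cancelˡ (coeff c n) _ _ (trans (sum n) (cong (_+ coeff d₀ n) (sym (left n))))

  count : Bool → ℕ
  count b = if b then 1 else 0

  count-injective : ∀ {a b} → count a ≡ count b → a ≡ b
  count-injective {true}  {true}  _ = refl
  count-injective {false} {false} _ = refl

  -- For the sums 1 and 2 the only pair of distinct summands contains 0, so membership of 1 and 2
  -- can be read off. This serves to exclude r₁ = 0.
  R-1 : ∀ S → S 0 ≡ true → R S 1 ≡ count (S 1)
  R-1 S 0∈S = trans (ℕₚ.+-identityʳ _) (cong (λ b → count (b ∧ S 1)) 0∈S)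

  R-2 : ∀ S → S 0 ≡ true → R S 2 ≡ count (S 2)
  R-2 S 0∈S = trans (R-step S 0) (trans (ℕₚ.+-identityʳ _) (cong (λ b → count (b ∧ S 2)) 0∈S))

  solution₀ : ∀ h s → 0 < s → coeff (solution h s) 0 ≡ 1ℤ
  solution₀ h (suc s) _ = trans (coeff₀-⊛ (C 1ℤ ⊕ ⊝ X^ (suc s)) (τ h)) (cong₂ _*_
    (trans (coeff-⊕ (C 1ℤ) _ 0) (cong₂ _+_ (coeff-C 1ℤ 0) (trans (coeff-⊝ (X^ (suc s)) 0) (cong -_ (coeff-X^-ι (suc s) 0)))))
    (coeff₀-τ h))

  -- The two directions of the equivalence

  module Setting (m : ℕ) (3≤m : 3 ≤ m) (C₁ D₁ : NSet) (r₁ r₂ : ℕ) (r₁<r₂ : r₁ < r₂)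
                 (union : (C₁ ∪ˢ D₁) ≐ interval m) (intersection : (C₁ ∩ˢ D₁) ≐ pair r₁ r₂)
                 (0∈C : C₁ 0 ≡ true) (2∣r₁ : 2 ℕ∣.∣ r₁) where

    bounded : ∀ n → m < n → C₁ n ≡ false × D₁ n ≡ false
    bounded n m<n = both-false (C₁ n) (D₁ n) (trans (union n) (outside m<n))
      where
      both-false : ∀ a b → a ∨ b ≡ false → a ≡ false × b ≡ false
      both-false false false _ = refl , refl
      outside : ∀ {m n} → m < n → (n ℕ.≤ᵇ m) ≡ false
      outside {n = suc n} (s≤s m≤n) = <ᵇ-false m≤n

    covered : ∀ n → n ≤ m → C₁ n ∨ D₁ n ≡ true
    covered n n≤m = trans (union n) (inside n≤m)
      where
      inside : ∀ {m n} → n ≤ m → (n ℕ.≤ᵇ m) ≡ true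
      inside {n = zero}  _   = refl
      inside {n = suc n} n<m = <ᵇ-true n<m

    both : ∀ n → (n ℕ.≡ᵇ r₁) ∨ (n ℕ.≡ᵇ r₂) ≡ true → C₁ n ≡ true × D₁ n ≡ true
    both n n∈pair = conjuncts (C₁ n) (D₁ n) (trans (intersection n) n∈pair)
      where
      conjuncts : ∀ a b → a ∧ b ≡ true → a ≡ true × b ≡ true
      conjuncts true true _ = refl , refl

    ≡ᵇ-refl : ∀ n → (n ℕ.≡ᵇ n) ≡ true
    ≡ᵇ-refl zero    = refl
    ≡ᵇ-refl (suc n) = ≡ᵇ-refl n

    r₁∈both : C₁ r₁ ≡ true × D₁ r₁ ≡ true
    r₁∈both = both r₁ (cong (_∨ (r₁ ℕ.≡ᵇ r₂)) (≡ᵇ-refl r₁))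

    r₂∈both : C₁ r₂ ≡ true × D₁ r₂ ≡ true
    r₂∈both = both r₂ (trans (cong ((r₂ ℕ.≡ᵇ r₁) ∨_) (≡ᵇ-refl r₂)) (𝔹ₚ.∨-zeroʳ (r₂ ℕ.≡ᵇ r₁)))

    r₂≤m : r₂ ≤ m
    r₂≤m = ℕₚ.≮⇒≥ λ m<r₂ → contradiction (trans (sym (proj₁ r₂∈both)) (proj₁ (bounded r₂ m<r₂))) λ ()

    c d t P : Poly
    c = fromSet C₁ (suc m) (λ n le → proj₁ (bounded n le))
    d = fromSet D₁ (suc m) (λ n le → proj₂ (bounded n le))
    t = c ⊕ ⊝ d
    P = intervalPlusTwo m r₁ r₂

    coeff-t : ∀ n → coeff t n ≡ ι (C₁ n) + - ι (D₁ n)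
    coeff-t n = trans (coeff-⊕ c _ n) (cong (_+_ (ι (C₁ n))) (coeff-⊝ d n))

    c+d≈P : c ⊕ d ≈ P
    c+d≈P = coeffs λ n → begin
      coeff (c ⊕ d) n                                      ≡⟨ coeff-⊕ c d n ⟩
      ι (C₁ n) + ι (D₁ n)                                  ≡⟨ ι-∨ (C₁ n) (D₁ n) ⟨
      ι (C₁ n ∨ D₁ n) + ι (C₁ n ∧ D₁ n)                    ≡⟨ cong₂ (λ a b → ι a + ι b) (trans (union n) (≤ᵇ⇒<ᵇ n)) (intersection n) ⟩
      ι (n ℕ.<ᵇ suc m) + ι (pair r₁ r₂ n)                  ≡⟨ cong (_+_ (ι (n ℕ.<ᵇ suc m))) (ι-∨-disjoint (n ℕ.≡ᵇ r₁) (n ℕ.≡ᵇ r₂) (distinct n r₁ r₂ (ℕₚ.<⇒≢ r₁<r₂))) ⟩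
      ι (n ℕ.<ᵇ suc m) + (ι (n ℕ.≡ᵇ r₁) + ι (n ℕ.≡ᵇ r₂))   ≡⟨ ℤₚ.+-assoc (ι (n ℕ.<ᵇ suc m)) (ι (n ℕ.≡ᵇ r₁)) (ι (n ℕ.≡ᵇ r₂)) ⟨
      ι (n ℕ.<ᵇ suc m) + ι (n ℕ.≡ᵇ r₁) + ι (n ℕ.≡ᵇ r₂)     ≡⟨ coeff-intervalPlusTwo m r₁ r₂ n ⟨
      coeff P n                                            ∎
      where
      open ≡-Reasoning
      ≤ᵇ⇒<ᵇ : ∀ n → (n ℕ.≤ᵇ m) ≡ (n ℕ.<ᵇ suc m)
      ≤ᵇ⇒<ᵇ zero    = refl
      ≤ᵇ⇒<ᵇ (suc n) = refl
      distinct : ∀ n a b → a ≢ b → (n ℕ.≡ᵇ a) ∧ (n ℕ.≡ᵇ b) ≡ false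
      distinct zero    zero    zero    a≢b = contradiction refl a≢b
      distinct zero    zero    (suc b) a≢b = refl
      distinct zero    (suc a) b       a≢b = refl
      distinct (suc n) zero    b       a≢b = refl
      distinct (suc n) (suc a) zero    a≢b = 𝔹ₚ.∧-zeroʳ (n ℕ.≡ᵇ a)
      distinct (suc n) (suc a) (suc b) a≢b = distinct n a b (a≢b ∘ cong suc)

    module _ (R≡ : ∀ n → R C₁ n ≡ R D₁ n) where

      -- If r₁ = 0, then 0 lies in both sets, and equality of R at 1 and at 2 makes the sets agree
      -- at 1 and 2. Both numbers are covered by the union, so both lie in the intersection and
      -- equal r₂.
      r₁≢0 : r₁ ≢ 0
      r₁≢0 r₁≡0 = contradiction (trans (shared⇒≡r₂ 1 1≤m (shared 1 (R-1 C₁ 0∈C) (R-1 D₁ 0∈D)))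
                                       (sym (shared⇒≡r₂ 2 2≤m (shared 2 (R-2 C₁ 0∈C) (R-2 D₁ 0∈D))))) λ ()
        where
        1≤m : 1 ≤ m
        1≤m = ℕₚ.≤-trans (s≤s z≤n) 3≤m
        2≤m : 2 ≤ m
        2≤m = ℕₚ.≤-trans (s≤s (s≤s z≤n)) 3≤m
        0∈D : D₁ 0 ≡ true
        0∈D = subst (λ n → D₁ n ≡ true) r₁≡0 (proj₂ r₁∈both)
        shared : ∀ n → R C₁ n ≡ count (C₁ n) → R D₁ n ≡ count (D₁ n) → C₁ n ≡ D₁ n
        shared n R-C R-D = count-injective (trans (sym R-C) (trans (R≡ n) R-D))
        shared⇒≡r₂ : ∀ n → .{{NonZero n}} → n ≤ m → C₁ n ≡ D₁ n → n ≡ r₂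
        shared⇒≡r₂ (suc n) n≤m C≡D = ℕₚ.≡ᵇ⇒≡ (suc n) r₂ (subst T (sym hit) _)
          where
          same : ∀ a b → a ≡ b → a ∨ b ≡ true → a ∧ b ≡ true
          same true b refl _ = refl
          hit : (suc n ℕ.≡ᵇ r₂) ≡ true
          hit = trans (cong (λ r → (suc n ℕ.≡ᵇ r) ∨ (suc n ℕ.≡ᵇ r₂)) (sym r₁≡0))
                      (trans (sym (intersection (suc n))) (same _ _ C≡D (covered (suc n) n≤m)))

      0<r₁ : 0 < r₁
      0<r₁ = ℕₚ.n≢0⇒n>0 r₁≢0

      t₀≡1 : coeff t 0 ≡ 1ℤ
      t₀≡1 = trans (coeff-t 0) (cong₂ (λ a b → ι a + - ι b) 0∈C 0∉D)
        where
        0∉D : D₁ 0 ≡ false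
        0∉D = trans (cong (_∧ D₁ 0) (sym 0∈C)) (trans (intersection 0)
          (cong₂ _∨_ (≡ᵇ-false (ℕₚ.<⇒≢ 0<r₁)) (≡ᵇ-false (ℕₚ.<⇒≢ (ℕₚ.<-trans 0<r₁ r₁<r₂)))))

      t-vanish : ∀ n → m < n → coeff t n ≡ 0ℤ
      t-vanish n m<n = trans (coeff-t n) (cong₂ (λ a b → ι a + - ι b) (proj₁ (bounded n m<n)) (proj₂ (bounded n m<n)))

      functional : FunctionalEquation t P
      functional = Ring.trans (Ring.*-congˡ (Ring.sym c+d≈P)) (R≡⇒functional C₁ D₁ c d (λ _ → refl) (λ _ → refl) R≡)

      necessity-at : ∀ g → 2 ^ suc g ≡ 2 ℕ.+ r₁ → P ≡ intervalPlusTwo (r₁ ℕ.+ (1 ℕ.+ r₁)) r₁ (1 ℕ.+ r₁) →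
                     ∃ λ l → g ≡ 2 ℕ.* l ×
                     C₁ ≐ (A_ (suc g) ∪ˢ shift r₁ (B_ (suc g))) × D₁ ≐ (B_ (suc g) ∪ˢ shift r₁ (A_ (suc g)))
      necessity-at g 2^h≡ P≡ =
        let even-g        = trans (sym (proj₁ (oddOnes-2^-2 g r₁ 2^h≡))) even-r₁
            odd-1+r₁      = trans (proj₂ (oddOnes-2^-2 g r₁ 2^h≡)) (cong not even-g)
            (l , g≡2l)    = isOdd-false g even-g
        in l , g≡2l , Candidate.candidate-unique (suc g) r₁ 2^h≡ even-r₁ odd-1+r₁ {C₁} {D₁} c d (λ _ → refl) (λ _ → refl)
                        t≈solution (Ring.trans c+d≈P (Ring.reflexive P≡))
        where
        t≈solution : t ≈ solution (suc g) r₁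
        t≈solution = functional-unique {t} {solution (suc g) r₁} {P}
          (intervalPlusTwo-0 {m} {r₁} {r₂} 0<r₁ (ℕₚ.<-trans 0<r₁ r₁<r₂)) (trans t₀≡1 (sym (solution₀ (suc g) r₁ 0<r₁)))
          functional (subst (FunctionalEquation (solution (suc g) r₁)) (sym P≡) (solution-functional (suc g) r₁ 2^h≡))
        -- `r₁` lies in both sets, so `t` has coefficient zero there. Compared with the explicit
        -- solution, this forces an even number of binary ones in `r₁`.
        even-r₁ : oddOnes r₁ ≡ false
        even-r₁ = solution-zero⇒oddOnes (suc g) r₁ (subst (r₁ <_) (sym 2^h≡) (s≤s (ℕₚ.n≤1+n r₁)))
          (trans (sym (at t≈solution r₁)) (trans (coeff-t r₁) (cong₂ (λ a b → ι a + - ι b) (proj₁ r₁∈both) (proj₂ r₁∈both))))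

      necessity : Σ ℕ (λ l → 1 ≤ l ×
        (r₁ ≡ 2 ^ (2 ℕ.* l ℕ.+ 1) ℕ.∸ 2) × (r₂ ≡ 2 ^ (2 ℕ.* l ℕ.+ 1) ℕ.∸ 1) ×
        (m ≡ 2 ^ (2 ℕ.* l ℕ.+ 2) ℕ.∸ 3) ×
        (C₁ ≐ (A_ (2 ℕ.* l ℕ.+ 1) ∪ˢ shift (2 ^ (2 ℕ.* l ℕ.+ 1) ℕ.∸ 2) (B_ (2 ℕ.* l ℕ.+ 1)))) ×
        (D₁ ≐ (B_ (2 ℕ.* l ℕ.+ 1) ∪ˢ shift (2 ^ (2 ℕ.* l ℕ.+ 1) ℕ.∸ 2) (A_ (2 ℕ.* l ℕ.+ 1)))))
      necessity = from-parameters (functional-equation⇒parameters m r₁ r₂ r₁<r₂ r₂≤m 0<r₁ 2∣r₁ t t₀≡1 t-vanish functional)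
        where
        from-parameters : (∃ λ h → 3 ℕ.+ m ≡ 2 ^ suc h × r₂ ≡ 1 ℕ.+ r₁ × m ≡ r₁ ℕ.+ r₂) → _
        from-parameters (h , 3+m≡ , r₂≡ , m≡) = from-exponent h 3+m≡ 2^h≡
          where
          m≡′ : m ≡ r₁ ℕ.+ (1 ℕ.+ r₁)
          m≡′ = trans m≡ (cong (r₁ ℕ.+_) r₂≡)
          2^h≡ : 2 ^ h ≡ 2 ℕ.+ r₁
          2^h≡ = ℕₚ.*-cancelˡ-≡ (2 ^ h) (2 ℕ.+ r₁) 2 (trans (sym 3+m≡) (trans (cong (3 ℕ.+_) m≡′) (double r₁)))
            where
            double : ∀ s → 3 ℕ.+ (s ℕ.+ (1 ℕ.+ s)) ≡ 2 ℕ.* (2 ℕ.+ s)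
            double = ℕ-solve-∀
          P≡ : P ≡ intervalPlusTwo (r₁ ℕ.+ (1 ℕ.+ r₁)) r₁ (1 ℕ.+ r₁)
          P≡ = cong₂ (λ m r₂ → intervalPlusTwo m r₁ r₂) m≡′ r₂≡
          from-exponent : ∀ h → 3 ℕ.+ m ≡ 2 ^ suc h → 2 ^ h ≡ 2 ℕ.+ r₁ → _
          from-exponent (suc g) 3+m≡ 2^h≡ = from-half (necessity-at g 2^h≡ P≡)
            where
            from-half : (∃ λ l → g ≡ 2 ℕ.* l × C₁ ≐ (A_ (suc g) ∪ˢ shift r₁ (B_ (suc g))) × D₁ ≐ (B_ (suc g) ∪ˢ shift r₁ (A_ (suc g)))) → _
            -- l = 0 would mean 2 = 2 + r₁, and r₁ = 0 is already excluded.
            from-half (zero  , refl , _)       = contradiction (ℕₚ.suc-injective (ℕₚ.suc-injective (sym 2^h≡))) r₁≢0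
            from-half (suc l , g≡ , C≐ , D≐) = suc l , s≤s z≤n
              , trans r₁≡ (cong (λ h → 2 ^ h ℕ.∸ 2) h≡)
              , trans r₂≡ (trans (cong (ℕ._∸ 1) (sym 2^h≡)) (cong (λ h → 2 ^ h ℕ.∸ 1) h≡))
              , trans (cong (ℕ._∸ 3) 3+m≡) (cong (λ h → 2 ^ h ℕ.∸ 3) 1+h≡)
              , subst (λ h → C₁ ≐ (A_ h ∪ˢ shift (2 ^ h ℕ.∸ 2) (B_ h))) h≡ (subst (λ s → C₁ ≐ (A_ (suc g) ∪ˢ shift s (B_ (suc g)))) r₁≡ C≐)
              , subst (λ h → D₁ ≐ (B_ h ∪ˢ shift (2 ^ h ℕ.∸ 2) (A_ h))) h≡ (subst (λ s → D₁ ≐ (B_ (suc g) ∪ˢ shift s (A_ (suc g)))) r₁≡ D≐)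
              where
              r₁≡ : r₁ ≡ 2 ^ suc g ℕ.∸ 2
              r₁≡ = cong (ℕ._∸ 2) (sym 2^h≡)
              h≡ : suc g ≡ 2 ℕ.* suc l ℕ.+ 1
              h≡ = trans (cong suc g≡) (ℕₚ.+-comm 1 (2 ℕ.* suc l))
              1+h≡ : suc (suc g) ≡ 2 ℕ.* suc l ℕ.+ 2
              1+h≡ = trans (cong (2 ℕ.+_) g≡) (ℕₚ.+-comm 2 (2 ℕ.* suc l))

    sufficiency : ∀ l → r₁ ≡ 2 ^ (2 ℕ.* l ℕ.+ 1) ℕ.∸ 2 →
      C₁ ≐ (A_ (2 ℕ.* l ℕ.+ 1) ∪ˢ shift (2 ^ (2 ℕ.* l ℕ.+ 1) ℕ.∸ 2) (B_ (2 ℕ.* l ℕ.+ 1))) →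
      D₁ ≐ (B_ (2 ℕ.* l ℕ.+ 1) ∪ˢ shift (2 ^ (2 ℕ.* l ℕ.+ 1) ℕ.∸ 2) (A_ (2 ℕ.* l ℕ.+ 1))) →
      ∀ n → R C₁ n ≡ R D₁ n
    sufficiency l r₁≡ C≐ D≐ = functional⇒R≡ C₁ D₁ c d (λ _ → refl) (λ _ → refl)
      (Candidate.candidate-functional (suc (2 ℕ.* l)) r₁ 2^h≡ even-r₁ odd-1+r₁ c d (λ n → cong ι (C≐′ n)) (λ n → cong ι (D≐′ n)))
      where
      h≡ : 2 ℕ.* l ℕ.+ 1 ≡ suc (2 ℕ.* l)
      h≡ = ℕₚ.+-comm (2 ℕ.* l) 1
      s≡ : 2 ^ suc (2 ℕ.* l) ℕ.∸ 2 ≡ r₁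
      s≡ = trans (cong (λ h → 2 ^ h ℕ.∸ 2) (sym h≡)) (sym r₁≡)
      2^h≡ : 2 ^ suc (2 ℕ.* l) ≡ 2 ℕ.+ r₁
      2^h≡ = trans (sym (ℕₚ.m+[n∸m]≡n (ℕₚ.m≤m*n 2 (2 ^ (2 ℕ.* l)) {{ℕₚ.m^n≢0 2 (2 ℕ.* l)}}))) (cong (2 ℕ.+_) s≡)
      even-r₁ : oddOnes r₁ ≡ false
      even-r₁ = trans (proj₁ (oddOnes-2^-2 (2 ℕ.* l) r₁ 2^h≡)) (isOdd-double l)
      odd-1+r₁ : oddOnes (1 ℕ.+ r₁) ≡ true
      odd-1+r₁ = trans (proj₂ (oddOnes-2^-2 (2 ℕ.* l) r₁ 2^h≡)) (cong not (isOdd-double l))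
      C≐′ : C₁ ≐ (A_ (suc (2 ℕ.* l)) ∪ˢ shift r₁ (B_ (suc (2 ℕ.* l))))
      C≐′ = subst (λ s → C₁ ≐ (A_ (suc (2 ℕ.* l)) ∪ˢ shift s (B_ (suc (2 ℕ.* l))))) s≡
              (subst (λ h → C₁ ≐ (A_ h ∪ˢ shift (2 ^ h ℕ.∸ 2) (B_ h))) h≡ C≐)
      D≐′ : D₁ ≐ (B_ (suc (2 ℕ.* l)) ∪ˢ shift r₁ (A_ (suc (2 ℕ.* l))))
      D≐′ = subst (λ s → D₁ ≐ (B_ (suc (2 ℕ.* l)) ∪ˢ shift s (A_ (suc (2 ℕ.* l))))) s≡
              (subst (λ h → D₁ ≐ (B_ h ∪ˢ shift (2 ^ h ℕ.∸ 2) (A_ h))) h≡ D≐)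

open import Data.Nat using (ℕ; _+_; _*_; _∸_; _^_; _≤_; _<_)
open import Data.Nat.Divisibility using (divides)
open import Data.Nat.Properties using (*-comm)
open import Data.Bool using (true)
open import Data.Product using (Σ; _×_; _,_)
open import Relation.Binary.PropositionalEquality using (_≡_; trans)
open import Function.Bundles using (_⇔_; mk⇔)

theorem1p1 : (m : ℕ) → 3 ≤ m → (C D : NSet) → (r₁ r₂ : ℕ) → r₁ < r₂ →
    (C ∪ˢ D) ≐ interval m → (C ∩ˢ D) ≐ pair r₁ r₂ → C 0 ≡ true →
    Σ ℕ (λ k → r₁ ≡ 2 * k) →
    ((∀ n → R C n ≡ R D n) ⇔
    Σ ℕ (λ l → 1 ≤ l ×
    (r₁ ≡ 2 ^ (2 * l + 1) ∸ 2) × (r₂ ≡ 2 ^ (2 * l + 1) ∸ 1) ×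
    (m ≡ 2 ^ (2 * l + 2) ∸ 3) ×
    (C ≐ (A_ (2 * l + 1) ∪ˢ shift (2 ^ (2 * l + 1) ∸ 2) (B_ (2 * l + 1)))) ×
    (D ≐ (B_ (2 * l + 1) ∪ˢ shift (2 ^ (2 * l + 1) ∸ 2) (A_ (2 * l + 1))))))
theorem1p1 m 3≤m C D r₁ r₂ r₁<r₂ C∪D C∩D 0∈C (k , r₁≡2k) =
  mk⇔ necessity (λ (l , _ , r₁≡ , _ , _ , C≐ , D≐) → sufficiency l r₁≡ C≐ D≐)
  where open Theory.Setting m 3≤m C D r₁ r₂ r₁<r₂ C∪D C∩D 0∈C (divides k (trans r₁≡2k (*-comm 2 k)))
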